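{- Let $p$ be a prime number, let $s$ be a positive divisor of $p-1$, and let $\mathbb{K}$ be the unique subfield of $\mathbb{Q}(\zeta_p)$ with $[\mathbb{K}:\mathbb{Q}]=s$. Let $\mathcal{M}_p\subseteq\mathcal{O}_{\mathbb{K}}$ be the $\mathbb{Z}$-submodule defined in the context. Then $$[\mathcal{O}_{\mathbb{K}}:\mathcal{M}_p]=\begin{cases} p^{\frac{s+1}{2}} & \text{if } s\equiv 1\pmod 2,\\ p^{\frac{s+2}{2}} & \text{if } s\equiv 0\pmod 2.\end{cases}$$
   Context: Here $\zeta_p$ is a primitive $p$-th root of unity, $\mathbb{L}=\mathbb{Q}(\zeta_p)$, and $\mathcal{O}_{\mathbb{K}}$ is the ring of algebraic integers of $\mathbb{K}$. Let $u$ be an integer whose class generates $(\mathbb{Z}/p\mathbb{Z})^{\star}$, let $\sigma_u$ be the automorphism of $\mathbb{L}$ with $\sigma_u(\zeta_p)=\zeta_p^u$, let $\theta=\sigma_u|_{\mathbb{K}}$ (a generator of $\mathrm{Gal}(\mathbb{K}/\mathbb{Q})$), and let $t=\mathrm{Tr}_{\mathbb{L}/\mathbb{K}}(\zeta_p)$. The map $(a_0,\ldots,a_{s-1})\mapsto\sum_{i=0}^{s-1}a_i\theta^i(t)$ is an isomorphism of $\mathbb{Z}$-modules $\mathbb{Z}^s\to\mathcal{O}_{\mathbb{K}}$, and through it elements ${\bf x}\in\mathcal{O}_{\mathbb{K}}$ are identified with their coordinate vectors ${\bf x}=(a_0,\ldots,a_{s-1})\in\mathbb{Z}^s$. Let $\beta\in\mathbb{Z}$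 be a primitive root modulo $p$ (of multiplicative order $p-1$ modulo $p$), and put $\alpha=\beta^{(p-1)/s}$. For $i=0,1,\ldots,s-1$ let $\mu_i=(1,\alpha^i,\alpha^{2i},\ldots,\alpha^{(s-1)i})\in\mathbb{Z}^s$, and let $\cdot$ denote the usual dot product on $\mathbb{Z}^s$. Define: if $s$ is odd, $\mathcal{M}_p=\{{\bf x}\in\mathcal{O}_{\mathbb{K}}:{\bf x}\cdot\mu_i\equiv 0\pmod p\text{ for all } i=0,1,\ldots,\frac{s-1}{2}\}$; if $s$ is even, $\mathcal{M}_p=\{{\bf x}\in\mathcal{O}_{\mathbb{K}}:{\bf x}\cdot\mu_i\equiv 0\pmod p\text{ for all } i=0,1,\ldots,\frac{s}{2}\}$. -}

module Defs where

open import Algebra.Bundles using (CommutativeRing)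
open import Algebra.Morphism.Structures using (IsRingHomomorphism; IsRingIsomorphism)
open import Data.Fin.Base using (Fin; toℕ)
open import Data.Integer.Base as ℤ using (ℤ; +_; -[1+_])
import Data.Integer.Divisibility as ℤ
open import Data.Nat.Base as ℕ using (ℕ; suc; _∸_)
open import Data.Nat.DivMod using (_/_; _%_)
open import Data.Nat.GeneralisedArithmetic using (fold)
open import Data.Product using (Σ; ∃; ∃!; _×_)
open import Data.Rational.Base as ℚ using (ℚ)
open import Data.Vec.Functional using (Vector)
open import Level using (Level; _⊔_) renaming (suc to lsuc)
open import Relation.Binary.PropositionalEquality.Core using (_≡_)
open import Relation.Nullary.Negation.Core using (¬_)
open import Relation.Unary using (Pred; _∈_)

------------------------------------------------------------------------
-- Integers modulo p

infix 4 _≡_[mod_]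

_≡_[mod_] : ℤ → ℤ → ℕ → Set
a ≡ b [mod p ] = + p ℤ.∣ a ℤ.- b

-- The class of u lies in (ℤ/pℤ)* and generates it (p prime).  The group is
-- finite, so nonnegative exponents suffice.
record GeneratesUnits (p : ℕ) (u : ℤ) : Set where
  field
    unit      : ¬ u ≡ + 0 [mod p ]
    generates : ∀ a → ¬ a ≡ + 0 [mod p ] → ∃ λ k → a ≡ u ℤ.^ k [mod p ]

record HasOrderMod (p : ℕ) (β : ℤ) (n : ℕ) : Set where
  field
    power-one : β ℤ.^ n ≡ + 1 [mod p ]
    minimal   : ∀ k → 0 ℕ.< k → k ℕ.< n → ¬ β ℤ.^ k ≡ + 1 [mod p ]

open import Algebra.Definitions.RawMonoid ℤ.+-0-rawMonoid using () renaming (sum to ∑ℤ)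

infix 7 _·_

_·_ : ∀ {n} → Vector ℤ n → Vector ℤ n → ℤ
a · b = ∑ℤ λ j → a j ℤ.* b j

μ : ∀ {s} → ℤ → ℕ → Vector ℤ s
μ α i j = α ℤ.^ (toℕ j ℕ.* i)

-- The congruences defining 𝓜, on coordinate vectors.
record Congruences (p s : ℕ) (α : ℤ) (a : Vector ℤ s) : Set where
  field
    odd  : s % 2 ≡ 1 → ∀ i → i ℕ.≤ (s ∸ 1) / 2 → a · μ α i ≡ + 0 [mod p ]
    even : s % 2 ≡ 0 → ∀ i → i ℕ.≤ s / 2       → a · μ α i ≡ + 0 [mod p ]

module _ {c ℓ : Level} (L : CommutativeRing c ℓ) where

  open CommutativeRing L
  open import Algebra.Definitions.RawMonoid +-rawMonoid using (sum)
  open import Algebra.Properties.Semiring.Exp semiring using (_^_)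

  ----------------------------------------------------------------------
  -- Fields and subfields

  -- The library's Heyting fields carry an apartness relation; here
  -- "nonzero" is plain denial of equality.
  record IsField : Set (c ⊔ ℓ) where
    field
      1≉0     : ¬ 1# ≈ 0#
      inverse : ∀ x → ¬ x ≈ 0# → ∃ λ y → x * y ≈ 1#

  record IsSubfield {k} (K : Pred Carrier k) : Set (c ⊔ ℓ ⊔ k) where
    field
      resp      : ∀ {x y} → x ≈ y → x ∈ K → y ∈ K
      0#-closed : 0# ∈ K
      1#-closed : 1# ∈ K
      +-closed  : ∀ {x y} → x ∈ K → y ∈ K → x + y ∈ K
      -‿closed  : ∀ {x} → x ∈ K → - x ∈ K
      *-closed  : ∀ {x y} → x ∈ K → y ∈ K → x * y ∈ K
      inverse   : ∀ {x y} → x ∈ K → x * y ≈ 1# → y ∈ K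

  record IsPrimitiveRootOfUnity (n : ℕ) (ζ : Carrier) : Set ℓ where
    field
      power-one : ζ ^ n ≈ 1#
      minimal   : ∀ k → 0 ℕ.< k → k ℕ.< n → ¬ ζ ^ k ≈ 1#

  -- y = xᵘ for a unit x and a possibly negative exponent u.
  IsPower : Carrier → Carrier → ℤ → Set ℓ
  IsPower y x (+ n)    = y ≈ x ^ n
  IsPower y x -[1+ n ] = y * x ^ suc n ≈ 1#

  IsAutomorphism : (Carrier → Carrier) → Set (c ⊔ ℓ)
  IsAutomorphism = IsRingIsomorphism rawRing rawRing

  -- An enumeration, without repetition, of Gal(L/K).
  record IsGaloisGroup {k} (K : Pred Carrier k) {m : ℕ}
                       (g : Fin m → Carrier → Carrier) : Set (c ⊔ ℓ ⊔ k) where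
    field
      automorphism : ∀ i → IsAutomorphism (g i)
      fixes        : ∀ i {x} → x ∈ K → g i x ≈ x
      distinct     : ∀ i j → (∀ x → g i x ≈ g j x) → i ≡ j
      complete     : ∀ τ → IsAutomorphism τ → (∀ {x} → x ∈ K → τ x ≈ x) →
                     ∃ λ i → ∀ x → τ x ≈ g i x

  -- t = Tr_{L/K}(x), for L/K a finite Galois extension.
  IsTrace : ∀ {k} → Pred Carrier k → Carrier → Carrier → Set (c ⊔ ℓ ⊔ k)
  IsTrace K x t = Σ ℕ λ m → Σ (Fin m → Carrier → Carrier) λ g →
                  IsGaloisGroup K g × t ≈ sum (λ i → g i x)

  -- [A : B] = n for additive subgroups B ⊆ A of L: the elements rep i
  -- represent every coset of B in A exactly once.
  HasIndex : ∀ {a b} → Pred Carrier a → Pred Carrier b → ℕ → Set (c ⊔ a ⊔ b)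
  HasIndex A B n = Σ (Vector Carrier n) λ rep →
                   (∀ i → rep i ∈ A) ×
                   (∀ x → x ∈ A → ∃! _≡_ λ i → x - rep i ∈ B)

  module _ (ι : ℚ → Carrier) where

    -- L = ℚ(ζ) with ζ a primitive n-th root of unity, ι being the embedding
    -- of ℚ.  The quantification over subfields at level ℓ is not a
    -- restriction: the rational expressions in ζ form a subfield of that level.
    record IsCyclotomicField (n : ℕ) (ζ : Carrier) : Set (c ⊔ lsuc ℓ) where
      field
        isField         : IsField
        ι-homomorphism  : IsRingHomomorphism ℚ.+-*-rawRing rawRing ι
        rootOfUnity     : IsPrimitiveRootOfUnity n ζ
        generated       : (P : Pred Carrier ℓ) → IsSubfield P → ζ ∈ P → ∀ x → x ∈ P

    -- [K : ℚ] = n, witnessed by a ℚ-basis of K.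
    record HasDegree {k} (K : Pred Carrier k) (n : ℕ) : Set (c ⊔ ℓ ⊔ k) where
      field
        basis       : Vector Carrier n
        basis∈K     : ∀ i → basis i ∈ K
        spanning    : ∀ {x} → x ∈ K →
                      Σ (Vector ℚ n) λ q → x ≈ sum (λ i → ι (q i) * basis i)
        independent : ∀ (q : Vector ℚ n) → sum (λ i → ι (q i) * basis i) ≈ 0# →
                      ∀ i → q i ≡ ℚ.0ℚ

    fromℤ : ℤ → Carrier
    fromℤ a = ι (a ℚ./ 1)

    -- x is a root of a monic polynomial with integer coefficients.
    IsIntegral : Pred Carrier ℓ
    IsIntegral x = Σ ℕ λ n → Σ (Vector ℤ n) λ a →
                   x ^ n + sum (λ i → fromℤ (a i) * x ^ toℕ i) ≈ 0#

    𝓞 : ∀ {k} → Pred Carrier k → Pred Carrier (k ⊔ ℓ)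
    𝓞 K x = x ∈ K × IsIntegral x

    -- a is the coordinate vector of x in t, θ(t), …, θˢ⁻¹(t).  As t ∈ K, the
    -- powers of θ = σ|_K at t are those of σ.
    IsCoordinateVector : ∀ {s} → (Carrier → Carrier) → Carrier →
                         Carrier → Vector ℤ s → Set ℓ
    IsCoordinateVector σ t x a = x ≈ sum (λ i → fromℤ (a i) * fold t σ (toℕ i))

    𝓜 : ∀ {k} → Pred Carrier k → (σ : Carrier → Carrier) (t : Carrier)
        (p s : ℕ) (α : ℤ) → Pred Carrier (k ⊔ ℓ)
    𝓜 K σ t p s α x = x ∈ 𝓞 K ×
      (Σ (Vector ℤ s) λ a → IsCoordinateVector σ t x a × Congruences p s α a)

{-# OPTIONS --safe #-}
module Submission where

-- Only two facts about 𝓞 matter: the conjugates of t are a ℤ-basis of it, and s integers can be chosen so that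
-- the first m values of their Fourier transform modulo p at the s-th root of unity α are prescribed.
--
-- With R = ℤ[ζ] and π = ζ − 1, Nakayama's lemma gives 1 ∉ p R, hence 1 ∉ π R, and repeated division by π
-- makes 1, ζ, …, ζ^(p−2) independent.  An integral x lies in R: at a prime q ≠ p because a power of the
-- Frobenius map is the identity on R / q, and at p by stripping powers of π.
-- If d is the least positive exponent for which σᵈ fixes K, then Dedekind's independence of characters
-- gives d ≤ s and the d periods of ζ under σᵈ span the fixed field of σᵈ, so s ≤ d.  Hence d = s, the trace t
-- is a period, and comparing coefficients of σᵃ ζ yields the basis of 𝓞.

-- Neither the irreducibility of the cyclotomic polynomial nor decidable equality in `L` is given;
-- both have to come out of the arithmetic of `R`. Until the powers of `ζ` are known to be
-- independent, `R` is handled through p redundant generators, which is all that Nakayama's lemma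
-- needs. Minimality of `L`, applied to the elements that have an integer denominator, then gives
-- every element integer coordinates, and equality with zero becomes a question about integers.
-- Likewise `K` is only a predicate with a rational basis, and no Galois correspondence is at hand.
-- That a period lies in `K` follows by counting: `s + 1` elements in the span of `s` periods
-- satisfy a relation, which can be solved for the new element. Coset representatives must lie in 𝓞,
-- so `R` must also be shown integral, by the polynomial whose roots are the conjugates. In the end
-- 𝓜 is the kernel of the map from coordinates to `m` Fourier values modulo p, where `m` counts the
-- congruences. Surjectivity needs s invertible modulo p, which e s = p - 1 provides, and m ≤ s, so
-- that the powers of α involved are distinct. Hence the index is p^m.

open import Defs
open import Algebra.Bundles using (CommutativeRing)
import Algebra.Morphism.Construct.Composition as Composition
import Algebra.Morphism.Construct.Identity as Identity
open import Algebra.Morphism.Structures using (IsRingHomomorphism; IsRingIsomorphism)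
import Algebra.Solver.Ring
open import Algebra.Solver.Ring.AlmostCommutativeRing using (fromCommutativeRing; _-Raw-AlmostCommutative⟶_)
open import Data.Fin.Base as Fin using (Fin; zero; suc; toℕ; punchIn)
open import Data.Fin.Permutation using (Permutation; permutation)
import Data.Fin.Properties as Fin
open import Data.Integer.Base as ℤ using (ℤ; +_; -[1+_])
import Data.Integer.DivMod as ℤ
import Data.Integer.Divisibility.Signed as ℤ
import Data.Integer.Properties as ℤ
import Data.Integer.Solver
open import Data.List.Base using ([]; _∷_)
open import Data.List.Relation.Unary.All using (All; []; _∷_)
import Data.Maybe.Base as Maybe
open import Data.Nat.Base as ℕ using (ℕ; zero; suc; s≤s; z≤n; _!; _∸_)
open import Data.Nat.Combinatorics using (_C_; nCk≡n!/k![n-k]!; k![n∸k]!∣n!; nCn≡1; nC1≡n)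
import Data.Nat.Coprimality as ℕ
import Data.Nat.DivMod as ℕ
import Data.Nat.GCD as ℕ
import Data.Nat.Divisibility as ℕ
open import Data.Nat.GeneralisedArithmetic using (fold; fold-+)
open import Data.Nat.ListAction using (product)
open import Data.Nat.Primality using (Prime; euclidsLemma; prime⇒irreducible)
open import Data.Nat.Primality.Factorisation using (PrimeFactorisation; factorise)
import Data.Nat.Properties as ℕ
open import Data.Product using (∃!)
open import Data.Product.Base using (Σ; ∃; ∃₂; _×_; _,_; proj₁; proj₂)
open import Data.Rational.Base as ℚ using (ℚ; mkℚ)
import Data.Rational.Properties as ℚ
import Data.Rational.Unnormalised.Base as ℚᵘ
import Data.Rational.Unnormalised.Properties as ℚᵘ
open import Data.Sum.Base using (_⊎_; inj₁; inj₂; [_,_]′)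
open import Data.Vec.Functional using (insertAt)
import Data.Vec.Functional.Properties as Vec
open import Function.Base using (_∘_; case_of_; id)
open import Level using (Level; 0ℓ)
open import Relation.Binary.Definitions using (tri<; tri≈; tri>)
open import Relation.Binary.PropositionalEquality.Core as ≡ using (_≡_)
import Relation.Binary.PropositionalEquality.Properties as ≡
open import Relation.Nullary.Decidable as Dec using (Dec; yes; no; ¬?; decidable-stable; dec⇒maybe)
open import Relation.Nullary.Negation.Core using (¬_; contradiction)
open import Relation.Unary using (Pred; _∈_)

open import Algebra.Definitions.RawMonoid ℤ.+-0-rawMonoid using () renaming (sum to ∑ℤ)

private
  variable
    ℓᶜ ℓ : Level

-- Finite sums indexed by natural numbers.

module Sums (A : CommutativeRing ℓᶜ ℓ) where

  open CommutativeRing A hiding (zero)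
  open import Algebra.Properties.Ring ring using (-‿distribʳ-*; -0#≈0#; -‿+-comm)
  open import Algebra.Properties.Semiring.Sum semiring
    using (sum; sum-cong-≋; ∑-distrib-+; ∑-comm; *-distribˡ-sum; *-distribʳ-sum; sum-replicate-zero)
  open import Algebra.Properties.Semiring.Exp semiring using (_^_)
  open import Relation.Binary.Reasoning.Setoid setoid

  -- The summand lives on all of `ℕ`, so that splitting, shifting and periodicity need no arithmetic
  -- on `Fin`.
  ∑< : ℕ → (ℕ → Carrier) → Carrier
  ∑< n F = sum {n} (λ i → F (toℕ i))

  sum-zero : ∀ {n} {f : Fin n → Carrier} → (∀ i → f i ≈ 0#) → sum f ≈ 0#
  sum-zero {n} f≈0 = trans (sum-cong-≋ f≈0) (sum-replicate-zero n)

  sum-neg : ∀ {n} (f : Fin n → Carrier) → sum (λ i → - f i) ≈ - sum f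
  sum-neg {zero}  f = sym -0#≈0#
  sum-neg {suc n} f = trans (+-congˡ (sum-neg (f ∘ suc))) (-‿+-comm (f zero) _)

  ∑<-cong : ∀ n {F G : ℕ → Carrier} → (∀ i → i ℕ.< n → F i ≈ G i) → ∑< n F ≈ ∑< n G
  ∑<-cong n F≈G = sum-cong-≋ {n} (λ i → F≈G (toℕ i) (Fin.toℕ<n i))

  ∑<-zero : ∀ n {F : ℕ → Carrier} → (∀ i → i ℕ.< n → F i ≈ 0#) → ∑< n F ≈ 0#
  ∑<-zero n F≈0 = sum-zero {n} (λ i → F≈0 (toℕ i) (Fin.toℕ<n i))

  ∑<-+ : ∀ n (F G : ℕ → Carrier) → ∑< n (λ i → F i + G i) ≈ ∑< n F + ∑< n G
  ∑<-+ n F G = ∑-distrib-+ {n} (F ∘ toℕ) (G ∘ toℕ)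

  ∑<-*ˡ : ∀ n x (F : ℕ → Carrier) → ∑< n (λ i → x * F i) ≈ x * ∑< n F
  ∑<-*ˡ n x F = sym (*-distribˡ-sum {n} x (F ∘ toℕ))

  ∑<-*ʳ : ∀ n x (F : ℕ → Carrier) → ∑< n (λ i → F i * x) ≈ ∑< n F * x
  ∑<-*ʳ n x F = sym (*-distribʳ-sum {n} x (F ∘ toℕ))

  ∑<-swap : ∀ m n (F : ℕ → ℕ → Carrier) →
            ∑< m (λ i → ∑< n (F i)) ≈ ∑< n (λ j → ∑< m (λ i → F i j))
  ∑<-swap m n F = ∑-comm {m} {n} (λ i j → F (toℕ i) (toℕ j))

  ∑<-last : ∀ n (F : ℕ → Carrier) → ∑< (suc n) F ≈ ∑< n F + F n
  ∑<-last zero    F = trans (+-identityʳ _) (sym (+-identityˡ _))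
  ∑<-last (suc n) F = trans (+-congˡ (∑<-last n (F ∘ suc))) (sym (+-assoc _ _ _))

  ∑<-++ : ∀ m n (F : ℕ → Carrier) → ∑< (m ℕ.+ n) F ≈ ∑< m F + ∑< n (F ∘ (m ℕ.+_))
  ∑<-++ zero    n F = sym (+-identityˡ _)
  ∑<-++ (suc m) n F = trans (+-congˡ (∑<-++ m n (F ∘ suc))) (sym (+-assoc _ _ _))

  ∑<-blocks : ∀ e s (F : ℕ → Carrier) →
              ∑< (e ℕ.* s) F ≈ ∑< e (λ k → ∑< s (λ i → F (k ℕ.* s ℕ.+ i)))
  ∑<-blocks zero    s F = refl
  ∑<-blocks (suc e) s F = begin
    ∑< (s ℕ.+ e ℕ.* s) F
      ≈⟨ ∑<-++ s (e ℕ.* s) F ⟩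
    ∑< s F + ∑< (e ℕ.* s) (λ i → F (s ℕ.+ i))
      ≈⟨ +-congˡ (∑<-blocks e s (F ∘ (s ℕ.+_))) ⟩
    ∑< s F + ∑< e (λ k → ∑< s (λ i → F (s ℕ.+ (k ℕ.* s ℕ.+ i))))
      ≈⟨ +-congˡ (∑<-cong e λ k _ → ∑<-cong s λ i _ →
           reflexive (≡.cong F (≡.sym (ℕ.+-assoc s (k ℕ.* s) i)))) ⟩
    ∑< s F + ∑< e (λ k → ∑< s (λ i → F (suc k ℕ.* s ℕ.+ i))) ∎

  -- Moving the window by one step trades the term at 0 for the term at n, and these agree by
  -- periodicity. `rotate` reads both windows as parts of one sum of length n + 1 and cancels.
  ∑<-shift : ∀ n (F : ℕ → Carrier) → (∀ i → F (i ℕ.+ n) ≈ F i) →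
             ∀ m → ∑< n (λ i → F (i ℕ.+ m)) ≈ ∑< n F
  ∑<-shift n F per zero    = ∑<-cong n λ i _ → reflexive (≡.cong F (ℕ.+-identityʳ i))
  ∑<-shift n F per (suc m) = begin
    ∑< n (λ i → F (i ℕ.+ suc m))
      ≈⟨ ∑<-cong n (λ i _ → reflexive (≡.cong F (ℕ.+-suc i m))) ⟩
    ∑< n (λ i → F (suc i ℕ.+ m))
      ≈⟨ rotate n (λ i → F (i ℕ.+ m)) (trans (reflexive (≡.cong F (ℕ.+-comm n m))) (per m)) ⟩
    ∑< n (λ i → F (i ℕ.+ m))
      ≈⟨ ∑<-shift n F per m ⟩
    ∑< n F ∎
    where
    open import Algebra.Properties.Group +-group using (∙-cancelˡ)
    rotate : ∀ n (G : ℕ → Carrier) → G n ≈ G 0 → ∑< n (G ∘ suc) ≈ ∑< n G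
    rotate n G eq = ∙-cancelˡ (G 0) _ _ (begin
      ∑< (suc n) G     ≈⟨ ∑<-last n G ⟩
      ∑< n G + G n     ≈⟨ +-comm _ _ ⟩
      G n + ∑< n G     ≈⟨ +-congʳ eq ⟩
      G 0 + ∑< n G     ∎)

  geometric : ∀ x n → (x - 1#) * ∑< n (x ^_) ≈ x ^ n - 1#
  geometric x zero    = trans (zeroʳ _) (sym (-‿inverseʳ 1#))
  geometric x (suc n) = begin
    (x - 1#) * (1# + ∑< n (λ i → x * x ^ i))
      ≈⟨ *-congˡ (+-congˡ (∑<-*ˡ n x (x ^_))) ⟩
    (x - 1#) * (1# + x * ∑< n (x ^_))
      ≈⟨ distribˡ _ _ _ ⟩
    (x - 1#) * 1# + (x - 1#) * (x * ∑< n (x ^_))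
      ≈⟨ +-cong (*-identityʳ _) (trans (sym (*-assoc _ _ _)) (trans (*-congʳ (*-comm _ _)) (*-assoc _ _ _))) ⟩
    (x - 1#) + x * ((x - 1#) * ∑< n (x ^_))
      ≈⟨ +-congˡ (*-congˡ (geometric x n)) ⟩
    (x - 1#) + x * (x ^ n - 1#)
      ≈⟨ +-congˡ (trans (distribˡ _ _ _) (+-congˡ (trans (sym (-‿distribʳ-* x 1#)) (-‿cong (*-identityʳ x))))) ⟩
    (x - 1#) + (x * x ^ n - x)
      ≈⟨ +-comm _ _ ⟩
    (x * x ^ n - x) + (x - 1#)
      ≈⟨ +-assoc _ _ _ ⟩
    x * x ^ n + (- x + (x - 1#))
      ≈⟨ +-congˡ (trans (sym (+-assoc _ _ _)) (trans (+-congʳ (-‿inverseˡ x)) (+-identityˡ _))) ⟩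
    x ^ suc n - 1# ∎

-- The canonical map from the integers, and a ring solver with integer coefficients.

module IntegerCoefficients (A : CommutativeRing ℓᶜ ℓ) where

  open CommutativeRing A hiding (zero)
  open import Algebra.Properties.Ring ring
    using (-‿distribˡ-*; -‿distribʳ-*; -0#≈0#; -‿+-comm; -‿involutive)
  open import Algebra.Properties.Semiring.Mult semiring using (×-homo-+; ×1-homo-*) renaming (_×_ to _×′_)
  open import Relation.Binary.Reasoning.Setoid setoid

  ⟦_⟧ : ℤ → Carrier
  ⟦ + n ⟧      = n ×′ 1#
  ⟦ -[1+ n ] ⟧ = - (suc n ×′ 1#)

  ⟦-⟧ : ∀ i → ⟦ ℤ.- i ⟧ ≈ - ⟦ i ⟧
  ⟦-⟧ (+ zero)  = sym -0#≈0#
  ⟦-⟧ (+ suc n) = refl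
  ⟦-⟧ -[1+ n ]  = sym (-‿involutive _)

  ⟦⊖⟧ : ∀ m n → ⟦ m ℤ.⊖ n ⟧ ≈ m ×′ 1# - n ×′ 1#
  ⟦⊖⟧ m       zero    = trans (sym (+-identityʳ _)) (+-congˡ (sym -0#≈0#))
  ⟦⊖⟧ zero    (suc n) = sym (+-identityˡ _)
  ⟦⊖⟧ (suc m) (suc n) = begin
    ⟦ suc m ℤ.⊖ suc n ⟧                 ≡⟨ ≡.cong ⟦_⟧ (ℤ.[1+m]⊖[1+n]≡m⊖n m n) ⟩
    ⟦ m ℤ.⊖ n ⟧                         ≈⟨ ⟦⊖⟧ m n ⟩
    m ×′ 1# - n ×′ 1#                     ≈⟨ +-identityˡ _ ⟨
    0# + (m ×′ 1# - n ×′ 1#)              ≈⟨ +-congʳ (-‿inverseʳ 1#) ⟨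
    (1# - 1#) + (m ×′ 1# - n ×′ 1#)       ≈⟨ +-assoc _ _ _ ⟩
    1# + (- 1# + (m ×′ 1# - n ×′ 1#))     ≈⟨ +-congˡ (trans (sym (+-assoc _ _ _)) (trans (+-congʳ (+-comm _ _)) (+-assoc _ _ _))) ⟩
    1# + (m ×′ 1# + (- 1# - n ×′ 1#))     ≈⟨ +-assoc _ _ _ ⟨
    suc m ×′ 1# + (- 1# - n ×′ 1#)        ≈⟨ +-congˡ (-‿+-comm _ _) ⟩
    suc m ×′ 1# - suc n ×′ 1#             ∎

  ⟦+⟧ : ∀ i j → ⟦ i ℤ.+ j ⟧ ≈ ⟦ i ⟧ + ⟦ j ⟧
  ⟦+⟧ (+ m)    (+ n)    = ×-homo-+ 1# m n
  ⟦+⟧ (+ m)    -[1+ n ] = ⟦⊖⟧ m (suc n)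
  ⟦+⟧ -[1+ m ] (+ n)    = trans (⟦⊖⟧ n (suc m)) (+-comm _ _)
  ⟦+⟧ -[1+ m ] -[1+ n ] = begin
    - (suc (suc (m ℕ.+ n)) ×′ 1#)      ≡⟨ ≡.cong (λ k → - (suc k ×′ 1#)) (ℕ.+-suc m n) ⟨
    - ((suc m ℕ.+ suc n) ×′ 1#)        ≈⟨ -‿cong (×-homo-+ 1# (suc m) (suc n)) ⟩
    - (suc m ×′ 1# + suc n ×′ 1#)       ≈⟨ -‿+-comm _ _ ⟨
    - (suc m ×′ 1#) - suc n ×′ 1#       ∎

  private
    ⟦+*+⟧ : ∀ m n → ⟦ + m ℤ.* + n ⟧ ≈ ⟦ + m ⟧ * ⟦ + n ⟧
    ⟦+*+⟧ m n = trans (reflexive (≡.cong ⟦_⟧ (≡.sym (ℤ.pos-* m n)))) (×1-homo-* m n)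

    ⟦+*⟧ : ∀ m j → ⟦ + m ℤ.* j ⟧ ≈ ⟦ + m ⟧ * ⟦ j ⟧
    ⟦+*⟧ m (+ n)    = ⟦+*+⟧ m n
    ⟦+*⟧ m -[1+ n ] = begin
      ⟦ + m ℤ.* (ℤ.- + suc n) ⟧  ≡⟨ ≡.cong ⟦_⟧ (ℤ.neg-distribʳ-* (+ m) (+ suc n)) ⟨
      ⟦ ℤ.- (+ m ℤ.* + suc n) ⟧  ≈⟨ ⟦-⟧ (+ m ℤ.* + suc n) ⟩
      - ⟦ + m ℤ.* + suc n ⟧      ≈⟨ -‿cong (⟦+*+⟧ m (suc n)) ⟩
      - (⟦ + m ⟧ * ⟦ + suc n ⟧)  ≈⟨ -‿distribʳ-* _ _ ⟩
      ⟦ + m ⟧ * ⟦ -[1+ n ] ⟧     ∎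

  ⟦*⟧ : ∀ i j → ⟦ i ℤ.* j ⟧ ≈ ⟦ i ⟧ * ⟦ j ⟧
  ⟦*⟧ (+ m)    j = ⟦+*⟧ m j
  ⟦*⟧ -[1+ m ] j = begin
    ⟦ (ℤ.- + suc m) ℤ.* j ⟧    ≡⟨ ≡.cong ⟦_⟧ (ℤ.neg-distribˡ-* (+ suc m) j) ⟨
    ⟦ ℤ.- (+ suc m ℤ.* j) ⟧    ≈⟨ ⟦-⟧ (+ suc m ℤ.* j) ⟩
    - ⟦ + suc m ℤ.* j ⟧        ≈⟨ -‿cong (⟦+*⟧ (suc m) j) ⟩
    - (⟦ + suc m ⟧ * ⟦ j ⟧)    ≈⟨ -‿distribˡ-* _ _ ⟩
    ⟦ -[1+ m ] ⟧ * ⟦ j ⟧       ∎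

  ⟦1⟧ : ⟦ + 1 ⟧ ≈ 1#
  ⟦1⟧ = +-identityʳ 1#

  private
    morphism : ℤ.+-*-rawRing -Raw-AlmostCommutative⟶ fromCommutativeRing A
    morphism = record
      { ⟦_⟧ = ⟦_⟧ ; +-homo = ⟦+⟧ ; *-homo = ⟦*⟧ ; -‿homo = ⟦-⟧ ; 0-homo = refl ; 1-homo = ⟦1⟧ }

  module Solver = Algebra.Solver.Ring ℤ.+-*-rawRing (fromCommutativeRing A) morphism
    (λ i j → Maybe.map (λ i≡j → reflexive (≡.cong ⟦_⟧ i≡j)) (dec⇒maybe (i ℤ.≟ j)))

-- Linear dependence over a domain with decidable zero.

module LinearDependence (A : CommutativeRing ℓᶜ ℓ) where

  open CommutativeRing A hiding (zero)
  open Sums A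
  open IntegerCoefficients.Solver A
  open import Algebra.Properties.Semiring.Sum semiring
  open import Relation.Binary.Reasoning.Setoid setoid

  Relation : ∀ {m n} → (Fin m → Fin n → Carrier) → Set (ℓᶜ Level.⊔ ℓ)
  Relation {m} e = Σ (Fin m → Carrier) λ c → (∃ λ i → ¬ c i ≈ 0#) × (∀ j → sum (λ i → c i * e i j) ≈ 0#)

  module Domain (1≉0 : ¬ 1# ≈ 0#) (cancel : ∀ {x y} → ¬ x ≈ 0# → x * y ≈ 0# → y ≈ 0#)
                (≈0? : ∀ x → Dec (x ≈ 0#)) where

    opaque
      -- Fraction-free Gaussian elimination on the first coordinate. It serves twice: over the
      -- integers, and over `L` once its equality has been decided.
      dependent : ∀ n (e : Fin (suc n) → Fin n → Carrier) → Relation e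
      dependent zero    e = (λ _ → 1#) , (zero , 1≉0) , λ ()
      dependent (suc n) e with Fin.any? (λ k → ¬? (≈0? (e k zero)))
      ... | no all0 = c , (suc (proj₁ c≉0) , proj₂ c≉0) , eq
        where
        rec : Relation (λ i j → e (suc i) (suc j))
        rec = dependent n (λ i j → e (suc i) (suc j))
        c≉0 : ∃ λ i → ¬ proj₁ rec i ≈ 0#
        c≉0 = proj₁ (proj₂ rec)
        c : Fin (suc (suc n)) → Carrier
        c zero    = 0#
        c (suc i) = proj₁ rec i
        e≈0 : ∀ k → e k zero ≈ 0#
        e≈0 k = decidable-stable (≈0? (e k zero)) (λ ne → all0 (k , ne))
        eq : ∀ j → sum (λ i → c i * e i j) ≈ 0#
        eq zero    = sum-zero {suc (suc n)} (λ i → trans (*-congˡ (e≈0 i)) (zeroʳ (c i)))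
        eq (suc j) = trans (+-cong (zeroˡ _) (proj₂ (proj₂ rec) j)) (+-identityˡ _)
      ... | yes (k , eₖ≉0) = c , (punchIn k (proj₁ c≉0) , nonzero) , eq
        where
        f : Fin (suc n) → Fin (suc n) → Carrier
        f i j = e k zero * e (punchIn k i) j - e (punchIn k i) zero * e k j
        rec : Relation (λ i → f i ∘ suc)
        rec = dependent n (λ i → f i ∘ suc)
        c′ : Fin (suc n) → Carrier
        c′ = proj₁ rec
        c≉0 : ∃ λ i → ¬ proj₁ rec i ≈ 0#
        c≉0 = proj₁ (proj₂ rec)
        u v : Fin (suc n) → Carrier
        u i = c′ i * e (punchIn k i) zero
        v i = e k zero * c′ i
        -- Expanding a relation between the eliminated vectors `f` gives each remaining vector its
        -- coefficient times the pivot entry, and collects this sum at the pivot vector.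
        cₖ : Carrier
        cₖ = - sum u
        c : Fin (suc (suc n)) → Carrier
        c = insertAt v k cₖ
        nonzero : ¬ c (punchIn k (proj₁ c≉0)) ≈ 0#
        nonzero eq = proj₂ c≉0 (cancel eₖ≉0 (trans
          (reflexive (≡.sym (Vec.insertAt-punchIn v k cₖ (proj₁ c≉0)))) eq))
        elim : ∀ j → sum (λ i → c i * e i j) ≈ sum (λ i → c′ i * f i j)
        elim j = begin
          sum (λ i → c i * e i j)
            ≈⟨ sum-remove {i = k} (λ i → c i * e i j) ⟩
          c k * e k j + sum (λ i → c (punchIn k i) * e (punchIn k i) j)
            ≈⟨ +-cong (*-congʳ (reflexive (Vec.insertAt-lookup v k cₖ)))
                      (sum-cong-≋ {suc n} λ i → *-congʳ {e (punchIn k i) j} (reflexive (Vec.insertAt-punchIn v k cₖ i))) ⟩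
          cₖ * e k j + sum (λ i → v i * e (punchIn k i) j)
            ≈⟨ +-congʳ (trans (*-congʳ (sym (sum-neg u))) (*-distribʳ-sum (e k j) (λ i → - u i))) ⟩
          sum (λ i → - u i * e k j) + sum (λ i → v i * e (punchIn k i) j)
            ≈⟨ ∑-distrib-+ (λ i → - u i * e k j) (λ i → v i * e (punchIn k i) j) ⟨
          sum (λ i → - u i * e k j + v i * e (punchIn k i) j)
            ≈⟨ sum-cong-≋ {suc n} (λ i → solve 5 (λ c₁ e₁ e₂ e₃ e₄ →
                 :- (c₁ :* e₁) :* e₂ :+ e₃ :* c₁ :* e₄ := c₁ :* (e₃ :* e₄ :- e₁ :* e₂))
                 refl (c′ i) (e (punchIn k i) zero) (e k j) (e k zero) (e (punchIn k i) j)) ⟩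
          sum (λ i → c′ i * f i j) ∎

        f₀≈0 : ∀ i → f i zero ≈ 0#
        f₀≈0 i = trans (+-congʳ (*-comm _ _)) (-‿inverseʳ _)
        eq : ∀ j → sum (λ i → c i * e i j) ≈ 0#
        eq zero    = trans (elim zero) (sum-zero {suc n} λ i → trans (*-congˡ (f₀≈0 i)) (zeroʳ (c′ i)))
        eq (suc j) = trans (elim (suc j)) (proj₂ (proj₂ rec) j)

-- Binomial coefficients modulo a prime, and the q-th power of a sum.

prime∣!⇒≤ : ∀ {q} → Prime q → ∀ k → q ℕ.∣ k ! → q ℕ.≤ k
prime∣!⇒≤ {suc zero} pr zero q∣1 = contradiction pr λ ()
prime∣!⇒≤ {suc (suc q)} pr zero q∣1 = contradiction (ℕ.∣⇒≤ q∣1) λ { (s≤s ()) }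
prime∣!⇒≤ pr (suc k) q∣k! = [ ℕ.∣⇒≤ , ℕ.m≤n⇒m≤1+n ∘ prime∣!⇒≤ pr k ]′ (euclidsLemma (suc k) (k !) pr q∣k!)

-- The prime divides q ! but neither k ! nor (q - k) !, both factors being factorials of smaller
-- numbers.
prime∣C : ∀ {q} → Prime q → ∀ {k} → 0 ℕ.< k → k ℕ.< q → q ℕ.∣ q C k
prime∣C {suc q} pr {k@(suc k-1)} 0<k k<q = [ id , (λ q∣d → contradiction q∣d q∤d) ]′ (euclidsLemma (suc q C k) d pr q∣Cd)
  where
  open import Data.Nat.Properties using (_!*_!≢0)
  d = k ! ℕ.* (suc q ∸ k) !
  instance d≢0 = k !* (suc q ∸ k) !≢0
  Cd≡ : (suc q C k) ℕ.* d ≡ suc q !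
  Cd≡ = ≡.trans (≡.cong (ℕ._* d) (nCk≡n!/k![n-k]! (ℕ.<⇒≤ k<q))) (ℕ.m/n*n≡m (k![n∸k]!∣n! (ℕ.<⇒≤ k<q)))
  q∣Cd : suc q ℕ.∣ (suc q C k) ℕ.* d
  q∣Cd = ≡.subst (suc q ℕ.∣_) (≡.sym Cd≡) (ℕ.m∣m*n (q !))
  q∤d : ¬ suc q ℕ.∣ d
  q∤d q∣d = [ ℕ.<⇒≱ k<q ∘ prime∣!⇒≤ pr k
            , ℕ.<⇒≱ (s≤s (ℕ.m∸n≤m q k-1)) ∘ prime∣!⇒≤ pr (suc q ∸ k) ]′ (euclidsLemma (k !) _ pr q∣d)

module Freshman (A : CommutativeRing ℓᶜ ℓ) where

  open CommutativeRing A hiding (zero)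
  open Sums A
  open IntegerCoefficients A
  open import Algebra.Properties.Semiring.Exp semiring using (_^_)
  open import Algebra.Properties.Semiring.Mult semiring using (×-assoc-*; ×-congʳ) renaming (_×_ to _×′_)
  import Algebra.Properties.CommutativeSemiring.Binomial commutativeSemiring as Binomial
  open import Relation.Binary.Reasoning.Setoid setoid

  module _ (m : ℕ) (pr : Prime (suc (suc m))) where

    private
      q : ℕ
      q = suc (suc m)

    -- Numbered from 0 although it starts at the binomial coefficient with lower index 1: only the
    -- inner coefficients are divisible by q.
    coefficient : ℕ → ℕ
    coefficient k = (q C suc k) ℕ./ q

    coefficient-0 : coefficient 0 ≡ 1
    coefficient-0 = ≡.trans (≡.cong (ℕ._/ q) (nC1≡n q)) (ℕ.n/n≡1 q)

    -- An equation with explicit cofactor rather than a congruence, since it is used both to expand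
    -- (π + 1)^p exactly and to obtain the Frobenius congruence.
    freshman : ∀ x y → (x + y) ^ q ≈
      y ^ q + (⟦ + q ⟧ * ∑< (suc m) (λ k → ⟦ + coefficient k ⟧ * (x ^ suc k * y ^ (suc m ∸ k))) + x ^ q)
    freshman x y = begin
      (x + y) ^ q
        ≈⟨ Binomial.theorem q x y ⟩
      F 0 + ∑< (suc (suc m)) (F ∘ suc)
        ≈⟨ +-cong first (trans (∑<-last (suc m) (F ∘ suc)) (+-cong middle last)) ⟩
      y ^ q + (⟦ + q ⟧ * ∑< (suc m) (λ k → ⟦ + coefficient k ⟧ * (x ^ suc k * y ^ (suc m ∸ k))) + x ^ q) ∎
      where
      F : ℕ → Carrier
      F k = (q C k) ×′ (x ^ k * y ^ (q ∸ k))
      ×′≈ : ∀ k z → k ×′ z ≈ ⟦ + k ⟧ * z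
      ×′≈ k z = sym (trans (×-assoc-* k 1# z) (×-congʳ k (*-identityˡ z)))
      first : F 0 ≈ y ^ q
      first = trans (+-identityʳ _) (*-identityˡ _)
      last : F q ≈ x ^ q
      last = begin
        (q C q) ×′ (x ^ q * y ^ (q ∸ q))  ≡⟨ ≡.cong₂ (λ i j → i ×′ (x ^ q * y ^ j)) (nCn≡1 q) (ℕ.n∸n≡0 q) ⟩
        1 ×′ (x ^ q * 1#)                 ≈⟨ +-identityʳ _ ⟩
        x ^ q * 1#                        ≈⟨ *-identityʳ _ ⟩
        x ^ q                             ∎
      middle : ∑< (suc m) (F ∘ suc) ≈ ⟦ + q ⟧ * ∑< (suc m) (λ k → ⟦ + coefficient k ⟧ * (x ^ suc k * y ^ (suc m ∸ k)))
      middle = trans (∑<-cong (suc m) {F ∘ suc} {λ k → ⟦ + q ⟧ * (⟦ + coefficient k ⟧ * (x ^ suc k * y ^ (suc m ∸ k)))}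
        λ k k<m → begin
          F (suc k)
            ≈⟨ ×′≈ (q C suc k) _ ⟩
          ⟦ + (q C suc k) ⟧ * (x ^ suc k * y ^ (suc m ∸ k))
            ≡⟨ ≡.cong (λ i → ⟦ + i ⟧ * (x ^ suc k * y ^ (suc m ∸ k))) (ℕ.m/n*n≡m (prime∣C pr {suc k} (s≤s z≤n) (s≤s k<m))) ⟨
          ⟦ + (coefficient k ℕ.* q) ⟧ * (x ^ suc k * y ^ (suc m ∸ k))
            ≈⟨ *-congʳ (trans (reflexive (≡.cong ⟦_⟧ (≡.trans (≡.cong +_ (ℕ.*-comm (coefficient k) q)) (ℤ.pos-* q (coefficient k)))))
                              (⟦*⟧ (+ q) (+ coefficient k))) ⟩
          ⟦ + q ⟧ * ⟦ + coefficient k ⟧ * (x ^ suc k * y ^ (suc m ∸ k))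
            ≈⟨ *-assoc _ _ _ ⟩
          ⟦ + q ⟧ * (⟦ + coefficient k ⟧ * (x ^ suc k * y ^ (suc m ∸ k))) ∎)
        (∑<-*ˡ (suc m) ⟦ + q ⟧ (λ k → ⟦ + coefficient k ⟧ * (x ^ suc k * y ^ (suc m ∸ k))))
        where import Data.Integer.Properties as ℤ

-- Bézout identities, and congruences between natural numbers.

bezout : ∀ {q} → Prime q → ∀ i → (+ q ℤ.∣ i) ⊎ ∃₂ λ x y → x ℤ.* i ℤ.+ y ℤ.* + q ≡ + 1
bezout {q} pr i with q ℕ.∣? ℤ.∣ i ∣
... | yes q∣i = inj₁ (ℤ.∣ᵤ⇒∣ q∣i)
... | no  q∤i = inj₂ (signed (ℤ.+∣i∣≡i⊎+∣i∣≡-i i) (identity (ℕ.coprime-Bézout coprime)))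
  where
  open ≡.≡-Reasoning
  m = ℤ.∣ i ∣
  coprime : ℕ.Coprime m q
  coprime (d∣m , d∣q) = case prime⇒irreducible pr d∣q of λ where
    (inj₁ d≡1)    → d≡1
    (inj₂ ≡.refl) → contradiction d∣m q∤i
  identity : ℕ.Bézout.Identity 1 m q → ∃₂ λ x y → x ℤ.* + m ℤ.+ y ℤ.* + q ≡ + 1
  identity (ℕ.Bézout.+- x y eq) = + x , ℤ.- + y , (begin
    + x ℤ.* + m ℤ.+ (ℤ.- + y) ℤ.* + q    ≡⟨ ≡.cong (ℤ._+ (ℤ.- + y) ℤ.* + q) (ℤ.pos-* x m) ⟨
    + (x ℕ.* m) ℤ.+ (ℤ.- + y) ℤ.* + q    ≡⟨ ≡.cong (λ k → + k ℤ.+ (ℤ.- + y) ℤ.* + q) eq ⟨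
    + 1 ℤ.+ + (y ℕ.* q) ℤ.+ (ℤ.- + y) ℤ.* + q  ≡⟨ ≡.cong (λ k → + 1 ℤ.+ k ℤ.+ (ℤ.- + y) ℤ.* + q) (ℤ.pos-* y q) ⟩
    + 1 ℤ.+ + y ℤ.* + q ℤ.+ (ℤ.- + y) ℤ.* + q
      ≡⟨ solve 2 (λ a b → con (+ 1) :+ a :* b :+ (:- a) :* b := con (+ 1)) ≡.refl (+ y) (+ q) ⟩
    + 1 ∎)
    where open Data.Integer.Solver.+-*-Solver
  identity (ℕ.Bézout.-+ x y eq) = ℤ.- + x , + y , (begin
    (ℤ.- + x) ℤ.* + m ℤ.+ + y ℤ.* + q    ≡⟨ ≡.cong (λ k → (ℤ.- + x) ℤ.* + m ℤ.+ k) (ℤ.pos-* y q) ⟨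
    (ℤ.- + x) ℤ.* + m ℤ.+ + (y ℕ.* q)    ≡⟨ ≡.cong (λ k → (ℤ.- + x) ℤ.* + m ℤ.+ + k) eq ⟨
    (ℤ.- + x) ℤ.* + m ℤ.+ (+ 1 ℤ.+ + (x ℕ.* m))  ≡⟨ ≡.cong (λ k → (ℤ.- + x) ℤ.* + m ℤ.+ (+ 1 ℤ.+ k)) (ℤ.pos-* x m) ⟩
    (ℤ.- + x) ℤ.* + m ℤ.+ (+ 1 ℤ.+ + x ℤ.* + m)
      ≡⟨ solve 2 (λ a b → (:- a) :* b :+ (con (+ 1) :+ a :* b) := con (+ 1)) ≡.refl (+ x) (+ m) ⟩
    + 1 ∎)
    where open Data.Integer.Solver.+-*-Solver
  signed : + m ≡ i ⊎ + m ≡ ℤ.- i → (∃₂ λ x y → x ℤ.* + m ℤ.+ y ℤ.* + q ≡ + 1) →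
           ∃₂ λ x y → x ℤ.* i ℤ.+ y ℤ.* + q ≡ + 1
  signed (inj₁ m≡i)  (x , y , eq) = x , y , ≡.trans (≡.cong (λ k → x ℤ.* k ℤ.+ y ℤ.* + q) (≡.sym m≡i)) eq
  signed (inj₂ m≡-i) (x , y , eq) = ℤ.- x , y , ≡.trans (≡.cong (ℤ._+ y ℤ.* + q)
    (≡.trans (≡.sym (ℤ.neg-distribˡ-* x i)) (≡.trans (ℤ.neg-distribʳ-* x i) (≡.cong (x ℤ.*_) (≡.sym m≡-i))))) eq

private
  module ℤS = Data.Integer.Solver.+-*-Solver
open ℤS public using () renaming (solve to ℤsolve; con to ℤcon; _:+_ to infixl 6 _⊕_; _:*_ to infixl 7 _⊗_; _:-_ to infixl 6 _⊝_; _:=_ to infix 4 _⊜_; :-_ to infix 8 ⊖_)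

k<m^k : ∀ m → 1 ℕ.< m → ∀ k → k ℕ.< m ℕ.^ k
k<m^k m 1<m zero    = s≤s z≤n
k<m^k m 1<m (suc k) = ℕ.<-≤-trans (s≤s (k<m^k m 1<m k)) (ℕ.^-monoʳ-< m 1<m (ℕ.n<1+n k))

%≡⇒∣∸ : ∀ d .{{_ : ℕ.NonZero d}} a b → a ℕ.% d ≡ b ℕ.% d → d ℕ.∣ b ∸ a
%≡⇒∣∸ d a b eq = ℕ.divides (b ℕ./ d ∸ a ℕ./ d) (begin
  b ∸ a                                                      ≡⟨ ≡.cong₂ _∸_ (ℕ.m≡m%n+[m/n]*n b d) (ℕ.m≡m%n+[m/n]*n a d) ⟩
  b ℕ.% d ℕ.+ b ℕ./ d ℕ.* d ∸ (a ℕ.% d ℕ.+ a ℕ./ d ℕ.* d)    ≡⟨ ≡.cong (λ r → b ℕ.% d ℕ.+ b ℕ./ d ℕ.* d ∸ (r ℕ.+ a ℕ./ d ℕ.* d)) eq ⟩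
  b ℕ.% d ℕ.+ b ℕ./ d ℕ.* d ∸ (b ℕ.% d ℕ.+ a ℕ./ d ℕ.* d)    ≡⟨ ℕ.[m+n]∸[m+o]≡n∸o (b ℕ.% d) _ _ ⟩
  b ℕ./ d ℕ.* d ∸ a ℕ./ d ℕ.* d                              ≡⟨ ℕ.*-distribʳ-∸ d (b ℕ./ d) (a ℕ./ d) ⟨
  (b ℕ./ d ∸ a ℕ./ d) ℕ.* d                                  ∎)
  where open ≡.≡-Reasoning

∣∸⇒%≡ : ∀ d .{{_ : ℕ.NonZero d}} {a b} → a ℕ.≤ b → d ℕ.∣ b ∸ a → b ℕ.% d ≡ a ℕ.% d
∣∸⇒%≡ d {a} {b} a≤b d∣ = ≡.trans (≡.cong (ℕ._% d) (≡.sym (ℕ.m+[n∸m]≡n a≤b))) (ℕ.%-remove-+ʳ a d∣)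

[mod]⇒%≡ : ∀ d .{{_ : ℕ.NonZero d}} a b → + a ≡ + b [mod d ] → a ℕ.% d ≡ b ℕ.% d
[mod]⇒%≡ d a b d∣ = [ (λ a≤b → ≡.sym (∣∸⇒%≡ d a≤b (≡.subst (d ℕ.∣_) (≡.trans (≡.cong ℤ.∣_∣ (ℤ.m-n≡m⊖n a b)) (ℤ.∣⊖∣-≤ a≤b)) d∣)))
                    , (λ b≤a → ∣∸⇒%≡ d b≤a (≡.subst (d ℕ.∣_) (≡.trans (≡.cong ℤ.∣_∣ (ℤ.m-n≡m⊖n a b)) (≡.trans (ℤ.∣m⊖n∣≡∣n⊖m∣ a b) (ℤ.∣⊖∣-≤ b≤a))) d∣))
                    ]′ (ℕ.≤-total a b)

-- Powers modulo p and primitive roots.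

module UnitsMod (p N : ℕ) .{{_ : ℕ.NonZero p}} .{{_ : ℕ.NonZero N}} (p≡1+N : p ≡ suc N) (prime : Prime p) where

  private
    N<p : N ℕ.< p
    N<p = ℕ.≤-reflexive (≡.sym p≡1+N)

    <p⇒≤N : ∀ {i} → i ℕ.< p → i ℕ.≤ N
    <p⇒≤N i<p = ℕ.≤-pred (ℕ.<-≤-trans i<p (ℕ.≤-reflexive p≡1+N))

    p≰1 : ¬ p ℕ.≤ 1
    p≰1 p≤1 = contradiction (ℕ.>-nonZero⁻¹ N) (ℕ.≤⇒≯ (ℕ.≤-pred (ℕ.≤-trans (ℕ.≤-reflexive (≡.sym p≡1+N)) p≤1)))

  p∤^ : ∀ {q} → ¬ p ℕ.∣ q → ∀ k → ¬ p ℕ.∣ q ℕ.^ k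
  p∤^ p∤q zero    p∣1 = contradiction (ℕ.∣⇒≤ p∣1) p≰1
  p∤^ {q} p∤q (suc k) p∣  = [ p∤q , p∤^ p∤q k ]′ (euclidsLemma q (q ℕ.^ k) prime p∣)

  opaque
    residue : ∀ m → ¬ p ℕ.∣ m → ∃ λ (i : Fin N) → suc (toℕ i) ≡ m ℕ.% p
    residue m p∤m = Fin.fromℕ< pred<N , ≡.trans (≡.cong suc (Fin.toℕ-fromℕ< pred<N)) sp
      where
      instance
        m%p≢0 : ℕ.NonZero (m ℕ.% p)
        m%p≢0 = ℕ.≢-nonZero (p∤m ∘ ℕ.m%n≡0⇒n∣m m p)
      sp : suc (ℕ.pred (m ℕ.% p)) ≡ m ℕ.% p
      sp = ℕ.suc-pred (m ℕ.% p)
      pred<N : ℕ.pred (m ℕ.% p) ℕ.< N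
      pred<N = <p⇒≤N (≡.subst (ℕ._< p) (≡.sym sp) (ℕ.m%n<n m p))

    ^%≡⇒∣ : ∀ {q} → ¬ p ℕ.∣ q → ∀ {i j} → i ℕ.≤ j → q ℕ.^ i ℕ.% p ≡ q ℕ.^ j ℕ.% p → p ℕ.∣ q ℕ.^ (j ∸ i) ∸ 1
    ^%≡⇒∣ {q} p∤q {i} {j} i≤j eq = [ (λ p∣q^i → contradiction p∣q^i (p∤^ p∤q i)) , (λ p∣ → p∣) ]′
      (euclidsLemma (q ℕ.^ i) (q ℕ.^ (j ∸ i) ∸ 1) prime (≡.subst (p ℕ.∣_) (≡.sym factor) (%≡⇒∣∸ p (q ℕ.^ i) (q ℕ.^ j) eq)))
      where
      factor : q ℕ.^ i ℕ.* (q ℕ.^ (j ∸ i) ∸ 1) ≡ q ℕ.^ j ∸ q ℕ.^ i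
      factor = ≡.trans (ℕ.*-distribˡ-∸ (q ℕ.^ i) (q ℕ.^ (j ∸ i)) 1)
        (≡.cong₂ _∸_ (≡.trans (≡.sym (ℕ.^-distribˡ-+-* q i (j ∸ i))) (≡.cong (q ℕ.^_) (ℕ.m+[n∸m]≡n i≤j))) (ℕ.*-identityʳ (q ℕ.^ i)))

    -- The p exponents 0, ..., N land on only N nonzero residues, so two powers agree, and the
    -- smaller one can be cancelled.
    order : ∀ {q} → ¬ p ℕ.∣ q → ∃ λ f → 0 ℕ.< f × f ℕ.≤ N × p ℕ.∣ q ℕ.^ f ∸ 1
    order {q} p∤q with Fin.pigeonhole N<p (λ (i : Fin p) → proj₁ (residue (q ℕ.^ toℕ i) (p∤^ p∤q (toℕ i))))
    ... | i , j , i<j , eq = toℕ j ∸ toℕ i , ℕ.m<n⇒0<n∸m i<j , ℕ.≤-trans (ℕ.m∸n≤m (toℕ j) (toℕ i)) (<p⇒≤N (Fin.toℕ<n j)) ,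
      ^%≡⇒∣ p∤q (ℕ.<⇒≤ i<j) (≡.trans (≡.sym (proj₂ (residue (q ℕ.^ toℕ i) (p∤^ p∤q (toℕ i)))))
        (≡.trans (≡.cong (suc ∘ toℕ) eq) (proj₂ (residue (q ℕ.^ toℕ j) (p∤^ p∤q (toℕ j))))))

  module PrimitiveRoot (v : ℕ) (p∤v : ¬ p ℕ.∣ v)
                       (generates : ∀ j → 0 ℕ.< j → j ℕ.< p → ∃ λ k → v ℕ.^ k ℕ.% p ≡ j) where

    opaque
      ^+period : ∀ {f} → p ℕ.∣ v ℕ.^ f ∸ 1 → ∀ k → v ℕ.^ (k ℕ.+ f) ℕ.% p ≡ v ℕ.^ k ℕ.% p
      ^+period {f} p∣ k = ∣∸⇒%≡ p (ℕ.^-monoʳ-≤ v {{v≢0}} (ℕ.m≤m+n k f)) (≡.subst (p ℕ.∣_) (≡.sym factor) (ℕ.∣n⇒∣m*n (v ℕ.^ k) p∣))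
        where
        v≢0 : ℕ.NonZero v
        v≢0 = ℕ.≢-nonZero (λ { ≡.refl → p∤v (p ℕ.∣0) })
        factor : v ℕ.^ (k ℕ.+ f) ∸ v ℕ.^ k ≡ v ℕ.^ k ℕ.* (v ℕ.^ f ∸ 1)
        factor = ≡.trans (≡.cong₂ _∸_ (ℕ.^-distribˡ-+-* v k f) (≡.sym (ℕ.*-identityʳ (v ℕ.^ k)))) (≡.sym (ℕ.*-distribˡ-∸ (v ℕ.^ k) (v ℕ.^ f) 1))

      ^%period : ∀ {f} → .{{_ : ℕ.NonZero f}} → p ℕ.∣ v ℕ.^ f ∸ 1 → ∀ k → v ℕ.^ (k ℕ.% f) ℕ.% p ≡ v ℕ.^ k ℕ.% p
      ^%period {f} p∣ k = ≡.trans (≡.sym (multiples (k ℕ./ f))) (≡.cong (λ l → v ℕ.^ l ℕ.% p) (≡.sym (ℕ.m≡m%n+[m/n]*n k f)))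
        where
        multiples : ∀ c → v ℕ.^ (k ℕ.% f ℕ.+ c ℕ.* f) ℕ.% p ≡ v ℕ.^ (k ℕ.% f) ℕ.% p
        multiples zero    = ≡.cong (λ l → v ℕ.^ l ℕ.% p) (ℕ.+-identityʳ (k ℕ.% f))
        multiples (suc c) = ≡.trans (≡.cong (λ l → v ℕ.^ l ℕ.% p)
            (≡.trans (≡.cong (k ℕ.% f ℕ.+_) (ℕ.+-comm f (c ℕ.* f))) (≡.sym (ℕ.+-assoc (k ℕ.% f) (c ℕ.* f) f))))
          (≡.trans (^+period p∣ (k ℕ.% f ℕ.+ c ℕ.* f)) (multiples c))

      log : Fin N → ℕ
      log j = proj₁ (generates (suc (toℕ j)) (s≤s z≤n) (ℕ.≤-<-trans (Fin.toℕ<n j) N<p))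

      ^log : ∀ j → v ℕ.^ log j ℕ.% p ≡ suc (toℕ j)
      ^log j = proj₂ (generates (suc (toℕ j)) (s≤s z≤n) (ℕ.≤-<-trans (Fin.toℕ<n j) N<p))

      -- A discrete logarithm reduced modulo a period still determines its residue, so the N nonzero
      -- residues inject into `Fin f`.
      N≤period : ∀ {f} → 0 ℕ.< f → p ℕ.∣ v ℕ.^ f ∸ 1 → N ℕ.≤ f
      N≤period {f} 0<f p∣ = Fin.injective⇒≤ {f = log%f} injective
        where
        instance
          f≢0 : ℕ.NonZero f
          f≢0 = ℕ.>-nonZero 0<f
        log%f : Fin N → Fin f
        log%f j = Fin.fromℕ< (ℕ.m%n<n (log j) f)
        ^log%f : ∀ j → v ℕ.^ toℕ (log%f j) ℕ.% p ≡ suc (toℕ j)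
        ^log%f j = begin
          v ℕ.^ toℕ (log%f j) ℕ.% p   ≡⟨ ≡.cong (λ l → v ℕ.^ l ℕ.% p) (Fin.toℕ-fromℕ< (ℕ.m%n<n (log j) f)) ⟩
          v ℕ.^ (log j ℕ.% f) ℕ.% p   ≡⟨ ^%period {f} p∣ (log j) ⟩
          v ℕ.^ log j ℕ.% p           ≡⟨ ^log j ⟩
          suc (toℕ j)                 ∎
          where open ≡.≡-Reasoning
        injective : ∀ {i j} → log%f i ≡ log%f j → i ≡ j
        injective {i} {j} eq = Fin.toℕ-injective (ℕ.suc-injective (≡.trans (≡.sym (^log%f i))
          (≡.trans (≡.cong (λ k → v ℕ.^ toℕ k ℕ.% p) eq) (^log%f j))))

      -- The pigeonhole period is at most N and every period is at least N; Fermat's little theorem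
      -- for `v` results without a separate proof.
      ^N≡1 : p ℕ.∣ v ℕ.^ N ∸ 1
      ^N≡1 with order p∤v
      ... | f , 0<f , f≤N , p∣ = ≡.subst (λ k → p ℕ.∣ v ℕ.^ k ∸ 1) (ℕ.≤-antisym f≤N (N≤period 0<f p∣)) p∣

      ^-injective : ∀ {a b} → a ℕ.< N → b ℕ.< N → v ℕ.^ a ℕ.% p ≡ v ℕ.^ b ℕ.% p → a ≡ b
      ^-injective {a} {b} a<N b<N eq with ℕ.<-cmp a b
      ... | tri≈ _ a≡b _ = a≡b
      ... | tri< a<b _ _ = contradiction (N≤period (ℕ.m<n⇒0<n∸m a<b) (^%≡⇒∣ p∤v (ℕ.<⇒≤ a<b) eq))
                             (ℕ.<⇒≱ (ℕ.≤-<-trans (ℕ.m∸n≤m b a) b<N))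
      ... | tri> _ _ b<a = contradiction (N≤period (ℕ.m<n⇒0<n∸m b<a) (^%≡⇒∣ p∤v (ℕ.<⇒≤ b<a) (≡.sym eq)))
                             (ℕ.<⇒≱ (ℕ.≤-<-trans (ℕ.m∸n≤m a b) a<N))

    -- An element j of `Fin N` stands for the nonzero residue j + 1.
    exp : ℕ → Fin N
    exp a = proj₁ (residue (v ℕ.^ a) (p∤^ p∤v a))

    suc-exp : ∀ a → suc (toℕ (exp a)) ≡ v ℕ.^ a ℕ.% p
    suc-exp a = proj₂ (residue (v ℕ.^ a) (p∤^ p∤v a))

    log% : Fin N → Fin N
    log% j = Fin.fromℕ< (ℕ.m%n<n (log j) N)

    exp-log% : ∀ j → exp (toℕ (log% j)) ≡ j
    exp-log% j = Fin.toℕ-injective (ℕ.suc-injective (≡.trans (suc-exp (toℕ (log% j)))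
      (≡.trans (≡.cong (λ l → v ℕ.^ l ℕ.% p) (Fin.toℕ-fromℕ< (ℕ.m%n<n (log j) N))) (≡.trans (^%period {N} ^N≡1 (log j)) (^log j)))))

    log%-exp : ∀ a → log% (exp (toℕ a)) ≡ a
    log%-exp a = Fin.toℕ-injective (^-injective (Fin.toℕ<n (log% (exp (toℕ a)))) (Fin.toℕ<n a)
      (≡.trans (≡.sym (suc-exp (toℕ (log% (exp (toℕ a)))))) (≡.trans (≡.cong (suc ∘ toℕ) (exp-log% (exp (toℕ a)))) (suc-exp (toℕ a)))))

    exponential : Permutation N N
    exponential = permutation (exp ∘ toℕ) log% exp-log% log%-exp

-- The ring of integers modulo q.

module IntegersMod (q : ℕ) where

  infix 4 _≈ₘ_
  -- A record rather than a synonym for divisibility of the difference, so that `x` and `y` stay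
  -- visible in the type.
  record _≈ₘ_ (x y : ℤ) : Set where
    constructor modulo
    field
      divides : + q ℤ.∣ x ℤ.- y
  open _≈ₘ_ public

  ≡⇒≈ₘ : ∀ {x y} → x ≡ y → x ≈ₘ y
  ≡⇒≈ₘ {x} ≡.refl = modulo (ℤ.divides (+ 0) (ℤ.+-inverseʳ x))

  ≈ₘ-sym : ∀ {x y} → x ≈ₘ y → y ≈ₘ x
  ≈ₘ-sym {x} {y} (modulo d) = modulo (≡.subst (+ q ℤ.∣_) (ℤsolve 2 (λ x y → ℤcon (+ 0) ⊝ (x ⊝ y) ⊜ y ⊝ x) ≡.refl x y)
    (ℤ.∣m∣n⇒∣m-n (ℤ.divides (+ 0) ≡.refl) d))

  ≈ₘ-trans : ∀ {x y z} → x ≈ₘ y → y ≈ₘ z → x ≈ₘ z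
  ≈ₘ-trans {x} {y} {z} (modulo d) (modulo e) = modulo (≡.subst (+ q ℤ.∣_) (ℤsolve 3 (λ x y z → (x ⊝ y) ⊕ (y ⊝ z) ⊜ x ⊝ z) ≡.refl x y z) (ℤ.∣m∣n⇒∣m+n d e))

  ≈ₘ-+ : ∀ {x y u v} → x ≈ₘ y → u ≈ₘ v → x ℤ.+ u ≈ₘ y ℤ.+ v
  ≈ₘ-+ {x} {y} {u} {v} (modulo d) (modulo e) = modulo (≡.subst (+ q ℤ.∣_) (ℤsolve 4 (λ x y u v → (x ⊝ y) ⊕ (u ⊝ v) ⊜ (x ⊕ u) ⊝ (y ⊕ v)) ≡.refl x y u v) (ℤ.∣m∣n⇒∣m+n d e))

  ≈ₘ-* : ∀ {x y u v} → x ≈ₘ y → u ≈ₘ v → x ℤ.* u ≈ₘ y ℤ.* v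
  ≈ₘ-* {x} {y} {u} {v} (modulo d) (modulo e) = modulo (≡.subst (+ q ℤ.∣_) (ℤsolve 4 (λ x y u v → u ⊗ (x ⊝ y) ⊕ y ⊗ (u ⊝ v) ⊜ x ⊗ u ⊝ y ⊗ v) ≡.refl x y u v)
    (ℤ.∣m∣n⇒∣m+n (ℤ.∣n⇒∣m*n u d) (ℤ.∣n⇒∣m*n y e)))

  ≈ₘ-neg : ∀ {x y} → x ≈ₘ y → ℤ.- x ≈ₘ ℤ.- y
  ≈ₘ-neg {x} {y} (modulo d) = modulo (≡.subst (+ q ℤ.∣_) (ℤ.neg-distrib-+ x (ℤ.- y)) (ℤ.∣m⇒∣-m d))

  ℤ/q : CommutativeRing 0ℓ 0ℓ
  ℤ/q = record
    { Carrier = ℤ ; _≈_ = _≈ₘ_ ; _+_ = ℤ._+_ ; _*_ = ℤ._*_ ; -_ = ℤ.-_ ; 0# = + 0 ; 1# = + 1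
    ; isCommutativeRing = record
      { isRing = record
        { +-isAbelianGroup = record
          { isGroup = record
            { isMonoid = record
              { isSemigroup = record
                { isMagma = record
                  { isEquivalence = record { refl = ≡⇒≈ₘ ≡.refl ; sym = ≈ₘ-sym ; trans = ≈ₘ-trans }
                  ; ∙-cong        = ≈ₘ-+
                  }
                ; assoc = λ x y z → ≡⇒≈ₘ (ℤ.+-assoc x y z)
                }
              ; identity = (λ x → ≡⇒≈ₘ (ℤ.+-identityˡ x)) , (λ x → ≡⇒≈ₘ (ℤ.+-identityʳ x))
              }
            ; inverse = (λ x → ≡⇒≈ₘ (ℤ.+-inverseˡ x)) , (λ x → ≡⇒≈ₘ (ℤ.+-inverseʳ x))
            ; ⁻¹-cong = ≈ₘ-neg
            }
          ; comm = λ x y → ≡⇒≈ₘ (ℤ.+-comm x y)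
          }
        ; *-cong     = ≈ₘ-*
        ; *-assoc    = λ x y z → ≡⇒≈ₘ (ℤ.*-assoc x y z)
        ; *-identity = (λ x → ≡⇒≈ₘ (ℤ.*-identityˡ x)) , (λ x → ≡⇒≈ₘ (ℤ.*-identityʳ x))
        ; distrib    = (λ x y z → ≡⇒≈ₘ (ℤ.*-distribˡ-+ x y z)) , (λ x y z → ≡⇒≈ₘ (ℤ.*-distribʳ-+ x y z))
        }
      ; *-comm = λ x y → ≡⇒≈ₘ (ℤ.*-comm x y)
      }
    }

  -≈ₘ0⇒≈ₘ : ∀ {x y} → x ℤ.- y ≈ₘ + 0 → x ≈ₘ y
  -≈ₘ0⇒≈ₘ {x} {y} (modulo d) = modulo (≡.subst (+ q ℤ.∣_) (ℤ.+-identityʳ (x ℤ.- y)) d)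

  +-injectiveₘ : ∀ {i j} → i ℕ.< q → j ℕ.< q → + i ≈ₘ + j → i ≡ j
  +-injectiveₘ {i} {j} i<q j<q (modulo d) = ≡.trans (≡.sym (ℕ.m<n⇒m%n≡m i<q)) (≡.trans ([mod]⇒%≡ q i j (ℤ.∣⇒∣ᵤ d)) (ℕ.m<n⇒m%n≡m j<q))
    where
    instance
      q≢0 : ℕ.NonZero q
      q≢0 = ℕ.>-nonZero (ℕ.≤-<-trans z≤n i<q)

  opaque
    residueₘ : .{{_ : ℕ.NonZero q}} → ∀ z → Σ (Fin q) λ r → z ≈ₘ + toℕ r
    residueₘ z = Fin.fromℕ< (ℤ.n%ℕd<d z q) , modulo (ℤ.divides (z ℤ./ℕ q)
      (≡.trans (≡.cong₂ (λ x r → x ℤ.- + r) (ℤ.a≡a%ℕn+[a/ℕn]*n z q) (Fin.toℕ-fromℕ< (ℤ.n%ℕd<d z q)))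
        (ℤsolve 2 (λ r x → (r ⊕ x) ⊝ r ⊜ x) ≡.refl (+ (z ℤ.%ℕ q)) (z ℤ./ℕ q ℤ.* + q))))

-- The finite Fourier transform at a root of unity of order s.

module FiniteFourier (A : CommutativeRing ℓᶜ ℓ) where

  open CommutativeRing A hiding (zero)
  open IntegerCoefficients A using (⟦_⟧)
  open import Algebra.Properties.Semiring.Exp semiring using (_^_; ^-homo-*; ^-assocʳ; ^-congˡ)
  open Sums A
  open import Algebra.Properties.Group +-group using (x∙y⁻¹≈ε⇒x≈y)
  open import Relation.Binary.Reasoning.Setoid setoid

  module Transform (cancel : ∀ {x y} → ¬ x ≈ 0# → x * y ≈ 0# → y ≈ 0#) (s : ℕ) (s⁻¹ : Carrier) (s⁻¹*s≈1 : s⁻¹ * ⟦ + s ⟧ ≈ 1#)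
                   (α : Carrier) (α^s≈1 : α ^ s ≈ 1#) (α^k≉1 : ∀ k → 0 ℕ.< k → k ℕ.< s → ¬ α ^ k ≈ 1#) where

    1^k≈1 : ∀ k → 1# ^ k ≈ 1#
    1^k≈1 zero    = refl
    1^k≈1 (suc k) = trans (*-identityˡ _) (1^k≈1 k)

    α^sk : ∀ k → α ^ (s ℕ.* k) ≈ 1#
    α^sk k = trans (sym (^-assocʳ α s k)) (trans (^-congˡ k α^s≈1) (1^k≈1 k))

    ∑-1 : ∀ m → ∑< m (λ _ → 1#) ≈ ⟦ + m ⟧
    ∑-1 zero    = refl
    ∑-1 (suc m) = +-congˡ (∑-1 m)

    orthogonal : ∀ k → ¬ α ^ k ≈ 1# → ∑< s (λ j → α ^ (j ℕ.* k)) ≈ 0#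
    orthogonal k ≉1 = trans
      (∑<-cong s λ j _ → trans (reflexive (≡.cong (α ^_) (ℕ.*-comm j k))) (sym (^-assocʳ α k j)))
      (cancel (≉1 ∘ x∙y⁻¹≈ε⇒x≈y _ _) (trans (geometric (α ^ k) s) (trans (+-congʳ (trans (^-assocʳ α k s) (trans (reflexive (≡.cong (α ^_) (ℕ.*-comm k s))) (α^sk k)))) (-‿inverseʳ (1#)))))

    -- Since α^s = 1, the factor `(s ∸ 1) ℕ.* i` plays the role of the exponent - i. The power is
    -- that of the difference of k and i, or its inverse, and the difference is positive and below
    -- s.
    α^-distinct : ∀ {i k} → i ℕ.< s → k ℕ.< s → ¬ i ≡ k → ¬ α ^ (k ℕ.+ (s ∸ 1) ℕ.* i) ≈ 1#
    α^-distinct {i} {k} i<s k<s i≢k eq with ℕ.<-cmp i k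
    ... | tri≈ _ i≡k _ = i≢k i≡k
    ... | tri< i<k _ _ = α^k≉1 (k ∸ i) (ℕ.m<n⇒0<n∸m i<k) (ℕ.≤-<-trans (ℕ.m∸n≤m k i) k<s) (begin
      α ^ (k ∸ i)                            ≈⟨ *-identityʳ _ ⟨
      α ^ (k ∸ i) * 1#                      ≈⟨ *-congˡ (α^sk i) ⟨
      α ^ (k ∸ i) * α ^ (s ℕ.* i)            ≈⟨ ^-homo-* α (k ∸ i) (s ℕ.* i) ⟨
      α ^ (k ∸ i ℕ.+ s ℕ.* i)                ≡⟨ ≡.cong (α ^_) exponent ⟩
      α ^ (k ℕ.+ (s ∸ 1) ℕ.* i)              ≈⟨ eq ⟩
      1#                                     ∎)
      where
      exponent : k ∸ i ℕ.+ s ℕ.* i ≡ k ℕ.+ (s ∸ 1) ℕ.* i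
      exponent = ≡.trans (≡.cong (λ t → k ∸ i ℕ.+ t ℕ.* i) (≡.sym (ℕ.m+[n∸m]≡n (ℕ.≤-trans (s≤s z≤n) i<s))))
        (≡.trans (≡.sym (ℕ.+-assoc (k ∸ i) i ((s ∸ 1) ℕ.* i))) (≡.cong (ℕ._+ (s ∸ 1) ℕ.* i) (ℕ.m∸n+n≡m (ℕ.<⇒≤ i<k))))
    ... | tri> _ _ k<i = α^k≉1 (i ∸ k) (ℕ.m<n⇒0<n∸m k<i) (ℕ.≤-<-trans (ℕ.m∸n≤m i k) i<s) (begin
      α ^ (i ∸ k)                                        ≈⟨ *-identityʳ _ ⟨
      α ^ (i ∸ k) * 1#                                  ≈⟨ *-congˡ eq ⟨
      α ^ (i ∸ k) * α ^ (k ℕ.+ (s ∸ 1) ℕ.* i)            ≈⟨ ^-homo-* α (i ∸ k) (k ℕ.+ (s ∸ 1) ℕ.* i) ⟨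
      α ^ (i ∸ k ℕ.+ (k ℕ.+ (s ∸ 1) ℕ.* i))              ≡⟨ ≡.cong (α ^_) exponent ⟩
      α ^ (s ℕ.* i)                                      ≈⟨ α^sk i ⟩
      1#                                                 ∎)
      where
      exponent : i ∸ k ℕ.+ (k ℕ.+ (s ∸ 1) ℕ.* i) ≡ s ℕ.* i
      exponent = ≡.trans (≡.sym (ℕ.+-assoc (i ∸ k) k ((s ∸ 1) ℕ.* i))) (≡.trans (≡.cong (ℕ._+ (s ∸ 1) ℕ.* i) (ℕ.m∸n+n≡m (ℕ.<⇒≤ k<i)))
        (≡.cong (ℕ._* i) (ℕ.m+[n∸m]≡n (ℕ.≤-trans (s≤s z≤n) i<s))))

    -- The inverse transform of the spectrum that equals `c` below m and is zero from m on.
    inverse-transform : ∀ m → (ℕ → Carrier) → ℕ → Carrier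
    inverse-transform m c j = s⁻¹ * ∑< m (λ i → c i * α ^ (j ℕ.* ((s ∸ 1) ℕ.* i)))

    -- After exchanging the sums, the prescribed value `c i` is weighted by the sum of the powers of
    -- α^(k - i), which is s for i = k and vanishes otherwise.
    transform-inverse : ∀ m → m ℕ.≤ s → ∀ c k → k ℕ.< m →
                        ∑< s (λ j → inverse-transform m c j * α ^ (j ℕ.* k)) ≈ c k
    transform-inverse m m≤s c k k<m = begin
      ∑< s (λ j → inverse-transform m c j * α ^ (j ℕ.* k))
        ≈⟨ ∑<-cong s (λ j _ → trans (*-assoc s⁻¹ (∑< m (λ i → c i * α ^ (j ℕ.* ((s ∸ 1) ℕ.* i)))) (α ^ (j ℕ.* k)))
             (*-congˡ {s⁻¹} (trans (sym (∑<-*ʳ m (α ^ (j ℕ.* k)) (λ i → c i * α ^ (j ℕ.* ((s ∸ 1) ℕ.* i)))))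
               (∑<-cong m λ i _ → combine i j)))) ⟩
      ∑< s (λ j → s⁻¹ * ∑< m (λ i → c i * α ^ (j ℕ.* exponent i)))
        ≈⟨ ∑<-*ˡ s s⁻¹ (λ j → ∑< m (λ i → c i * α ^ (j ℕ.* exponent i))) ⟩
      s⁻¹ * ∑< s (λ j → ∑< m (λ i → c i * α ^ (j ℕ.* exponent i)))
        ≈⟨ *-congˡ (trans (∑<-swap s m (λ j i → c i * α ^ (j ℕ.* exponent i)))
             (∑<-cong m λ i _ → ∑<-*ˡ s (c i) (λ j → α ^ (j ℕ.* exponent i)))) ⟩
      s⁻¹ * ∑< m (λ i → c i * ∑< s (λ j → α ^ (j ℕ.* exponent i)))
        ≈⟨ *-congˡ (single m k k<m (λ i → c i * ∑< s (λ j → α ^ (j ℕ.* exponent i))) λ i i<m i≢k →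
             trans (*-congˡ (orthogonal (exponent i) (α^-distinct (ℕ.<-≤-trans i<m m≤s) (ℕ.<-≤-trans k<m m≤s) i≢k))) (zeroʳ (c i))) ⟩
      s⁻¹ * (c k * ∑< s (λ j → α ^ (j ℕ.* exponent k)))
        ≈⟨ *-congˡ (*-congˡ (trans (∑<-cong s {λ j → α ^ (j ℕ.* exponent k)} {λ _ → 1#} λ j _ → diagonal j) (∑-1 s))) ⟩
      s⁻¹ * (c k * ⟦ + s ⟧)
        ≈⟨ trans (*-congˡ (*-comm (c k) ⟦ + s ⟧)) (trans (sym (*-assoc s⁻¹ ⟦ + s ⟧ (c k))) (trans (*-congʳ s⁻¹*s≈1) (*-identityˡ (c k)))) ⟩
      c k ∎
      where
      exponent : ℕ → ℕ
      exponent i = k ℕ.+ (s ∸ 1) ℕ.* i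
      combine : ∀ i j → c i * α ^ (j ℕ.* ((s ∸ 1) ℕ.* i)) * α ^ (j ℕ.* k) ≈ c i * α ^ (j ℕ.* exponent i)
      combine i j = trans (*-assoc (c i) (α ^ (j ℕ.* ((s ∸ 1) ℕ.* i))) (α ^ (j ℕ.* k))) (*-congˡ (trans (sym (^-homo-* α (j ℕ.* ((s ∸ 1) ℕ.* i)) (j ℕ.* k)))
        (reflexive (≡.cong (α ^_) (≡.trans (≡.sym (ℕ.*-distribˡ-+ j ((s ∸ 1) ℕ.* i) k)) (≡.cong (j ℕ.*_) (ℕ.+-comm ((s ∸ 1) ℕ.* i) k)))))))
      single : ∀ m k → k ℕ.< m → ∀ F → (∀ i → i ℕ.< m → ¬ i ≡ k → F i ≈ 0#) → ∑< m F ≈ F k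
      single (suc m) zero    _         F F≈0 = trans (+-congˡ (∑<-zero m λ i i<m → F≈0 (suc i) (s≤s i<m) λ ())) (+-identityʳ (F 0))
      single (suc m) (suc k) (s≤s k<m) F F≈0 = trans (+-cong (F≈0 0 (s≤s z≤n) λ ())
        (single m k k<m (F ∘ suc) λ i i<m i≢k → F≈0 (suc i) (s≤s i<m) (i≢k ∘ ℕ.suc-injective))) (+-identityˡ (F (suc k)))
      diagonal : ∀ j → α ^ (j ℕ.* exponent k) ≈ 1#
      diagonal j = trans (reflexive (≡.cong (α ^_) (≡.trans (≡.cong (λ t → j ℕ.* (t ℕ.* k)) (ℕ.m+[n∸m]≡n (ℕ.≤-trans (s≤s z≤n) (ℕ.<-≤-trans k<m m≤s))))
        (≡.trans (ℕ.*-comm j (s ℕ.* k)) (ℕ.*-assoc s k j))))) (α^sk (k ℕ.* j))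

-- Prescribed transform values modulo q.

module TransformMod (q : ℕ) (prime : Prime q) (s e : ℕ) (1+es≡q : suc (e ℕ.* s) ≡ q)
  (α : ℤ) (α^s≈1 : IntegersMod._≈ₘ_ q (α ℤ.^ s) (+ 1)) (α^k≉1 : ∀ k → 0 ℕ.< k → k ℕ.< s → ¬ IntegersMod._≈ₘ_ q (α ℤ.^ k) (+ 1)) where

  open IntegersMod q
  open CommutativeRing ℤ/q hiding (zero)
  open Sums ℤ/q
  open IntegerCoefficients ℤ/q using (⟦_⟧)
  open import Algebra.Properties.Semiring.Exp semiring using (_^_)
  open import Relation.Binary.Reasoning.Setoid setoid

  ^≡ : ∀ x k → x ℤ.^ k ≡ x ^ k
  ^≡ x zero    = ≡.refl
  ^≡ x (suc k) = ≡.cong (x ℤ.*_) (^≡ x k)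

  ⟦+⟧≡ : ∀ m → ⟦ + m ⟧ ≡ + m
  ⟦+⟧≡ zero    = ≡.refl
  ⟦+⟧≡ (suc m) = ≡.cong (ℤ._+_ (+ 1)) (⟦+⟧≡ m)

  cancel : ∀ {x y} → ¬ x ≈ + 0 → x * y ≈ + 0 → y ≈ + 0
  cancel {x} {y} x≉0 xy≈0 = case bezout prime x of λ where
      (inj₁ q∣x)          → contradiction (modulo (≡.subst (+ q ℤ.∣_) (≡.sym (ℤ.+-identityʳ x)) q∣x)) x≉0
      (inj₂ (a , b , eq)) → begin
        y                                    ≡⟨ ℤ.*-identityˡ y ⟨
        + 1 * y                              ≡⟨ ≡.cong (_* y) eq ⟨
        (a * x + b * + q) * y                ≡⟨ ℤsolve 5 (λ a x b q y → (a ⊗ x ⊕ b ⊗ q) ⊗ y ⊜ a ⊗ (x ⊗ y) ⊕ q ⊗ (b ⊗ y)) ≡.refl a x b (+ q) y ⟩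
        a * (x * y) + + q * (b * y)          ≈⟨ +-cong (*-congˡ {a} xy≈0) (*-congʳ {b * y} q≈0) ⟩
        a * + 0 + + 0 * (b * y)              ≈⟨ +-cong (zeroʳ a) (zeroˡ (b * y)) ⟩
        + 0                                  ∎
    where
    q≈0 : + q ≈ + 0
    q≈0 = modulo (≡.subst (+ q ℤ.∣_) (≡.sym (ℤ.+-identityʳ (+ q))) ℤ.∣-refl)

  -- As e s = q − 1, the inverse of s modulo q is − e.
  s⁻¹*s≈1 : ℤ.- + e * ⟦ + s ⟧ ≈ + 1
  s⁻¹*s≈1 = trans (reflexive (≡.cong (ℤ.- + e *_) (⟦+⟧≡ s))) (modulo (ℤ.divides (ℤ.- + 1) (≡.trans
    (ℤsolve 2 (λ e s → (⊖ e) ⊗ s ⊝ ℤcon (+ 1) ⊜ ℤcon (ℤ.- + 1) ⊗ (ℤcon (+ 1) ⊕ e ⊗ s)) ≡.refl (+ e) (+ s))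
    (≡.cong (ℤ.- + 1 *_) (≡.trans (≡.cong (ℤ._+_ (+ 1)) (≡.sym (ℤ.pos-* e s))) (≡.cong +_ 1+es≡q))))))

  private
    module F = FiniteFourier.Transform ℤ/q cancel s (ℤ.- + e) s⁻¹*s≈1 α (trans (reflexive (≡.sym (^≡ α s))) α^s≈1)
      (λ k 0<k k<s eq → α^k≉1 k 0<k k<s (trans (reflexive (^≡ α k)) eq))

  -- Surjectivity onto the tuples of residues; it provides a representative for every one of the p^m
  -- cosets.
  prescribe : ∀ m → m ℕ.≤ s → (c : ℕ → ℤ) →
              Σ (ℕ → ℤ) λ a → ∀ k → k ℕ.< m → ∑< s (λ j → a j * α ℤ.^ (j ℕ.* k)) ≈ c k
  prescribe m m≤s c = F.inverse-transform m c , λ k k<m → trans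
    (∑<-cong s {λ j → F.inverse-transform m c j * α ℤ.^ (j ℕ.* k)} {λ j → F.inverse-transform m c j * α ^ (j ℕ.* k)}
      λ j _ → reflexive (≡.cong (F.inverse-transform m c j *_) (^≡ α (j ℕ.* k))))
    (F.transform-inverse m m≤s c k k<m)

-- Least witnesses, and rational numbers with denominator one.

least : ∀ {P : ℕ → Set ℓ} → (∀ n → Dec (P n)) → ∀ n → P n → ∃ λ m → P m × (∀ k → k ℕ.< m → ¬ P k)
least P? zero    Pn = 0 , Pn , λ k ()
least P? (suc n) Pn with P? 0
... | yes P0 = 0 , P0 , λ k ()
... | no ¬P0 with least (P? ∘ suc) n Pn
...   | m , Pm , below = suc m , Pm , λ { zero _ → ¬P0 ; (suc k) (s≤s k<m) → below k k<m }

toℚᵘ-/1 : ∀ i → ℚ.toℚᵘ (i ℚ./ 1) ℚᵘ.≃ ℚᵘ.mkℚᵘ i 0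
toℚᵘ-/1 i = ℚ.toℚᵘ-fromℚᵘ (ℚᵘ.mkℚᵘ i 0)

+-/1 : ∀ i j → (i ℤ.+ j) ℚ./ 1 ≡ i ℚ./ 1 ℚ.+ j ℚ./ 1
+-/1 i j = ℚ.toℚᵘ-injective (begin
  ℚ.toℚᵘ ((i ℤ.+ j) ℚ./ 1)                      ≈⟨ toℚᵘ-/1 (i ℤ.+ j) ⟩
  ℚᵘ.mkℚᵘ (i ℤ.+ j) 0
    ≈⟨ ℚᵘ.*≡* (≡.cong (ℤ._* + 1) (≡.cong₂ ℤ._+_ (≡.sym (ℤ.*-identityʳ i)) (≡.sym (ℤ.*-identityʳ j)))) ⟩
  ℚᵘ.mkℚᵘ i 0 ℚᵘ.+ ℚᵘ.mkℚᵘ j 0                  ≈⟨ ℚᵘ.+-cong (toℚᵘ-/1 i) (toℚᵘ-/1 j) ⟨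
  ℚ.toℚᵘ (i ℚ./ 1) ℚᵘ.+ ℚ.toℚᵘ (j ℚ./ 1)        ≈⟨ ℚ.toℚᵘ-homo-+ (i ℚ./ 1) (j ℚ./ 1) ⟨
  ℚ.toℚᵘ (i ℚ./ 1 ℚ.+ j ℚ./ 1)                  ∎)
  where open ℚᵘ.≃-Reasoning

↧/1*q≡↥/1 : ∀ q → (ℚ.↧ q) ℚ./ 1 ℚ.* q ≡ (ℚ.↥ q) ℚ./ 1
↧/1*q≡↥/1 q@(mkℚ _ _ _) = ℚ.toℚᵘ-injective (begin
  ℚ.toℚᵘ ((ℚ.↧ q) ℚ./ 1 ℚ.* q)                ≈⟨ ℚ.toℚᵘ-homo-* ((ℚ.↧ q) ℚ./ 1) q ⟩
  ℚ.toℚᵘ ((ℚ.↧ q) ℚ./ 1) ℚᵘ.* ℚ.toℚᵘ q        ≈⟨ ℚᵘ.*-congʳ {ℚ.toℚᵘ q} (toℚᵘ-/1 (ℚ.↧ q)) ⟩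
  ℚᵘ.mkℚᵘ (ℚ.↧ q) 0 ℚᵘ.* ℚ.toℚᵘ q
    ≈⟨ ℚᵘ.*≡* (≡.trans (ℤ.*-identityʳ (ℚ.↧ q ℤ.* ℚ.↥ q)) (≡.trans (ℤ.*-comm (ℚ.↧ q) (ℚ.↥ q))
         (≡.cong (ℚ.↥ q ℤ.*_) (≡.cong +_ (≡.sym (ℕ.*-identityˡ (ℚ.↧ₙ q))))))) ⟩
  ℚᵘ.mkℚᵘ (ℚ.↥ q) 0                           ≈⟨ toℚᵘ-/1 (ℚ.↥ q) ⟨
  ℚ.toℚᵘ ((ℚ.↥ q) ℚ./ 1)                      ∎)
  where open ℚᵘ.≃-Reasoning

-- The field `L`: integers, characteristic zero, cancellation.

module CyclotomicField (L : CommutativeRing ℓᶜ ℓ) (ι : ℚ → CommutativeRing.Carrier L) (n : ℕ) (prime : Prime (suc (suc n)))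
  (ζ : CommutativeRing.Carrier L) (cyclotomic : IsCyclotomicField L ι (suc (suc n)) ζ) where

  open CommutativeRing L hiding (zero)
  open Sums L
  open IntegerCoefficients L
  open Solver using (solve; _:+_; _:*_; :-_; _:-_; con; _:=_)
  open IsCyclotomicField cyclotomic
  open IsField isField
  open IsRingHomomorphism ι-homomorphism using ()
    renaming (+-homo to ι-+; *-homo to ι-*; 1#-homo to ι-1; 0#-homo to ι-0; -‿homo to ι-neg)
  open import Algebra.Properties.Ring ring
    using (-‿distribˡ-*; -‿distribʳ-*; -0#≈0#; -‿involutive)
  open import Algebra.Properties.Semiring.Sum semiring
    using (sum; sum-cong-≋; ∑-distrib-+; *-distribˡ-sum; *-distribʳ-sum; ∑-comm; sum-permute)
  open import Algebra.Properties.CommutativeSemiring.Exp commutativeSemiring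
    using (_^_; ^-congˡ; ^-homo-*; ^-assocʳ; ^-distrib-*)
  open import Algebra.Properties.Group +-group using (x∙y⁻¹≈ε⇒x≈y; ∙-cancelˡ)
  open import Algebra.Properties.Semiring.Mult semiring using () renaming (_×_ to _×′_)
  open import Relation.Binary.Reasoning.Setoid setoid

  p N : ℕ
  p = suc (suc n)
  N = suc n

  -- Links the embedding through `ℚ`, in which integrality and coordinates are stated, with the
  -- integer multiples of 1 that the ring solver understands.
  fromℤ≈⟦⟧ : ∀ i → fromℤ L ι i ≈ ⟦ i ⟧
  fromℤ≈⟦⟧ (+ m) = nonneg m
    where
    nonneg : ∀ m → ι ((+ m) ℚ./ 1) ≈ m ×′ 1#
    nonneg zero    = ι-0
    nonneg (suc m) = begin
      ι (+ suc m ℚ./ 1)                   ≡⟨ ≡.cong ι (+-/1 (+ 1) (+ m)) ⟩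
      ι (+ 1 ℚ./ 1 ℚ.+ + m ℚ./ 1)         ≈⟨ ι-+ (+ 1 ℚ./ 1) (+ m ℚ./ 1) ⟩
      ι (+ 1 ℚ./ 1) + ι (+ m ℚ./ 1)       ≈⟨ +-cong ι-1 (nonneg m) ⟩
      1# + m ×′ 1#                        ∎
  fromℤ≈⟦⟧ -[1+ m ] = trans (ι-neg (+ suc m ℚ./ 1)) (-‿cong (fromℤ≈⟦⟧ (+ suc m)))

  ⟦↧⟧*ι≈⟦↥⟧ : ∀ q → ⟦ ℚ.↧ q ⟧ * ι q ≈ ⟦ ℚ.↥ q ⟧
  ⟦↧⟧*ι≈⟦↥⟧ q = begin
    ⟦ ℚ.↧ q ⟧ * ι q             ≈⟨ *-congʳ (fromℤ≈⟦⟧ (ℚ.↧ q)) ⟨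
    ι ((ℚ.↧ q) ℚ./ 1) * ι q     ≈⟨ ι-* _ q ⟨
    ι ((ℚ.↧ q) ℚ./ 1 ℚ.* q)     ≡⟨ ≡.cong ι (↧/1*q≡↥/1 q) ⟩
    fromℤ L ι (ℚ.↥ q)           ≈⟨ fromℤ≈⟦⟧ (ℚ.↥ q) ⟩
    ⟦ ℚ.↥ q ⟧                   ∎

  ⟦⟧-cong : ∀ {i j} → i ≡ j → ⟦ i ⟧ ≈ ⟦ j ⟧
  ⟦⟧-cong i≡j = reflexive (≡.cong ⟦_⟧ i≡j)

  -- The image of the fraction 1 / (m + 1) is an inverse, so a zero here would make 1 zero.
  suc≉0 : ∀ m → ¬ ⟦ + suc m ⟧ ≈ 0#
  suc≉0 m eq = 1≉0 (begin
    1#                     ≈⟨ ⟦1⟧ ⟨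
    ⟦ + 1 ⟧                ≈⟨ ⟦↧⟧*ι≈⟦↥⟧ q ⟨
    ⟦ + suc m ⟧ * ι q      ≈⟨ *-congʳ eq ⟩
    0# * ι q               ≈⟨ zeroˡ _ ⟩
    0#                     ∎)
    where q = mkℚ (+ 1) m (ℕ.1-coprimeTo (suc m))

  ⟦⟧≈0⇒≡0 : ∀ i → ⟦ i ⟧ ≈ 0# → i ≡ + 0
  ⟦⟧≈0⇒≡0 (+ zero)  _  = ≡.refl
  ⟦⟧≈0⇒≡0 (+ suc m) eq = contradiction eq (suc≉0 m)
  ⟦⟧≈0⇒≡0 -[1+ m ]  eq = contradiction (trans (sym (-‿involutive _)) (trans (-‿cong eq) -0#≈0#)) (suc≉0 m)

  *-nonzeroˡ : ∀ {x y} → ¬ x ≈ 0# → x * y ≈ 0# → y ≈ 0#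
  *-nonzeroˡ {x} {y} x≉0 xy≈0 = begin
    y              ≈⟨ *-identityˡ y ⟨
    1# * y         ≈⟨ *-congʳ (trans (*-comm _ _) (proj₂ (inverse x x≉0))) ⟨
    x⁻¹ * x * y    ≈⟨ *-assoc _ _ _ ⟩
    x⁻¹ * (x * y)  ≈⟨ *-congˡ xy≈0 ⟩
    x⁻¹ * 0#       ≈⟨ zeroʳ _ ⟩
    0#             ∎
    where x⁻¹ = proj₁ (inverse x x≉0)

  -≈0⇒≈ : ∀ {x y} → x - y ≈ 0# → x ≈ y
  -≈0⇒≈ = x∙y⁻¹≈ε⇒x≈y _ _

  ≈⇒-≈0 : ∀ {x y} → x ≈ y → x - y ≈ 0#
  ≈⇒-≈0 {x} {y} eq = trans (+-congʳ eq) (-‿inverseʳ y)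

  *-cancelˡ : ∀ {x y z} → ¬ x ≈ 0# → x * y ≈ x * z → y ≈ z
  *-cancelˡ {x} {y} {z} x≉0 eq = -≈0⇒≈ (*-nonzeroˡ x≉0 (begin
    x * (y - z)       ≈⟨ solve 3 (λ a b d → a :* (b :- d) := a :* b :- a :* d) refl x y z ⟩
    x * y - x * z     ≈⟨ ≈⇒-≈0 eq ⟩
    0#                ∎))

  -- The ring ℤ[ζ].

  ζ^p≈1 : ζ ^ p ≈ 1#
  ζ^p≈1 = IsPrimitiveRootOfUnity.power-one rootOfUnity

  ζ^k≉1 : ∀ k → 0 ℕ.< k → k ℕ.< p → ¬ ζ ^ k ≈ 1#
  ζ^k≉1 = IsPrimitiveRootOfUnity.minimal rootOfUnity

  -- The p powers used are dependent, one more than the rank. With all of them present,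
  -- multiplication by ζ is a cyclic shift of the coefficients, and closure under products needs no
  -- reduction.
  R : Pred Carrier ℓ
  R x = Σ (ℕ → ℤ) λ a → x ≈ ∑< p (λ i → ⟦ a i ⟧ * ζ ^ i)

  R-resp : ∀ {x y} → x ≈ y → x ∈ R → y ∈ R
  R-resp x≈y (a , eq) = a , trans (sym x≈y) eq

  R-+ : ∀ {x y} → x ∈ R → y ∈ R → x + y ∈ R
  R-+ {x} {y} (a , x≈) (b , y≈) = (λ i → a i ℤ.+ b i) , (begin
    x + y
      ≈⟨ +-cong x≈ y≈ ⟩
    ∑< p (λ i → ⟦ a i ⟧ * ζ ^ i) + ∑< p (λ i → ⟦ b i ⟧ * ζ ^ i)
      ≈⟨ ∑<-+ p (λ i → ⟦ a i ⟧ * ζ ^ i) (λ i → ⟦ b i ⟧ * ζ ^ i) ⟨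
    ∑< p (λ i → ⟦ a i ⟧ * ζ ^ i + ⟦ b i ⟧ * ζ ^ i)
      ≈⟨ ∑<-cong p (λ i _ → trans (*-congʳ (⟦+⟧ (a i) (b i))) (distribʳ (ζ ^ i) _ _)) ⟨
    ∑< p (λ i → ⟦ a i ℤ.+ b i ⟧ * ζ ^ i) ∎)

  R-⟦⟧* : ∀ {x} i → x ∈ R → ⟦ i ⟧ * x ∈ R
  R-⟦⟧* {x} j (a , x≈) = (λ i → j ℤ.* a i) , (begin
    ⟦ j ⟧ * x                                     ≈⟨ *-congˡ x≈ ⟩
    ⟦ j ⟧ * ∑< p (λ i → ⟦ a i ⟧ * ζ ^ i)          ≈⟨ ∑<-*ˡ p ⟦ j ⟧ (λ i → ⟦ a i ⟧ * ζ ^ i) ⟨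
    ∑< p (λ i → ⟦ j ⟧ * (⟦ a i ⟧ * ζ ^ i))
      ≈⟨ ∑<-cong p (λ i _ → trans (*-congʳ {ζ ^ i} (⟦*⟧ j (a i))) (*-assoc _ _ _)) ⟨
    ∑< p (λ i → ⟦ j ℤ.* a i ⟧ * ζ ^ i)            ∎)

  R-0 : 0# ∈ R
  R-0 = (λ _ → + 0) , sym (∑<-zero p (λ i _ → zeroˡ (ζ ^ i)))

  R-1 : 1# ∈ R
  R-1 = a , (begin
    1#                                        ≈⟨ +-identityʳ _ ⟨
    1# + 0#                                   ≈⟨ +-cong (trans (*-identityʳ _) ⟦1⟧) (∑<-zero N λ i _ → zeroˡ (ζ ^ suc i)) ⟨
    ⟦ + 1 ⟧ * 1# + ∑< N (λ i → 0# * ζ ^ suc i)  ≡⟨⟩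
    ∑< p (λ i → ⟦ a i ⟧ * ζ ^ i)              ∎)
    where
    a : ℕ → ℤ
    a zero    = + 1
    a (suc _) = + 0

  R-⟦⟧ : ∀ i → ⟦ i ⟧ ∈ R
  R-⟦⟧ i = R-resp (*-identityʳ _) (R-⟦⟧* i R-1)

  R-neg : ∀ {x} → x ∈ R → - x ∈ R
  R-neg {x} x∈R = R-resp (solve 1 (λ a → con (ℤ.- (+ 1)) :* a := :- a) refl x) (R-⟦⟧* (ℤ.- (+ 1)) x∈R)

  R-sub : ∀ {x y} → x ∈ R → y ∈ R → x - y ∈ R
  R-sub x∈R y∈R = R-+ x∈R (R-neg y∈R)

  R-sum : ∀ {m} {f : Fin m → Carrier} → (∀ i → f i ∈ R) → sum f ∈ R
  R-sum {zero}  _   = R-0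
  R-sum {suc m} f∈R = R-+ (f∈R zero) (R-sum (f∈R ∘ suc))

  R-ζ* : ∀ {x} → x ∈ R → ζ * x ∈ R
  R-ζ* {x} (a , x≈) = b , (begin
    ζ * x                                                     ≈⟨ *-congˡ x≈ ⟩
    ζ * ∑< p (λ i → ⟦ a i ⟧ * ζ ^ i)                          ≈⟨ ∑<-*ˡ p ζ (λ i → ⟦ a i ⟧ * ζ ^ i) ⟨
    ∑< p (λ i → ζ * (⟦ a i ⟧ * ζ ^ i))
      ≈⟨ ∑<-cong p (λ i _ → solve 3 (λ z d e → z :* (d :* e) := d :* (z :* e)) refl ζ ⟦ a i ⟧ (ζ ^ i)) ⟩
    ∑< p (λ i → ⟦ a i ⟧ * ζ ^ suc i)                          ≈⟨ ∑<-last N (λ i → ⟦ a i ⟧ * ζ ^ suc i) ⟩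
    ∑< N (λ i → ⟦ a i ⟧ * ζ ^ suc i) + ⟦ a N ⟧ * ζ ^ p        ≈⟨ +-comm _ _ ⟩
    ⟦ a N ⟧ * ζ ^ p + ∑< N (λ i → ⟦ a i ⟧ * ζ ^ suc i)        ≈⟨ +-congʳ (*-congˡ ζ^p≈1) ⟩
    ∑< p (λ i → ⟦ b i ⟧ * ζ ^ i)                              ∎)
    where
    b : ℕ → ℤ
    b zero    = a N
    b (suc i) = a i

  R-ζ^* : ∀ {x} k → x ∈ R → ζ ^ k * x ∈ R
  R-ζ^* zero    x∈R = R-resp (sym (*-identityˡ _)) x∈R
  R-ζ^* (suc k) x∈R = R-resp (sym (*-assoc _ _ _)) (R-ζ* (R-ζ^* k x∈R))

  R-* : ∀ {x y} → x ∈ R → y ∈ R → x * y ∈ R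
  R-* {x} {y} (a , x≈) y∈R = R-resp (sym (trans (*-congʳ x≈) (sym (∑<-*ʳ p y (λ i → ⟦ a i ⟧ * ζ ^ i)))))
    (R-sum {p} λ i → R-resp (sym (*-assoc _ _ _)) (R-⟦⟧* (a (toℕ i)) (R-ζ^* (toℕ i) y∈R)))

  R-^ : ∀ {x} k → x ∈ R → x ^ k ∈ R
  R-^ zero    x∈R = R-1
  R-^ (suc k) x∈R = R-* x∈R (R-^ k x∈R)

  R-ζ : ζ ∈ R
  R-ζ = R-resp (*-identityʳ ζ) (R-ζ* R-1)

  -- Divisibility by π = ζ - 1 and by p.

  π : Carrier
  π = ζ - 1#

  π≉0 : ¬ π ≈ 0#
  π≉0 eq = ζ^k≉1 1 (s≤s z≤n) (s≤s (s≤s z≤n)) (trans (*-identityʳ ζ) (-≈0⇒≈ eq))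

  R-π : π ∈ R
  R-π = R-sub R-ζ R-1

  1^n≈1 : ∀ m → 1# ^ m ≈ 1#
  1^n≈1 zero    = refl
  1^n≈1 (suc m) = trans (*-identityˡ _) (1^n≈1 m)

  open Freshman L

  private
    coeff : ℕ → ℕ
    coeff = coefficient n prime

    -- The tail of the binomial expansion of (π + 1)^p = 1: divided by π, that equation reads π^N +
    -- p (1 + π ρ) = 0.
    ρ : Carrier
    ρ = ∑< n (λ k → ⟦ + coeff (suc k) ⟧ * π ^ k)

    R-ρ : ρ ∈ R
    R-ρ = R-sum {n} λ k → R-⟦⟧* (+ coeff (suc (toℕ k))) (R-^ (toℕ k) R-π)

    Σ≈ : ∑< N (λ k → ⟦ + coeff k ⟧ * (π ^ suc k * 1# ^ (N ∸ k))) ≈ π * (1# + π * ρ)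
    Σ≈ = begin
      ∑< N (λ k → ⟦ + coeff k ⟧ * (π ^ suc k * 1# ^ (N ∸ k)))
        ≈⟨ ∑<-cong N (λ k _ → trans (*-congˡ {⟦ + coeff k ⟧} (trans (*-congˡ (1^n≈1 (N ∸ k))) (*-identityʳ _)))
             (solve 3 (λ d x e → d :* (x :* e) := x :* (d :* e)) refl ⟦ + coeff k ⟧ π (π ^ k))) ⟩
      ∑< N (λ k → π * (⟦ + coeff k ⟧ * π ^ k))
        ≈⟨ ∑<-*ˡ N π (λ k → ⟦ + coeff k ⟧ * π ^ k) ⟩
      π * (⟦ + coeff 0 ⟧ * 1# + ∑< n (λ k → ⟦ + coeff (suc k) ⟧ * π ^ suc k))
        ≈⟨ *-congˡ (+-cong (trans (*-identityʳ _) (trans (⟦⟧-cong (≡.cong +_ (coefficient-0 n prime))) ⟦1⟧))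
             (∑<-cong n (λ k _ → solve 3 (λ d x e → d :* (x :* e) := x :* (d :* e)) refl ⟦ + coeff (suc k) ⟧ π (π ^ k)))) ⟩
      π * (1# + ∑< n (λ k → π * (⟦ + coeff (suc k) ⟧ * π ^ k)))
        ≈⟨ *-congˡ (+-congˡ (∑<-*ˡ n π (λ k → ⟦ + coeff (suc k) ⟧ * π ^ k))) ⟩
      π * (1# + π * ρ) ∎

    expansion : π ^ N + ⟦ + p ⟧ * (1# + π * ρ) ≈ 0#
    expansion = *-nonzeroˡ π≉0 (∙-cancelˡ 1# _ _ (begin
      1# + π * (π ^ N + ⟦ + p ⟧ * (1# + π * ρ))
        ≈⟨ +-cong (1^n≈1 p) (solve 4 (λ x y q z → q :* (x :* z) :+ x :* y := x :* (y :+ q :* z)) refl π (π ^ N) ⟦ + p ⟧ (1# + π * ρ)) ⟨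
      1# ^ p + (⟦ + p ⟧ * (π * (1# + π * ρ)) + π ^ p)
        ≈⟨ +-congˡ (+-congʳ (*-congˡ Σ≈)) ⟨
      1# ^ p + (⟦ + p ⟧ * ∑< N (λ k → ⟦ + coeff k ⟧ * (π ^ suc k * 1# ^ (N ∸ k))) + π ^ p)
        ≈⟨ freshman n prime π 1# ⟨
      (π + 1#) ^ p
        ≈⟨ ^-congˡ p (trans (+-assoc _ _ _) (trans (+-congˡ (-‿inverseˡ 1#)) (+-identityʳ ζ))) ⟩
      ζ ^ p
        ≈⟨ ζ^p≈1 ⟩
      1#
        ≈⟨ +-identityʳ 1# ⟨
      1# + 0# ∎))

  infix 4 _∣ᴿ_
  _∣ᴿ_ : Carrier → Carrier → Set _
  x ∣ᴿ y = Σ Carrier λ r → r ∈ R × y ≈ x * r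

  ∣ᴿ-resp : ∀ {x y z} → y ≈ z → x ∣ᴿ y → x ∣ᴿ z
  ∣ᴿ-resp y≈z (r , r∈R , eq) = r , r∈R , trans (sym y≈z) eq

  ∣ᴿ-+ : ∀ {x y z} → x ∣ᴿ y → x ∣ᴿ z → x ∣ᴿ y + z
  ∣ᴿ-+ (r , r∈R , eq) (r′ , r′∈R , eq′) = r + r′ , R-+ r∈R r′∈R , trans (+-cong eq eq′) (sym (distribˡ _ _ _))

  ∣ᴿ-neg : ∀ {x y} → x ∣ᴿ y → x ∣ᴿ - y
  ∣ᴿ-neg (r , r∈R , eq) = - r , R-neg r∈R , trans (-‿cong eq) (-‿distribʳ-* _ _)

  ∣ᴿ-0 : ∀ {x} → x ∣ᴿ 0#
  ∣ᴿ-0 = 0# , R-0 , sym (zeroʳ _)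

  ∣ᴿ-*ʳ : ∀ {x y z} → z ∈ R → x ∣ᴿ y → x ∣ᴿ z * y
  ∣ᴿ-*ʳ {x} {y} {z} z∈R (r , r∈R , eq) = z * r , R-* z∈R r∈R ,
    trans (*-congˡ eq) (solve 3 (λ a b d → a :* (b :* d) := b :* (a :* d)) refl z x r)

  ∣ᴿ-* : ∀ {x y x′ y′} → x ∣ᴿ y → x′ ∣ᴿ y′ → x * x′ ∣ᴿ y * y′
  ∣ᴿ-* {x} {x′ = x′} (r , r∈R , eq) (r′ , r′∈R , eq′) = r * r′ , R-* r∈R r′∈R ,
    trans (*-cong eq eq′) (solve 4 (λ a b d e → (a :* b) :* (d :* e) := (a :* d) :* (b :* e)) refl x r x′ r′)

  ∣ᴿ-^ : ∀ {x y} k → x ∣ᴿ y → x ^ k ∣ᴿ y ^ k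
  ∣ᴿ-^ zero    _   = 1# , R-1 , sym (*-identityˡ 1#)
  ∣ᴿ-^ (suc k) x∣y = ∣ᴿ-* x∣y (∣ᴿ-^ k x∣y)

  ∣ᴿ-trans : ∀ {x y z} → x ∣ᴿ y → y ∣ᴿ z → x ∣ᴿ z
  ∣ᴿ-trans (r , r∈R , eq) (r′ , r′∈R , eq′) = r * r′ , R-* r∈R r′∈R ,
    trans eq′ (trans (*-congʳ eq) (*-assoc _ _ _))

  p∣π^N : ⟦ + p ⟧ ∣ᴿ π ^ N
  p∣π^N = - (1# + π * ρ) , R-neg (R-+ R-1 (R-* R-π R-ρ)) ,
    -≈0⇒≈ (trans (+-congˡ (trans (-‿cong (sym (-‿distribʳ-* _ _))) (-‿involutive _))) expansion)

  -- Bootstraps p = - π^N - π ρ p: a power of π dividing p on the right yields one more factor on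
  -- the left, as long as it still divides π^N. This avoids inverting 1 + π ρ in `R`.
  π^∣p : ∀ {j} → j ℕ.≤ N → π ^ j ∣ᴿ ⟦ + p ⟧
  π^∣p {zero}  _   = ⟦ + p ⟧ , R-⟦⟧ (+ p) , sym (*-identityˡ _)
  π^∣p {suc j} j<N = ∣ᴿ-resp (begin
      - π ^ N + - (π * ρ * P)
        ≈⟨ solve 3 (λ y P z → :- y :+ :- (z :* P) := P :- (y :+ P :* (con (+ 1) :+ z))) refl (π ^ N) P (π * ρ) ⟩
      P - (π ^ N + P * (⟦ + 1 ⟧ + π * ρ))
        ≈⟨ +-congˡ (-‿cong (trans (+-congˡ (*-congˡ (+-congʳ ⟦1⟧))) expansion)) ⟩
      P - 0#
        ≈⟨ trans (+-congˡ -0#≈0#) (+-identityʳ P) ⟩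
      P ∎)
    (∣ᴿ-+ (∣ᴿ-neg (π ^ (N ∸ suc j) , R-^ (N ∸ suc j) R-π ,
             trans (reflexive (≡.cong (π ^_) (≡.sym (ℕ.m+[n∸m]≡n j<N)))) (^-homo-* π (suc j) (N ∸ suc j))))
           (∣ᴿ-neg (∣ᴿ-* (ρ , R-ρ , refl) (π^∣p (ℕ.<⇒≤ j<N)))))
    where P = ⟦ + p ⟧

  -- Nakayama's lemma for the localisation of ℤ at 1 + q ℤ.
  nakayama : ∀ q → 1 ℕ.< q → ∀ m (e : Fin m → Carrier) →
             (k : Fin m → ℤ) (a : Fin m → Fin m → ℤ) →
             (∀ i → ⟦ + 1 ℤ.+ + q ℤ.* k i ⟧ * e i ≈ sum (λ j → ⟦ + q ℤ.* a i j ⟧ * e j)) →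
             ∀ i → e i ≈ 0#
  nakayama q 1<q (suc m) e k a eq = λ where
      zero    → e₀≈0
      (suc i) → rest i
    where
    Q = + q
    w u : ℤ
    w = k zero ℤ.- a zero zero
    u = + 1 ℤ.+ Q ℤ.* w
    S : Fin (suc m) → Carrier
    S i = sum (λ j → ⟦ Q ℤ.* a i (suc j) ⟧ * e (suc j))
    first : ⟦ u ⟧ * e zero ≈ S zero
    first = begin
      ⟦ u ⟧ * e zero
        ≈⟨ *-congʳ (⟦⟧-cong (ℤsolve 3 (λ x y z → ℤcon (+ 1) ⊕ x ⊗ (y ⊝ z) ⊜ (ℤcon (+ 1) ⊕ x ⊗ y) ⊝ x ⊗ z)
             ≡.refl Q (k zero) (a zero zero))) ⟩
      ⟦ (+ 1 ℤ.+ Q ℤ.* k zero) ℤ.- Q ℤ.* a zero zero ⟧ * e zero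
        ≈⟨ trans (*-congʳ (trans (⟦+⟧ (+ 1 ℤ.+ Q ℤ.* k zero) (ℤ.- (Q ℤ.* a zero zero))) (+-congˡ (⟦-⟧ (Q ℤ.* a zero zero))))) (distribʳ _ _ _) ⟩
      ⟦ + 1 ℤ.+ Q ℤ.* k zero ⟧ * e zero + - ⟦ Q ℤ.* a zero zero ⟧ * e zero
        ≈⟨ +-cong (eq zero) (sym (-‿distribˡ-* _ _)) ⟩
      (⟦ Q ℤ.* a zero zero ⟧ * e zero + S zero) - ⟦ Q ℤ.* a zero zero ⟧ * e zero
        ≈⟨ solve 2 (λ x y → (x :+ y) :- x := y) refl (⟦ Q ℤ.* a zero zero ⟧ * e zero) (S zero) ⟩
      S zero ∎
    -- The other equations are multiplied by `u`, so that `u` e₀ can be replaced by `S zero`. The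
    -- left coefficient (1 + q w)(1 + q k) is again 1 modulo q, and the right coefficients are still
    -- divisible by q.
    k′ : Fin m → ℤ
    k′ i = w ℤ.+ u ℤ.* k (suc i)
    a′ : Fin m → Fin m → ℤ
    a′ i j = a (suc i) zero ℤ.* (Q ℤ.* a zero (suc j)) ℤ.+ u ℤ.* a (suc i) (suc j)
    eq′ : ∀ i → ⟦ + 1 ℤ.+ Q ℤ.* k′ i ⟧ * e (suc i) ≈ sum (λ j → ⟦ Q ℤ.* a′ i j ⟧ * e (suc j))
    eq′ i = begin
      ⟦ + 1 ℤ.+ Q ℤ.* k′ i ⟧ * e (suc i)
        ≈⟨ *-congʳ (trans (⟦⟧-cong (ℤsolve 3 (λ x y z →
             ℤcon (+ 1) ⊕ x ⊗ (y ⊕ (ℤcon (+ 1) ⊕ x ⊗ y) ⊗ z) ⊜ (ℤcon (+ 1) ⊕ x ⊗ y) ⊗ (ℤcon (+ 1) ⊕ x ⊗ z))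
             ≡.refl Q w (k (suc i)))) (⟦*⟧ u _)) ⟩
      ⟦ u ⟧ * ⟦ + 1 ℤ.+ Q ℤ.* k (suc i) ⟧ * e (suc i)
        ≈⟨ trans (*-assoc _ _ _) (*-congˡ (eq (suc i))) ⟩
      ⟦ u ⟧ * (⟦ b ⟧ * e zero + S (suc i))
        ≈⟨ solve 4 (λ x y z t → x :* (y :* z :+ t) := y :* (x :* z) :+ x :* t) refl ⟦ u ⟧ ⟦ b ⟧ (e zero) (S (suc i)) ⟩
      ⟦ b ⟧ * (⟦ u ⟧ * e zero) + ⟦ u ⟧ * S (suc i)
        ≈⟨ +-congʳ (*-congˡ first) ⟩
      ⟦ b ⟧ * S zero + ⟦ u ⟧ * S (suc i)
        ≈⟨ +-cong (*-distribˡ-sum ⟦ b ⟧ (λ j → ⟦ Q ℤ.* a zero (suc j) ⟧ * e (suc j)))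
                  (*-distribˡ-sum ⟦ u ⟧ (λ j → ⟦ Q ℤ.* a (suc i) (suc j) ⟧ * e (suc j))) ⟩
      sum (λ j → ⟦ b ⟧ * (⟦ Q ℤ.* a zero (suc j) ⟧ * e (suc j))) + sum (λ j → ⟦ u ⟧ * (⟦ Q ℤ.* a (suc i) (suc j) ⟧ * e (suc j)))
        ≈⟨ ∑-distrib-+ (λ j → ⟦ b ⟧ * (⟦ Q ℤ.* a zero (suc j) ⟧ * e (suc j)))
                       (λ j → ⟦ u ⟧ * (⟦ Q ℤ.* a (suc i) (suc j) ⟧ * e (suc j))) ⟨
      sum (λ j → ⟦ b ⟧ * (⟦ Q ℤ.* a zero (suc j) ⟧ * e (suc j)) + ⟦ u ⟧ * (⟦ Q ℤ.* a (suc i) (suc j) ⟧ * e (suc j)))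
        ≈⟨ sum-cong-≋ {m} (λ j → combine (a zero (suc j)) (a (suc i) (suc j)) (e (suc j))) ⟩
      sum (λ j → ⟦ Q ℤ.* a′ i j ⟧ * e (suc j)) ∎
      where
      b = Q ℤ.* a (suc i) zero
      combine : ∀ x y z → ⟦ b ⟧ * (⟦ Q ℤ.* x ⟧ * z) + ⟦ u ⟧ * (⟦ Q ℤ.* y ⟧ * z) ≈
                ⟦ Q ℤ.* (a (suc i) zero ℤ.* (Q ℤ.* x) ℤ.+ u ℤ.* y) ⟧ * z
      combine x y z = begin
        ⟦ b ⟧ * (⟦ Q ℤ.* x ⟧ * z) + ⟦ u ⟧ * (⟦ Q ℤ.* y ⟧ * z)
          ≈⟨ +-cong (trans (sym (*-assoc _ _ _)) (*-congʳ (sym (⟦*⟧ b _))))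
                    (trans (sym (*-assoc _ _ _)) (*-congʳ (sym (⟦*⟧ u _)))) ⟩
        ⟦ b ℤ.* (Q ℤ.* x) ⟧ * z + ⟦ u ℤ.* (Q ℤ.* y) ⟧ * z
          ≈⟨ trans (sym (distribʳ _ _ _)) (*-congʳ (sym (⟦+⟧ (b ℤ.* (Q ℤ.* x)) (u ℤ.* (Q ℤ.* y))))) ⟩
        ⟦ b ℤ.* (Q ℤ.* x) ℤ.+ u ℤ.* (Q ℤ.* y) ⟧ * z
          ≈⟨ *-congʳ (⟦⟧-cong (ℤsolve 5 (λ Q a x u y → (Q ⊗ a) ⊗ (Q ⊗ x) ⊕ u ⊗ (Q ⊗ y) ⊜ Q ⊗ (a ⊗ (Q ⊗ x) ⊕ u ⊗ y))
               ≡.refl Q (a (suc i) zero) x u y)) ⟩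
        ⟦ Q ℤ.* (a (suc i) zero ℤ.* (Q ℤ.* x) ℤ.+ u ℤ.* y) ⟧ * z ∎
    rest : ∀ i → e (suc i) ≈ 0#
    rest = nakayama q 1<q m (e ∘ suc) k′ a′ eq′
    u≢0 : ¬ u ≡ + 0
    u≢0 u≡0 = ℕ.<⇒≱ 1<q (ℕ.∣⇒≤ (ℤ.∣⇒∣ᵤ (ℤ.∣m+n∣n⇒∣m {Q} {+ 1} (≡.subst (Q ℤ.∣_) (≡.sym u≡0) (ℤ.divides (+ 0) ≡.refl))
                                               (ℤ.divides w (ℤ.*-comm Q w)))))
    e₀≈0 : e zero ≈ 0#
    e₀≈0 = *-nonzeroˡ (u≢0 ∘ ⟦⟧≈0⇒≡0 u) (trans first (sum-zero λ j → trans (*-congˡ (rest j)) (zeroʳ ⟦ Q ℤ.* a zero (suc j) ⟧)))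

  -- If 1 = p r, then each power of ζ equals p times r times itself, an integer combination of all
  -- the powers with coefficients divisible by p, and Nakayama's lemma makes ζ^0 = 1 vanish.
  ⟦p⟧∤1 : ¬ ⟦ + p ⟧ ∣ᴿ 1#
  ⟦p⟧∤1 (r , r∈R , 1≈pr) = 1≉0 (nakayama p (s≤s (s≤s z≤n)) p (λ i → ζ ^ toℕ i) (λ _ → + 0) a eq zero)
    where
    a : Fin p → Fin p → ℤ
    a i j = proj₁ (R-ζ^* (toℕ i) r∈R) (toℕ j)
    eq : ∀ i → ⟦ + 1 ℤ.+ + p ℤ.* + 0 ⟧ * ζ ^ toℕ i ≈ sum (λ j → ⟦ + p ℤ.* a i j ⟧ * ζ ^ toℕ j)
    eq i = begin
      ⟦ + 1 ℤ.+ + p ℤ.* + 0 ⟧ * ζ ^ toℕ i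
        ≈⟨ *-congʳ (trans (⟦⟧-cong (≡.cong (ℤ._+_ (+ 1)) (ℤ.*-zeroʳ (+ p)))) (trans ⟦1⟧ 1≈pr)) ⟩
      ⟦ + p ⟧ * r * ζ ^ toℕ i
        ≈⟨ trans (*-assoc _ _ _) (*-congˡ (*-comm _ _)) ⟩
      ⟦ + p ⟧ * (ζ ^ toℕ i * r)
        ≈⟨ *-congˡ (proj₂ (R-ζ^* (toℕ i) r∈R)) ⟩
      ⟦ + p ⟧ * sum (λ j → ⟦ a i j ⟧ * ζ ^ toℕ j)
        ≈⟨ *-distribˡ-sum {p} ⟦ + p ⟧ (λ j → ⟦ a i j ⟧ * ζ ^ toℕ j) ⟩
      sum (λ j → ⟦ + p ⟧ * (⟦ a i j ⟧ * ζ ^ toℕ j))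
        ≈⟨ sum-cong-≋ {p} (λ j → trans (sym (*-assoc _ _ _)) (*-congʳ {ζ ^ toℕ j} (sym (⟦*⟧ (+ p) (a i j))))) ⟩
      sum (λ j → ⟦ + p ℤ.* a i j ⟧ * ζ ^ toℕ j) ∎

  π∤1 : ¬ π ∣ᴿ 1#
  π∤1 π∣1 = ⟦p⟧∤1 (∣ᴿ-trans p∣π^N (∣ᴿ-resp (1^n≈1 N) (∣ᴿ-^ N π∣1)))

  π∣p : π ∣ᴿ ⟦ + p ⟧
  π∣p = case π^∣p {1} (s≤s z≤n) of λ where
    (r , r∈R , eq) → r , r∈R , trans eq (*-congʳ (*-identityʳ π))

  -- Otherwise 1 = x i + y p would be divisible by π, as both i and p are.
  π∣⟦⟧⇒p∣ : ∀ i → π ∣ᴿ ⟦ i ⟧ → + p ℤ.∣ i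
  π∣⟦⟧⇒p∣ i π∣i = case bezout prime i of λ where
    (inj₁ p∣i)          → p∣i
    (inj₂ (x , y , eq)) → contradiction
      (∣ᴿ-resp (trans (sym (trans (⟦+⟧ (x ℤ.* i) (y ℤ.* + p)) (+-cong (⟦*⟧ x i) (⟦*⟧ y (+ p))))) (trans (⟦⟧-cong eq) ⟦1⟧))
        (∣ᴿ-+ (∣ᴿ-*ʳ (R-⟦⟧ x) π∣i) (∣ᴿ-*ʳ (R-⟦⟧ y) π∣p))) π∤1

  p∣⇒⟦⟧ : ∀ {i} → + p ℤ.∣ i → ⟦ + p ⟧ ∣ᴿ ⟦ i ⟧
  p∣⇒⟦⟧ (ℤ.divides q ≡.refl) = ⟦ q ⟧ , R-⟦⟧ q , trans (⟦*⟧ q (+ p)) (*-comm _ _)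

  -- Independence of the first p - 1 powers of ζ over the integers.

  evalζ : ℕ → (ℕ → ℤ) → Carrier
  evalζ m a = ∑< m (λ i → ⟦ a i ⟧ * ζ ^ i)

  evalζ-suc : ∀ m a → evalζ (suc m) a ≈ ⟦ a 0 ⟧ + ζ * evalζ m (a ∘ suc)
  evalζ-suc m a = +-cong (*-identityʳ _) (trans
    (∑<-cong m λ i _ → solve 3 (λ x y z → x :* (y :* z) := y :* (x :* z)) refl ⟦ a (suc i) ⟧ ζ (ζ ^ i))
    (∑<-*ˡ m ζ (λ i → ⟦ a (suc i) ⟧ * ζ ^ i)))

  π* : ∀ x → π * x ≈ ζ * x - x
  π* x = trans (distribʳ _ _ _) (+-congˡ (trans (sym (-‿distribˡ-* _ _)) (-‿cong (*-identityˡ x))))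

  -- Synthetic division by X − 1, evaluated at ζ.
  record Division (m : ℕ) (a : ℕ → ℤ) : Set ℓ where
    field
      remainder : ℤ
      quotient  : ℕ → ℤ
      division  : evalζ (suc m) a ≈ ⟦ remainder ⟧ + π * evalζ m quotient
      divisible : ∀ {q} → q ℤ.∣ remainder → (∀ i → i ℕ.< m → q ℤ.∣ quotient i) → ∀ i → i ℕ.< suc m → q ℤ.∣ a i

  divide : ∀ m a → Division m a
  divide zero a = record
    { remainder = a 0
    ; quotient  = λ _ → + 0
    ; division  = +-cong (*-identityʳ _) (sym (zeroʳ π))
    ; divisible = λ { q∣a _ zero _ → q∣a ; _ _ (suc _) (s≤s ()) }
    }
  divide (suc m) a = record
    { remainder = a 0 ℤ.+ r
    ; quotient  = g
    ; division  = begin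
        evalζ (suc (suc m)) a
          ≈⟨ evalζ-suc (suc m) a ⟩
        ⟦ a 0 ⟧ + ζ * evalζ (suc m) (a ∘ suc)
          ≈⟨ +-congˡ (*-congˡ (Division.division rec)) ⟩
        ⟦ a 0 ⟧ + ζ * (⟦ r ⟧ + π * E)
          ≈⟨ +-congˡ (*-congˡ (+-congˡ (π* E))) ⟩
        ⟦ a 0 ⟧ + ζ * (⟦ r ⟧ + (ζ * E - E))
          ≈⟨ solve 4 (λ a r z e → a :+ z :* (r :+ (z :* e :- e)) := (a :+ r) :+ (z :* (r :+ z :* e) :- (r :+ z :* e)))
               refl ⟦ a 0 ⟧ ⟦ r ⟧ ζ E ⟩
        (⟦ a 0 ⟧ + ⟦ r ⟧) + (ζ * (⟦ r ⟧ + ζ * E) - (⟦ r ⟧ + ζ * E))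
          ≈⟨ +-congˡ (π* _) ⟨
        (⟦ a 0 ⟧ + ⟦ r ⟧) + π * (⟦ r ⟧ + ζ * E)
          ≈⟨ +-cong (sym (⟦+⟧ (a 0) r)) (*-congˡ (sym (evalζ-suc m g))) ⟩
        ⟦ a 0 ℤ.+ r ⟧ + π * evalζ (suc m) g ∎
    ; divisible = λ where
        q∣r q∣g zero    _         → ℤ.∣m+n∣n⇒∣m q∣r (q∣g 0 (s≤s z≤n))
        q∣r q∣g (suc i) (s≤s i<m) → Division.divisible rec (q∣g 0 (s≤s z≤n)) (λ j j<m → q∣g (suc j) (s≤s j<m)) i i<m
    }
    where
    rec = divide m (a ∘ suc)
    r   = Division.remainder rec
    E   = evalζ m (Division.quotient rec)
    -- Horner's scheme at 1: the remainder is the sum of all coefficients, and the quotient consists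
    -- of the sums of the proper tails.
    g : ℕ → ℤ
    g zero    = r
    g (suc i) = Division.quotient rec i

  -- The remainder modulo π is divisible by π, hence by p, hence by π^m because m ≤ N. It can
  -- therefore be subtracted, one factor π cancelled, and the quotient treated alike.
  π^m∣evalζ⇒p∣ : ∀ m → m ℕ.≤ N → ∀ a → π ^ m ∣ᴿ evalζ m a → ∀ i → i ℕ.< m → + p ℤ.∣ a i
  π^m∣evalζ⇒p∣ (suc m) m<N a (r , r∈R , eq) = divisible p∣rem
    (π^m∣evalζ⇒p∣ m (ℕ.<⇒≤ m<N) quotient (cancelπ (∣ᴿ-resp
      (trans (+-congʳ division) (solve 2 (λ x y → (x :+ y) :- x := y) refl ⟦ remainder ⟧ (π * evalζ m quotient)))
      (∣ᴿ-+ (r , r∈R , eq) (∣ᴿ-neg (∣ᴿ-trans (π^∣p m<N) (p∣⇒⟦⟧ p∣rem)))))))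
    where
    open Division (divide m a)
    cancelπ : ∀ {y} → π ^ suc m ∣ᴿ π * y → π ^ m ∣ᴿ y
    cancelπ (s , s∈R , eq) = s , s∈R , *-cancelˡ π≉0 (trans eq (*-assoc _ _ _))
    p∣rem : + p ℤ.∣ remainder
    p∣rem = π∣⟦⟧⇒p∣ remainder (∣ᴿ-resp
      (trans (+-congʳ division) (solve 2 (λ x y → (x :+ y) :- y := x) refl ⟦ remainder ⟧ (π * evalζ m quotient)))
      (∣ᴿ-+ {π} (π ^ m * r , R-* (R-^ m R-π) r∈R , trans eq (*-assoc _ _ _))
        (∣ᴿ-neg (evalζ m quotient , R-sum {m} (λ i → R-⟦⟧* (quotient (toℕ i)) (R-^ (toℕ i) R-ζ)) , refl))))

  -- Zero is divisible by π^N, so p divides every coefficient of a relation; divided by p it is a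
  -- relation again.
  descend : ∀ k a → evalζ N a ≈ 0# → ∀ i → i ℕ.< N → ∃ λ b → a i ≡ + (p ℕ.^ k) ℤ.* b
  descend zero    a rel i i<N = a i , ≡.sym (ℤ.*-identityˡ (a i))
  descend (suc k) a rel i i<N = proj₁ ih , (
    ≡.trans (a≡ i i<N) (≡.trans (≡.cong (ℤ._* + p) (proj₂ ih)) (≡.trans (ℤ.*-comm _ (+ p))
    (≡.trans (≡.sym (ℤ.*-assoc (+ p) (+ (p ℕ.^ k)) (proj₁ ih))) (≡.cong (ℤ._* proj₁ ih) (≡.sym (ℤ.pos-* p (p ℕ.^ k))))))))
    where
    p∣a : ∀ i → i ℕ.< N → + p ℤ.∣ a i
    p∣a = π^m∣evalζ⇒p∣ N ℕ.≤-refl a (∣ᴿ-resp (sym rel) ∣ᴿ-0)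
    b : ℕ → ℤ
    b i with i ℕ.<? N
    ... | yes i<N = ℤ.quotient (p∣a i i<N)
    ... | no  _   = + 0
    a≡ : ∀ i → i ℕ.< N → a i ≡ b i ℤ.* + p
    a≡ i i<N with i ℕ.<? N
    ... | yes i<N = ℤ._∣_.equality (p∣a i i<N)
    ... | no  i≮N = contradiction i<N i≮N
    b-rel : evalζ N b ≈ 0#
    b-rel = *-nonzeroˡ (suc≉0 N) (trans (sym (trans
      (∑<-cong N λ i i<N → trans (*-congʳ {ζ ^ i} (trans (⟦⟧-cong (a≡ i i<N)) (trans (⟦*⟧ (b i) (+ p)) (*-comm _ _)))) (*-assoc ⟦ + p ⟧ ⟦ b i ⟧ (ζ ^ i)))
      (∑<-*ˡ N ⟦ + p ⟧ (λ i → ⟦ b i ⟧ * ζ ^ i)))) rel)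
    ih = descend k b b-rel i i<N

  evalζ-independent : ∀ a → evalζ N a ≈ 0# → ∀ i → i ℕ.< N → a i ≡ + 0
  -- An integer x divisible by p^|x| is zero, as p^|x| exceeds |x|; so this number of descents is
  -- enough.
  evalζ-independent a rel i i<N with descend ℤ.∣ a i ∣ a rel i i<N
  ... | b , eq = multiple-small (a i) b ℤ.∣ b ∣ ≡.refl eq
    where
    multiple-small : ∀ x b m → ℤ.∣ b ∣ ≡ m → x ≡ + (p ℕ.^ ℤ.∣ x ∣) ℤ.* b → x ≡ + 0
    multiple-small x b zero    ∣b∣≡0 eq = ≡.trans eq (≡.trans (≡.cong (+ (p ℕ.^ ℤ.∣ x ∣) ℤ.*_) (ℤ.∣i∣≡0⇒i≡0 ∣b∣≡0)) (ℤ.*-zeroʳ (+ (p ℕ.^ ℤ.∣ x ∣))))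
    multiple-small x b (suc m) ∣b∣≡  eq = contradiction (k<m^k p (s≤s (s≤s z≤n)) ℤ.∣ x ∣) (ℕ.≤⇒≯ (≡.subst (p ℕ.^ ℤ.∣ x ∣ ℕ.≤_)
      (≡.sym (≡.trans (≡.cong ℤ.∣_∣ eq) (≡.trans (ℤ.abs-* (+ (p ℕ.^ ℤ.∣ x ∣)) b) (≡.cong (p ℕ.^ ℤ.∣ x ∣ ℕ.*_) ∣b∣≡))))
      (ℕ.m≤m*n (p ℕ.^ ℤ.∣ x ∣) (suc m))))

  -- Integer relations, denominators and decidable equality.

  ⟦sum⟧ : ∀ {m} (f : Fin m → ℤ) → ⟦ ∑ℤ f ⟧ ≈ sum (λ i → ⟦ f i ⟧)
  ⟦sum⟧ {zero}  f = refl
  ⟦sum⟧ {suc m} f = trans (⟦+⟧ (f zero) (∑ℤ (f ∘ suc))) (+-congˡ (⟦sum⟧ (f ∘ suc)))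

  integral-combination : ∀ {l m} (w : Fin m → Carrier) (v : Fin l → Carrier) (e : Fin l → Fin m → ℤ) (k : Fin l → ℤ) →
    (∀ i → v i ≈ sum (λ j → ⟦ e i j ⟧ * w j)) →
    sum (λ i → ⟦ k i ⟧ * v i) ≈ sum (λ j → ⟦ ∑ℤ (λ i → k i ℤ.* e i j) ⟧ * w j)
  integral-combination {l} {m} w v e k v≈ = begin
    sum (λ i → ⟦ k i ⟧ * v i)
      ≈⟨ sum-cong-≋ {l} (λ i → trans (*-congˡ (v≈ i)) (*-distribˡ-sum {m} ⟦ k i ⟧ (λ j → ⟦ e i j ⟧ * w j))) ⟩
    sum (λ i → sum (λ j → ⟦ k i ⟧ * (⟦ e i j ⟧ * w j)))
      ≈⟨ ∑-comm {l} {m} (λ i j → ⟦ k i ⟧ * (⟦ e i j ⟧ * w j)) ⟩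
    sum (λ j → sum (λ i → ⟦ k i ⟧ * (⟦ e i j ⟧ * w j)))
      ≈⟨ sum-cong-≋ {m} (λ j → trans (sum-cong-≋ {l} λ i → trans (sym (*-assoc _ _ _)) (*-congʳ {w j} (sym (⟦*⟧ (k i) (e i j)))))
           (trans (sym (*-distribʳ-sum {l} (w j) (λ i → ⟦ k i ℤ.* e i j ⟧))) (*-congʳ (sym (⟦sum⟧ (λ i → k i ℤ.* e i j)))))) ⟩
    sum (λ j → ⟦ ∑ℤ (λ i → k i ℤ.* e i j) ⟧ * w j) ∎

  ℤ-*-nonzeroˡ : ∀ {i j} → ¬ i ≡ + 0 → i ℤ.* j ≡ + 0 → j ≡ + 0
  ℤ-*-nonzeroˡ {i} i≢0 eq = [ (λ i≡0 → contradiction i≡0 i≢0) , (λ j≡0 → j≡0) ]′ (ℤ.i*j≡0⇒i≡0∨j≡0 i eq)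

  IntegerRelation : ∀ {m} → (Fin m → Carrier) → Set ℓ
  IntegerRelation {m} v = Σ (Fin m → ℤ) λ k → (∃ λ i → ¬ k i ≡ + 0) × sum (λ i → ⟦ k i ⟧ * v i) ≈ 0#

  opaque
    -- The coefficient vectors `e i` are dependent over the integers, and their relation is carried
    -- over to the `v i`; no independence of `w` enters.
    ℤ-dependent : ∀ {m} (w : Fin m → Carrier) (v : Fin (suc m) → Carrier) (e : Fin (suc m) → Fin m → ℤ) →
      (∀ i → v i ≈ sum (λ j → ⟦ e i j ⟧ * w j)) → IntegerRelation v
    ℤ-dependent {m} w v e v≈ = result (LinearDependence.Domain.dependent ℤ.+-*-commutativeRing (λ ()) ℤ-*-nonzeroˡ (ℤ._≟ + 0) m e)
      where
      result : LinearDependence.Relation ℤ.+-*-commutativeRing e → IntegerRelation v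
      result (k , k≢0 , rel) = k , k≢0 , trans (integral-combination w v e k v≈)
        (sum-zero {m} λ j → trans (*-congʳ {w j} (⟦⟧-cong (rel j))) (zeroˡ (w j)))

  Frac : Pred Carrier ℓ
  Frac x = Σ ℤ λ d → ¬ d ≡ + 0 × ⟦ d ⟧ * x ∈ R

  ⟦⟧≉0 : ∀ {i} → ¬ i ≡ + 0 → ¬ ⟦ i ⟧ ≈ 0#
  ⟦⟧≉0 i≢0 = i≢0 ∘ ⟦⟧≈0⇒≡0 _

  ℤ-*-≢0 : ∀ {i j} → ¬ i ≡ + 0 → ¬ j ≡ + 0 → ¬ i ℤ.* j ≡ + 0
  ℤ-*-≢0 i≢0 j≢0 eq = j≢0 (ℤ-*-nonzeroˡ i≢0 eq)

  R⊆Frac : ∀ {x} → x ∈ R → x ∈ Frac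
  R⊆Frac x∈R = + 1 , (λ ()) , R-⟦⟧* (+ 1) x∈R

  -- With z = d x in `R`, the p + 1 powers of z are combinations of p powers of ζ, hence related.
  -- Cancelling z down to the lowest nonzero coefficient l gives l + z h = 0, whence l y = - d h.
  Frac-inverse : ∀ {x y} → x ∈ Frac → x * y ≈ 1# → y ∈ Frac
  Frac-inverse {x} {y} (d , d≢0 , z∈R) xy≈1 = result (lowest k k≢0 rel)
    where
    z = ⟦ d ⟧ * x
    zy≈d : z * y ≈ ⟦ d ⟧
    zy≈d = trans (*-assoc _ _ _) (trans (*-congˡ xy≈1) (*-identityʳ _))
    z≉0 : ¬ z ≈ 0#
    z≉0 z≈0 = ⟦⟧≉0 d≢0 (trans (sym zy≈d) (trans (*-congʳ z≈0) (zeroˡ y)))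
    dep = ℤ-dependent {p} (λ j → ζ ^ toℕ j) (λ i → z ^ toℕ i) (λ i j → proj₁ (R-^ (toℕ i) z∈R) (toℕ j)) (λ i → proj₂ (R-^ (toℕ i) z∈R))
    k   = proj₁ dep
    k≢0 = proj₁ (proj₂ dep)
    rel = proj₂ (proj₂ dep)
    lowest : ∀ {m} (k : Fin m → ℤ) → (∃ λ i → ¬ k i ≡ + 0) → sum (λ i → ⟦ k i ⟧ * z ^ toℕ i) ≈ 0# →
             Σ ℤ λ l → ¬ l ≡ + 0 × Σ Carrier λ h → h ∈ R × ⟦ l ⟧ + z * h ≈ 0#
    lowest {suc m} k (i , kᵢ≢0) rel with k zero ℤ.≟ + 0
    ... | no k₀≢0 = k zero , k₀≢0 , h , R-sum {m} (λ i → R-⟦⟧* (k (suc i)) (R-^ (toℕ i) z∈R)) ,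
        trans (sym (+-cong (*-identityʳ ⟦ k zero ⟧) tail≈)) rel
      where
      h : Carrier
      h = sum (λ i → ⟦ k (suc i) ⟧ * z ^ toℕ i)
      tail≈ : sum (λ i → ⟦ k (suc i) ⟧ * z ^ suc (toℕ i)) ≈ z * h
      tail≈ = trans (sum-cong-≋ {m} λ i → solve 3 (λ a b d → a :* (b :* d) := b :* (a :* d)) refl ⟦ k (suc i) ⟧ z (z ^ toℕ i))
        (sym (*-distribˡ-sum {m} z (λ i → ⟦ k (suc i) ⟧ * z ^ toℕ i)))
    ... | yes k₀≡0 = lowest {m} (k ∘ suc) (shift i kᵢ≢0) (*-nonzeroˡ z≉0 (begin
        z * sum (λ i → ⟦ k (suc i) ⟧ * z ^ toℕ i)
          ≈⟨ *-distribˡ-sum {m} z (λ i → ⟦ k (suc i) ⟧ * z ^ toℕ i) ⟩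
        sum (λ i → z * (⟦ k (suc i) ⟧ * z ^ toℕ i))
          ≈⟨ sum-cong-≋ {m} (λ i → solve 3 (λ a b d → b :* (a :* d) := a :* (b :* d)) refl ⟦ k (suc i) ⟧ z (z ^ toℕ i)) ⟩
        sum (λ i → ⟦ k (suc i) ⟧ * z ^ suc (toℕ i))
          ≈⟨ trans (sym (+-identityˡ _)) (+-congʳ (sym (trans (*-congʳ (⟦⟧-cong k₀≡0)) (zeroˡ 1#)))) ⟩
        ⟦ k zero ⟧ * 1# + sum (λ i → ⟦ k (suc i) ⟧ * z ^ suc (toℕ i))
          ≈⟨ rel ⟩
        0# ∎))
      where
      shift : ∀ i → ¬ k i ≡ + 0 → ∃ λ i → ¬ k (suc i) ≡ + 0
      shift zero    k₀≢0 = contradiction k₀≡0 k₀≢0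
      shift (suc i) kᵢ≢0 = i , kᵢ≢0
    result : (Σ ℤ λ l → ¬ l ≡ + 0 × Σ Carrier λ h → h ∈ R × ⟦ l ⟧ + z * h ≈ 0#) → y ∈ Frac
    result (l , l≢0 , h , h∈R , eq) = l , l≢0 , R-resp (begin
      - (⟦ d ⟧ * h)                        ≈⟨ trans (sym (+-identityˡ _)) (+-congʳ (sym (zeroʳ y))) ⟩
      y * 0# + - (⟦ d ⟧ * h)               ≈⟨ +-cong (*-congˡ (sym eq)) (-‿cong (*-congʳ (sym zy≈d))) ⟩
      y * (⟦ l ⟧ + z * h) - z * y * h
        ≈⟨ solve 4 (λ y l z h → y :* (l :+ z :* h) :- z :* y :* h := l :* y) refl y ⟦ l ⟧ z h ⟩
      ⟦ l ⟧ * y                            ∎) (R-neg (R-⟦⟧* d h∈R))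

  Frac-isSubfield : IsSubfield L Frac
  Frac-isSubfield = record
    { resp      = λ { x≈y (d , d≢0 , dx∈R) → d , d≢0 , R-resp (*-congˡ x≈y) dx∈R }
    ; 0#-closed = R⊆Frac R-0
    ; 1#-closed = R⊆Frac R-1
    ; +-closed  = λ { {x} {y} (d , d≢0 , dx∈R) (d′ , d′≢0 , dy∈R) → d ℤ.* d′ , ℤ-*-≢0 d≢0 d′≢0 ,
        R-resp (trans (solve 4 (λ d d′ x y → d′ :* (d :* x) :+ d :* (d′ :* y) := d :* d′ :* (x :+ y)) refl ⟦ d ⟧ ⟦ d′ ⟧ x y)
                      (*-congʳ (sym (⟦*⟧ d d′))))
          (R-+ (R-⟦⟧* d′ dx∈R) (R-⟦⟧* d dy∈R)) }
    ; -‿closed  = λ { (d , d≢0 , dx∈R) → d , d≢0 , R-resp (-‿distribʳ-* _ _) (R-neg dx∈R) }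
    ; *-closed  = λ { {x} {y} (d , d≢0 , dx∈R) (d′ , d′≢0 , dy∈R) → d ℤ.* d′ , ℤ-*-≢0 d≢0 d′≢0 ,
        R-resp (trans (solve 4 (λ d d′ x y → (d :* x) :* (d′ :* y) := d :* d′ :* (x :* y)) refl ⟦ d ⟧ ⟦ d′ ⟧ x y)
                      (*-congʳ (sym (⟦*⟧ d d′))))
          (R-* dx∈R dy∈R) }
    ; inverse   = Frac-inverse
    }

  opaque
    -- The elements with an integer denominator form a subfield containing ζ, and `L` is the only
    -- such subfield.
    clear : ∀ x → x ∈ Frac
    clear = generated Frac Frac-isSubfield (R⊆Frac R-ζ)

  ∑ζ^≈0 : ∑< p (ζ ^_) ≈ 0#
  ∑ζ^≈0 = *-nonzeroˡ π≉0 (trans (geometric ζ p) (≈⇒-≈0 ζ^p≈1))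

  ζ≉0 : ¬ ζ ≈ 0#
  ζ≉0 ζ≈0 = 1≉0 (trans (sym ζ^p≈1) (trans (*-congʳ ζ≈0) (zeroˡ _)))

  ζ^≉0 : ∀ k → ¬ ζ ^ k ≈ 0#
  ζ^≉0 zero    = 1≉0
  ζ^≉0 (suc k) = ζ^≉0 k ∘ *-nonzeroˡ ζ≉0

  -- The exponents 1, ..., N represent the nonzero residues, so automorphisms permute these powers;
  -- the exponents 0, ..., N - 1 lack this symmetry.
  evalζ⁺ : (ℕ → ℤ) → Carrier
  evalζ⁺ a = ∑< N (λ i → ⟦ a i ⟧ * ζ ^ suc i)

  R⇒evalζ⁺ : ∀ {x} → x ∈ R → Σ (ℕ → ℤ) λ a → x ≈ evalζ⁺ a
  R⇒evalζ⁺ {x} (a , x≈) = (λ i → a (suc i) ℤ.- a 0) , (begin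
    x
      ≈⟨ x≈ ⟩
    ∑< p (λ i → ⟦ a i ⟧ * ζ ^ i)
      ≈⟨ trans (+-congˡ (trans (-‿cong (trans (*-congˡ ∑ζ^≈0) (zeroʳ _))) -0#≈0#)) (+-identityʳ _) ⟨
    ∑< p (λ i → ⟦ a i ⟧ * ζ ^ i) - ⟦ a 0 ⟧ * ∑< p (ζ ^_)
      ≈⟨ +-congˡ (trans (-‿distribˡ-* _ _) (sym (∑<-*ˡ p (- ⟦ a 0 ⟧) (ζ ^_)))) ⟩
    ∑< p (λ i → ⟦ a i ⟧ * ζ ^ i) + ∑< p (λ i → - ⟦ a 0 ⟧ * ζ ^ i)
      ≈⟨ ∑<-+ p (λ i → ⟦ a i ⟧ * ζ ^ i) (λ i → - ⟦ a 0 ⟧ * ζ ^ i) ⟨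
    ∑< p (λ i → ⟦ a i ⟧ * ζ ^ i + - ⟦ a 0 ⟧ * ζ ^ i)
      ≈⟨ ∑<-cong p (λ i _ → trans (sym (distribʳ (ζ ^ i) ⟦ a i ⟧ (- ⟦ a 0 ⟧)))
           (*-congʳ {ζ ^ i} (sym (trans (⟦+⟧ (a i) (ℤ.- a 0)) (+-congˡ (⟦-⟧ (a 0))))))) ⟩
    ∑< p (λ i → ⟦ a i ℤ.- a 0 ⟧ * ζ ^ i)
      ≈⟨ trans (+-congʳ (trans (*-congʳ (⟦⟧-cong (ℤ.+-inverseʳ (a 0)))) (zeroˡ 1#))) (+-identityˡ _) ⟩
    evalζ⁺ (λ i → a (suc i) ℤ.- a 0) ∎)

  evalζ⁺-independent : ∀ a → evalζ⁺ a ≈ 0# → ∀ i → i ℕ.< N → a i ≡ + 0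
  evalζ⁺-independent a rel = evalζ-independent a (*-nonzeroˡ ζ≉0 (trans (trans
    (sym (∑<-*ˡ N ζ (λ i → ⟦ a i ⟧ * ζ ^ i)))
    (∑<-cong N λ i _ → solve 3 (λ x y z → y :* (x :* z) := x :* (y :* z)) refl ⟦ a i ⟧ ζ (ζ ^ i))) rel))

  opaque
    -- After clearing the denominator, independence reduces the question to the vanishing of
    -- finitely many integers.
    ≈0? : ∀ x → Dec (x ≈ 0#)
    ≈0? x with clear x
    ... | d , d≢0 , dx∈R with R⇒evalζ⁺ dx∈R
    ...   | a , dx≈ with Fin.all? {n = N} (λ i → a (toℕ i) ℤ.≟ + 0)
    ...     | yes a≡0 = yes (*-nonzeroˡ (⟦⟧≉0 d≢0) (trans dx≈ (sum-zero {N} λ i → trans (*-congʳ {ζ ^ suc (toℕ i)} (⟦⟧-cong (a≡0 i))) (zeroˡ (ζ ^ suc (toℕ i))))))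
    ...     | no  a≢0 = no λ x≈0 → a≢0 λ i → evalζ⁺-independent a (trans (sym dx≈) (trans (*-congˡ x≈0) (zeroʳ _))) (toℕ i) (Fin.toℕ<n i)

  -- Integral elements lie in ℤ[ζ].

  -- The values at x of the polynomials over R: monic of degree k, respectively of degree less than k.
  data Monic : ℕ → Carrier → Carrier → Set (ℓᶜ Level.⊔ ℓ) where
    one  : ∀ {x y} → y ≈ 1# → Monic 0 x y
    cons : ∀ {k x y r m} → r ∈ R → Monic k x m → y ≈ r + x * m → Monic (suc k) x y

  data LowDegree : ℕ → Carrier → Carrier → Set (ℓᶜ Level.⊔ ℓ) where
    nil  : ∀ {x y} → y ≈ 0# → LowDegree 0 x y
    cons : ∀ {k x y r m} → r ∈ R → LowDegree k x m → y ≈ r + x * m → LowDegree (suc k) x y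

  Integral : Carrier → Set (ℓᶜ Level.⊔ ℓ)
  Integral x = ∃ λ k → Monic k x 0#

  Monic-resp : ∀ {k x y z} → y ≈ z → Monic k x y → Monic k x z
  Monic-resp y≈z (one eq)          = one (trans (sym y≈z) eq)
  Monic-resp y≈z (cons r∈R mon eq) = cons r∈R mon (trans (sym y≈z) eq)

  Monic⇒LowDegree : ∀ {k x y} → Monic k x y → LowDegree (suc k) x y
  Monic⇒LowDegree (one eq)          = cons R-1 (nil refl) (trans eq (sym (trans (+-congˡ (zeroʳ _)) (+-identityʳ 1#))))
  Monic⇒LowDegree (cons r∈R mon eq) = cons r∈R (Monic⇒LowDegree mon) eq

  LowDegree-R* : ∀ {k x y b} → b ∈ R → LowDegree k x y → LowDegree k x (b * y)
  LowDegree-R* b∈R (nil eq)           = nil (trans (*-congˡ eq) (zeroʳ _))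
  LowDegree-R* {x = x} {b = b} b∈R (cons {r = r} {m} r∈R low eq) = cons (R-* b∈R r∈R) (LowDegree-R* b∈R low)
    (trans (*-congˡ eq) (solve 4 (λ b r x m → b :* (r :+ x :* m) := b :* r :+ x :* (b :* m)) refl b r x m))

  LowDegree+Monic : ∀ {k x y z} → LowDegree k x y → Monic k x z → Monic k x (y + z)
  LowDegree+Monic (nil eq) (one eq′) = one (trans (+-cong eq eq′) (+-identityˡ 1#))
  LowDegree+Monic {x = x} (cons {r = r} {m} r∈R low eq) (cons {r = r′} {m′} r′∈R mon eq′) =
    cons (R-+ r∈R r′∈R) (LowDegree+Monic low mon)
      (trans (+-cong eq eq′) (solve 5 (λ r x m r′ m′ → (r :+ x :* m) :+ (r′ :+ x :* m′) := (r :+ r′) :+ x :* (m :+ m′)) refl r x m r′ m′))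

  -- In r + x m = - b m + (r + (x + b) m) the first term has smaller degree than the second and is
  -- absorbed by it.
  Monic-translate : ∀ {k x y b} → b ∈ R → Monic k x y → Monic k (x + b) y
  Monic-translate b∈R (one eq) = one eq
  Monic-translate {x = x} {b = b} b∈R (cons {r = r} {m} r∈R mon eq) =
    Monic-resp (trans (solve 4 (λ b m r x → :- b :* m :+ (r :+ (x :+ b) :* m) := r :+ x :* m) refl b m r x) (sym eq))
      (LowDegree+Monic (LowDegree-R* (R-neg b∈R) (Monic⇒LowDegree mon′)) (cons r∈R mon′ refl))
    where mon′ = Monic-translate b∈R mon

  -- Multiplying by b^k lets each power of x absorb as many factors b as it needs; the surplus goes
  -- into the lower coefficients.
  Monic-scale : ∀ {k x y b} → b ∈ R → Monic k x y → Monic k (b * x) (b ^ k * y)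
  Monic-scale b∈R (one eq) = one (trans (*-identityˡ _) eq)
  Monic-scale {suc k} {x} {b = b} b∈R (cons {r = r} {m} r∈R mon eq) = cons (R-* (R-^ (suc k) b∈R) r∈R) (Monic-scale b∈R mon)
    (trans (*-congˡ eq) (solve 5 (λ b B r x m → b :* B :* (r :+ x :* m) := b :* B :* r :+ (b :* x) :* (B :* m)) refl b (b ^ k) r x m))

  Integral-translate : ∀ {x b} → b ∈ R → Integral x → Integral (x + b)
  Integral-translate b∈R (k , mon) = k , Monic-translate b∈R mon

  Integral-scale : ∀ {x b} → b ∈ R → Integral x → Integral (b * x)
  Integral-scale b∈R (k , mon) = k , Monic-resp (zeroʳ _) (Monic-scale b∈R mon)

  IsIntegral⇒Integral : ∀ {x} → IsIntegral L ι x → Integral x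
  IsIntegral⇒Integral {x} (k , a , eq) = k , Monic-resp eq (polynomial k (λ i → fromℤ L ι (a i)) (λ i → R-resp (sym (fromℤ≈⟦⟧ (a i))) (R-⟦⟧ (a i))))
    where
    polynomial : ∀ k (r : Fin k → Carrier) → (∀ i → r i ∈ R) → Monic k x (x ^ k + sum (λ i → r i * x ^ toℕ i))
    polynomial zero    r r∈R = one (+-identityʳ 1#)
    polynomial (suc k) r r∈R = cons (r∈R zero) (polynomial k (r ∘ suc) (r∈R ∘ suc)) (begin
      x * x ^ k + (r zero * 1# + sum (λ i → r (suc i) * (x * x ^ toℕ i)))
        ≈⟨ +-congˡ (+-cong (*-identityʳ _) (trans
             (sum-cong-≋ {k} λ i → solve 3 (λ r x y → r :* (x :* y) := x :* (r :* y)) refl (r (suc i)) x (x ^ toℕ i))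
             (sym (*-distribˡ-sum {k} x (λ i → r (suc i) * x ^ toℕ i))))) ⟩
      x * x ^ k + (r zero + x * sum (λ i → r (suc i) * x ^ toℕ i))
        ≈⟨ solve 4 (λ x y r s → x :* y :+ (r :+ x :* s) := r :+ x :* (y :+ s)) refl x (x ^ k) (r zero) _ ⟩
      r zero + x * (x ^ k + sum (λ i → r (suc i) * x ^ toℕ i)) ∎)

  -- Multiplied by b^k, the monic equation of x becomes one for z = b x in which every term except
  -- z^k carries a factor b.
  Integral⇒∣^ : ∀ {x z b} → b ∈ R → z ∈ R → z ≈ b * x → Integral x → ∃ λ k → b ∣ᴿ z ^ k
  Integral⇒∣^ {x} {z} {b} b∈R z∈R z≈bx (k , mon) = k , ∣ᴿ-resp
      (trans (+-congˡ (-‿cong (zeroʳ _))) (trans (+-congˡ -0#≈0#) (+-identityʳ _))) (scaled mon)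
    where
    scaled : ∀ {k m} → Monic k x m → b ∣ᴿ z ^ k - b ^ k * m
    scaled (one eq) = ∣ᴿ-resp (sym (≈⇒-≈0 (sym (trans (*-identityˡ _) eq)))) ∣ᴿ-0
    scaled {suc k} (cons {r = r} {m} r∈R mon eq) = ∣ᴿ-resp (begin
        z * (z ^ k - b ^ k * m) + - (b ^ suc k * r)
          ≈⟨ solve 6 (λ z Z b B r m → z :* (Z :- B :* m) :+ :- (b :* B :* r) := z :* Z :- (b :* B :* r :+ B :* (z :* m))) refl z (z ^ k) b (b ^ k) r m ⟩
        z * z ^ k - (b * b ^ k * r + b ^ k * (z * m))
          ≈⟨ +-congˡ (-‿cong (+-congˡ (*-congˡ (trans (*-congʳ z≈bx) (*-assoc _ _ _))))) ⟩
        z * z ^ k - (b * b ^ k * r + b ^ k * (b * (x * m)))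
          ≈⟨ +-congˡ (-‿cong (trans (solve 5 (λ b B r x m → b :* B :* r :+ B :* (b :* (x :* m)) := b :* B :* (r :+ x :* m)) refl b (b ^ k) r x m) (*-congˡ (sym eq)))) ⟩
        z ^ suc k - b ^ suc k * _ ∎)
      (∣ᴿ-+ (∣ᴿ-*ʳ z∈R (scaled mon)) (∣ᴿ-neg (b ^ k * r , R-* (R-^ k b∈R) r∈R , *-assoc _ _ _)))

  ^-cong-∣ᴿ : ∀ {b x y} → x ∈ R → y ∈ R → b ∣ᴿ x - y → ∀ k → b ∣ᴿ x ^ k - y ^ k
  ^-cong-∣ᴿ x∈R y∈R b∣ zero    = ∣ᴿ-resp (sym (-‿inverseʳ 1#)) ∣ᴿ-0
  ^-cong-∣ᴿ {b} {x} {y} x∈R y∈R b∣ (suc k) = ∣ᴿ-resp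
    (solve 4 (λ x y X Y → x :* (X :- Y) :+ Y :* (x :- y) := x :* X :- y :* Y) refl x y (x ^ k) (y ^ k))
    (∣ᴿ-+ (∣ᴿ-*ʳ x∈R (^-cong-∣ᴿ x∈R y∈R b∣ k)) (∣ᴿ-*ʳ (R-^ k y∈R) b∣))

  ∣ᴿ-trans-sub : ∀ {b x y z} → b ∣ᴿ x - y → b ∣ᴿ y - z → b ∣ᴿ x - z
  ∣ᴿ-trans-sub {b} {x} {y} {z} d e = ∣ᴿ-resp (solve 3 (λ x y z → (x :- y) :+ (y :- z) := x :- z) refl x y z) (∣ᴿ-+ d e)

  module _ (m : ℕ) (q-prime : Prime (suc (suc m))) where

    private
      q : ℕ
      q = suc (suc m)

    frobenius : ∀ {x y} → x ∈ R → y ∈ R → ⟦ + q ⟧ ∣ᴿ (x + y) ^ q - (x ^ q + y ^ q)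
    frobenius {x} {y} x∈R y∈R = w , R-sum {suc m} (λ k → R-⟦⟧* (+ coefficient m q-prime (toℕ k)) (R-* (R-^ (suc (toℕ k)) x∈R) (R-^ (suc m ∸ toℕ k) y∈R))) ,
      trans (+-congʳ (freshman m q-prime x y)) (solve 3 (λ X Y W → (Y :+ (W :+ X)) :- (X :+ Y) := W) refl (x ^ q) (y ^ q) (⟦ + q ⟧ * w))
      where
      w = ∑< (suc m) (λ k → ⟦ + coefficient m q-prime k ⟧ * (x ^ suc k * y ^ (suc m ∸ k)))

    frobenius^ : ∀ k {x y} → x ∈ R → y ∈ R → ⟦ + q ⟧ ∣ᴿ (x + y) ^ (q ℕ.^ k) - (x ^ (q ℕ.^ k) + y ^ (q ℕ.^ k))
    frobenius^ zero {x} {y} x∈R y∈R = ∣ᴿ-resp (sym (≈⇒-≈0 (trans (*-identityʳ _) (sym (+-cong (*-identityʳ x) (*-identityʳ y)))))) ∣ᴿ-0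
    frobenius^ (suc k) {x} {y} x∈R y∈R = ∣ᴿ-resp (+-cong (pow (x + y)) (-‿cong (+-cong (pow x) (pow y))))
      (∣ᴿ-trans-sub (^-cong-∣ᴿ (R-^ Q (R-+ x∈R y∈R)) (R-+ (R-^ Q x∈R) (R-^ Q y∈R)) (frobenius^ k x∈R y∈R) q)
        (frobenius (R-^ Q x∈R) (R-^ Q y∈R)))
      where
      Q = q ℕ.^ k
      pow : ∀ z → (z ^ Q) ^ q ≈ z ^ (q ℕ.* Q)
      pow z = trans (^-assocʳ z Q q) (reflexive (≡.cong (z ^_) (ℕ.*-comm Q q)))

    -- Modulo q, raising to the power q^k is a ring homomorphism; the elements it fixes form a
    -- subring that contains ζ, hence everything.
    frobenius-fixes : ∀ k → ζ ^ (q ℕ.^ k) ≈ ζ → ∀ {x} → x ∈ R → ⟦ + q ⟧ ∣ᴿ x ^ (q ℕ.^ k) - x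
    frobenius-fixes k ζ^Q≈ζ (a , x≈) = fixed-resp (sym x≈) (fixed-sum {p} λ i → fixed-* (fixed-⟦⟧ (a (toℕ i))) (fixed-ζ^ (toℕ i)))
      where
      Q = q ℕ.^ k
      Fixed : Carrier → Set (ℓᶜ Level.⊔ ℓ)
      Fixed x = x ∈ R × ⟦ + q ⟧ ∣ᴿ x ^ Q - x
      fixed-resp : ∀ {x y} → x ≈ y → Fixed x → ⟦ + q ⟧ ∣ᴿ y ^ Q - y
      fixed-resp x≈y (_ , d) = ∣ᴿ-resp (+-cong (^-congˡ Q x≈y) (-‿cong x≈y)) d
      fixed-+ : ∀ {x y} → Fixed x → Fixed y → Fixed (x + y)
      fixed-+ {x} {y} (x∈R , d) (y∈R , e) = R-+ x∈R y∈R , ∣ᴿ-trans-sub (frobenius^ k x∈R y∈R)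
        (∣ᴿ-resp (solve 4 (λ X x Y y → (X :- x) :+ (Y :- y) := (X :+ Y) :- (x :+ y)) refl (x ^ Q) x (y ^ Q) y) (∣ᴿ-+ d e))
      fixed-0 : Fixed 0#
      fixed-0 = R-0 , ∣ᴿ-resp (sym (≈⇒-≈0 (0^ Q (ℕ.m^n>0 q k)))) ∣ᴿ-0
        where
        0^ : ∀ i → 0 ℕ.< i → 0# ^ i ≈ 0#
        0^ (suc i) _ = zeroˡ _
      fixed-1 : Fixed 1#
      fixed-1 = R-1 , ∣ᴿ-resp (sym (≈⇒-≈0 (1^n≈1 Q))) ∣ᴿ-0
      fixed-* : ∀ {x y} → Fixed x → Fixed y → Fixed (x * y)
      fixed-* {x} {y} (x∈R , d) (y∈R , e) = R-* x∈R y∈R , ∣ᴿ-resp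
        (trans (solve 4 (λ X x Y y → X :* (Y :- y) :+ y :* (X :- x) := X :* Y :- x :* y) refl (x ^ Q) x (y ^ Q) y)
               (+-congʳ (sym (^-distrib-* x y Q))))
        (∣ᴿ-+ (∣ᴿ-*ʳ (R-^ Q x∈R) e) (∣ᴿ-*ʳ y∈R d))
      -- Additivity is applied to x and - x, so the parity of `Q` does not matter.
      fixed-neg : ∀ {x} → Fixed x → Fixed (- x)
      fixed-neg {x} (x∈R , d) = R-neg x∈R , ∣ᴿ-resp
        (solve 4 (λ X x Y Z → (Z :- con (+ 0)) :- (Z :- (X :+ Y)) :- (X :- x) := Y :- :- x) refl (x ^ Q) x ((- x) ^ Q) ((x - x) ^ Q))
        (∣ᴿ-+ (∣ᴿ-+ (∣ᴿ-resp (+-congʳ (^-congˡ Q (sym (-‿inverseʳ x)))) (proj₂ fixed-0)) (∣ᴿ-neg (frobenius^ k x∈R (R-neg x∈R)))) (∣ᴿ-neg d))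
      fixed-sum : ∀ {m} {f : Fin m → Carrier} → (∀ i → Fixed (f i)) → Fixed (sum f)
      fixed-sum {zero}  _ = fixed-0
      fixed-sum {suc m} f = fixed-+ (f zero) (fixed-sum (f ∘ suc))
      fixed-ℕ : ∀ i → Fixed ⟦ + i ⟧
      fixed-ℕ zero    = fixed-0
      fixed-ℕ (suc i) = fixed-+ fixed-1 (fixed-ℕ i)
      fixed-⟦⟧ : ∀ i → Fixed ⟦ i ⟧
      fixed-⟦⟧ (+ i)    = fixed-ℕ i
      fixed-⟦⟧ -[1+ i ] = fixed-neg (fixed-ℕ (suc i))
      fixed-ζ^ : ∀ i → Fixed (ζ ^ i)
      fixed-ζ^ zero    = fixed-1
      fixed-ζ^ (suc i) = fixed-* (R-ζ , ∣ᴿ-resp (sym (≈⇒-≈0 ζ^Q≈ζ)) ∣ᴿ-0) (fixed-ζ^ i)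

  ∣⇒ζ^≈ : ∀ {i j} → p ℕ.∣ j ∸ i → i ℕ.≤ j → ζ ^ j ≈ ζ ^ i
  ∣⇒ζ^≈ {i} {j} (ℕ.divides k j∸i≡) i≤j = begin
    ζ ^ j                     ≡⟨ ≡.cong (ζ ^_) (ℕ.m+[n∸m]≡n i≤j) ⟨
    ζ ^ (i ℕ.+ (j ∸ i))       ≈⟨ ^-homo-* ζ i (j ∸ i) ⟩
    ζ ^ i * ζ ^ (j ∸ i)       ≡⟨ ≡.cong (λ l → ζ ^ i * ζ ^ l) (≡.trans j∸i≡ (ℕ.*-comm k p)) ⟩
    ζ ^ i * ζ ^ (p ℕ.* k)     ≈⟨ *-congˡ (trans (sym (^-assocʳ ζ p k)) (trans (^-congˡ k ζ^p≈1) (1^n≈1 k))) ⟩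
    ζ ^ i * 1#                ≈⟨ *-identityʳ _ ⟩
    ζ ^ i                     ∎

  opaque
    ∃-ζ^q^f≈ζ : ∀ q → .{{ℕ.NonZero q}} → ¬ p ℕ.∣ q → ∃ λ f → 0 ℕ.< f × ζ ^ (q ℕ.^ f) ≈ ζ
    ∃-ζ^q^f≈ζ q p∤q = result (UnitsMod.order p N ≡.refl prime {q} p∤q)
      where
      result : (∃ λ f → 0 ℕ.< f × f ℕ.≤ N × p ℕ.∣ q ℕ.^ f ∸ 1) → ∃ λ f → 0 ℕ.< f × ζ ^ (q ℕ.^ f) ≈ ζ
      result (f , 0<f , _ , p∣) = f , 0<f , trans (∣⇒ζ^≈ {1} {q ℕ.^ f} p∣ (ℕ.m^n>0 q f)) (*-identityʳ ζ)

  -- Z[ζ]/q is reduced for q ≠ p, because a power of the Frobenius map is the identity.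
  Integral⇒R-away : ∀ m (q-prime : Prime (suc (suc m))) → ¬ p ℕ.∣ suc (suc m) →
                    ∀ {x} → Integral x → ⟦ + suc (suc m) ⟧ * x ∈ R → x ∈ R
  Integral⇒R-away m q-prime p∤q {x} x-int z∈R = conclude q∣z
    where
    q : ℕ
    q = suc (suc m)
    z = ⟦ + q ⟧ * x
    f = proj₁ (∃-ζ^q^f≈ζ q p∤q)
    0<f : 0 ℕ.< f
    0<f = proj₁ (proj₂ (∃-ζ^q^f≈ζ q p∤q))
    k = proj₁ (Integral⇒∣^ (R-⟦⟧ (+ q)) z∈R refl x-int)
    q∣z^k : ⟦ + q ⟧ ∣ᴿ z ^ k
    q∣z^k = proj₂ (Integral⇒∣^ (R-⟦⟧ (+ q)) z∈R refl x-int)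
    ζ^Q : ∀ k → ζ ^ (q ℕ.^ (f ℕ.* k)) ≈ ζ
    ζ^Q zero    = trans (reflexive (≡.cong (λ l → ζ ^ (q ℕ.^ l)) (ℕ.*-zeroʳ f))) (*-identityʳ ζ)
    ζ^Q (suc k) = begin
      ζ ^ (q ℕ.^ (f ℕ.* suc k))             ≡⟨ ≡.cong (λ l → ζ ^ (q ℕ.^ l)) (ℕ.*-suc f k) ⟩
      ζ ^ (q ℕ.^ (f ℕ.+ f ℕ.* k))           ≡⟨ ≡.cong (ζ ^_) (ℕ.^-distribˡ-+-* q f (f ℕ.* k)) ⟩
      ζ ^ (q ℕ.^ f ℕ.* q ℕ.^ (f ℕ.* k))     ≈⟨ ^-assocʳ ζ (q ℕ.^ f) (q ℕ.^ (f ℕ.* k)) ⟨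
      (ζ ^ (q ℕ.^ f)) ^ (q ℕ.^ (f ℕ.* k))   ≈⟨ ^-congˡ (q ℕ.^ (f ℕ.* k)) (proj₂ (proj₂ (∃-ζ^q^f≈ζ q p∤q))) ⟩
      ζ ^ (q ℕ.^ (f ℕ.* k))                 ≈⟨ ζ^Q k ⟩
      ζ                                     ∎
    -- A multiple of the order `f` keeps ζ^Q = ζ, and the factor `k` makes Q at least k. So q
    -- divides z^Q, to which z is congruent modulo q.
    Q = q ℕ.^ (f ℕ.* k)
    k≤Q : k ℕ.≤ Q
    k≤Q = ℕ.≤-trans (ℕ.<⇒≤ (k<m^k q (s≤s (s≤s z≤n)) k)) (ℕ.^-monoʳ-≤ q (ℕ.m≤n*m k f {{ℕ.>-nonZero 0<f}}))
    q∣z^Q : ⟦ + q ⟧ ∣ᴿ z ^ Q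
    q∣z^Q = ∣ᴿ-resp (trans (sym (^-homo-* z (Q ∸ k) k)) (reflexive (≡.cong (z ^_) (ℕ.m∸n+n≡m k≤Q))))
      (∣ᴿ-*ʳ (R-^ (Q ∸ k) z∈R) q∣z^k)
    q∣z : ⟦ + q ⟧ ∣ᴿ z
    q∣z = ∣ᴿ-resp (solve 2 (λ Z z → Z :- (Z :- z) := z) refl (z ^ Q) z)
      (∣ᴿ-+ q∣z^Q (∣ᴿ-neg (frobenius-fixes m q-prime (f ℕ.* k) (ζ^Q k) z∈R)))
    conclude : ⟦ + q ⟧ ∣ᴿ z → x ∈ R
    conclude (r , r∈R , eq) = R-resp (*-cancelˡ (suc≉0 (suc m)) (sym eq)) r∈R

  mod-π : ∀ {w} → w ∈ R → ∃₂ λ i w′ → w′ ∈ R × w ≈ ⟦ i ⟧ + π * w′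
  mod-π (a , w≈) = remainder , evalζ N quotient , R-sum {N} (λ i → R-⟦⟧* (quotient (toℕ i)) (R-^ (toℕ i) R-ζ)) , trans w≈ division
    where open Division (divide N a)

  -- Otherwise x i is 1 modulo p for some x, hence modulo π, and taking k-th powers makes 1
  -- divisible by π.
  π∣^⇒p∣ : ∀ i k → π ∣ᴿ ⟦ i ⟧ ^ k → + p ℤ.∣ i
  π∣^⇒p∣ i k π∣i^k = case bezout prime i of λ where
      (inj₁ p∣i)          → p∣i
      (inj₂ (x , y , eq)) → contradiction
        (∣ᴿ-resp (trans (solve 2 (λ a b → (a :- b) :+ b := a) refl (1# ^ k) ((⟦ x ⟧ * ⟦ i ⟧) ^ k)) (1^n≈1 k))
          (∣ᴿ-+ (^-cong-∣ᴿ R-1 (R-* (R-⟦⟧ x) (R-⟦⟧ i))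
                   (∣ᴿ-resp (≡1 x y eq) (∣ᴿ-*ʳ (R-⟦⟧ y) π∣p)) k)
                (∣ᴿ-resp (sym (^-distrib-* ⟦ x ⟧ ⟦ i ⟧ k)) (∣ᴿ-*ʳ (R-^ k (R-⟦⟧ x)) π∣i^k)))) π∤1
    where
    ≡1 : ∀ x y → x ℤ.* i ℤ.+ y ℤ.* + p ≡ + 1 → ⟦ y ⟧ * ⟦ + p ⟧ ≈ 1# - ⟦ x ⟧ * ⟦ i ⟧
    ≡1 x y eq = begin
      ⟦ y ⟧ * ⟦ + p ⟧
        ≈⟨ solve 2 (λ a b → b := (a :+ b) :- a) refl (⟦ x ⟧ * ⟦ i ⟧) (⟦ y ⟧ * ⟦ + p ⟧) ⟩
      (⟦ x ⟧ * ⟦ i ⟧ + ⟦ y ⟧ * ⟦ + p ⟧) - ⟦ x ⟧ * ⟦ i ⟧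
        ≈⟨ +-congʳ (trans (sym (trans (⟦+⟧ (x ℤ.* i) (y ℤ.* + p)) (+-cong (⟦*⟧ x i) (⟦*⟧ y (+ p))))) (trans (⟦⟧-cong eq) ⟦1⟧)) ⟩
      1# - ⟦ x ⟧ * ⟦ i ⟧ ∎

  -- Ascending induction on the exponent of π: if π^k w / p is integral and k < p − 1,
  -- then the constant term of w modulo π is divisible by p and can be subtracted.
  Integral⇒R-at-p : ∀ j k → k ℕ.+ j ≡ N → ∀ {x w} → Integral x → w ∈ R → ⟦ + p ⟧ * x ≈ π ^ k * w → x ∈ R
  Integral⇒R-at-p zero k k+0≡N {x} {w} _ w∈R eq = R-resp (*-cancelˡ (suc≉0 N) (begin
      ⟦ + p ⟧ * (g * w)    ≈⟨ trans (sym (*-assoc _ _ _)) (*-congʳ (sym (proj₂ (proj₂ p∣π^N)))) ⟩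
      π ^ N * w            ≡⟨ ≡.cong (λ l → π ^ l * w) (≡.trans (≡.sym k+0≡N) (ℕ.+-identityʳ k)) ⟩
      π ^ k * w            ≈⟨ eq ⟨
      ⟦ + p ⟧ * x          ∎)) (R-* (proj₁ (proj₂ p∣π^N)) w∈R)
    where g = proj₁ p∣π^N
  Integral⇒R-at-p (suc j) k k+sj≡N {x} {w} x-int w∈R eq = R-resp
      (solve 2 (λ x y → (x :+ :- y) :+ y := x) refl x (π ^ k * ⟦ b ⟧))
      (R-+ (Integral⇒R-at-p j (suc k) (≡.trans (≡.sym (ℕ.+-suc k j)) k+sj≡N)
              (Integral-translate (R-neg πᵏb∈R) x-int) w′∈R eq′) πᵏb∈R)
    where
    k<N : suc k ℕ.≤ N
    k<N = ≡.subst (suc k ℕ.≤_) k+sj≡N (≡.subst (suc k ℕ.≤_) (≡.sym (ℕ.+-suc k j)) (s≤s (ℕ.m≤m+n k j)))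
    e = proj₁ (π^∣p k<N)
    e∈R = proj₁ (proj₂ (π^∣p k<N))
    -- With p = π^(k+1) e the equation p x = π^k w becomes w = π (e x). As e x is integral, π
    -- divides a power of w, hence a power of the constant term `i`.
    w≈πv : w ≈ π * (e * x)
    w≈πv = *-cancelˡ (^≉0 k) (begin
      π ^ k * w                 ≈⟨ eq ⟨
      ⟦ + p ⟧ * x               ≈⟨ *-congʳ (proj₂ (proj₂ (π^∣p k<N))) ⟩
      π ^ suc k * e * x         ≈⟨ solve 4 (λ π Π e x → π :* Π :* e :* x := Π :* (π :* (e :* x))) refl π (π ^ k) e x ⟩
      π ^ k * (π * (e * x))     ∎)
      where
      ^≉0 : ∀ k → ¬ π ^ k ≈ 0#
      ^≉0 zero    = 1≉0
      ^≉0 (suc k) = ^≉0 k ∘ *-nonzeroˡ π≉0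
    i = proj₁ (mod-π w∈R)
    w′ = proj₁ (proj₂ (mod-π w∈R))
    w′∈R = proj₁ (proj₂ (proj₂ (mod-π w∈R)))
    w≈ = proj₂ (proj₂ (proj₂ (mod-π w∈R)))
    w^n = Integral⇒∣^ R-π w∈R w≈πv (Integral-scale e∈R x-int)
    p∣i : + p ℤ.∣ i
    p∣i = π∣^⇒p∣ i (proj₁ w^n) (∣ᴿ-resp (solve 2 (λ a b → b :- (b :- a) := a) refl (⟦ i ⟧ ^ proj₁ w^n) (w ^ proj₁ w^n))
      (∣ᴿ-+ (proj₂ w^n) (∣ᴿ-neg (^-cong-∣ᴿ w∈R (R-⟦⟧ i)
        (w′ , w′∈R , trans (+-congʳ w≈) (solve 2 (λ a b → (a :+ b) :- a := b) refl ⟦ i ⟧ (π * w′))) (proj₁ w^n)))))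
    b = ℤ.quotient p∣i
    πᵏb∈R : π ^ k * ⟦ b ⟧ ∈ R
    πᵏb∈R = R-* (R-^ k R-π) (R-⟦⟧ b)
    eq′ : ⟦ + p ⟧ * (x + - (π ^ k * ⟦ b ⟧)) ≈ π ^ suc k * w′
    eq′ = begin
      ⟦ + p ⟧ * (x + - (π ^ k * ⟦ b ⟧))
        ≈⟨ solve 4 (λ p x Π b → p :* (x :+ :- (Π :* b)) := p :* x :- Π :* (b :* p)) refl ⟦ + p ⟧ x (π ^ k) ⟦ b ⟧ ⟩
      ⟦ + p ⟧ * x - π ^ k * (⟦ b ⟧ * ⟦ + p ⟧)
        ≈⟨ +-cong (trans eq (*-congˡ w≈)) (-‿cong (*-congˡ (sym (trans (⟦⟧-cong (ℤ._∣_.equality p∣i)) (⟦*⟧ b (+ p)))))) ⟩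
      π ^ k * (⟦ i ⟧ + π * w′) - π ^ k * ⟦ i ⟧
        ≈⟨ solve 4 (λ Π i π w → Π :* (i :+ π :* w) :- Π :* i := π :* Π :* w) refl (π ^ k) ⟦ i ⟧ π w′ ⟩
      π ^ suc k * w′ ∎

  Integral⇒R-prime : ∀ {q} → Prime q → ∀ {x} → Integral x → ⟦ + q ⟧ * x ∈ R → x ∈ R
  Integral⇒R-prime {zero}        ()
  Integral⇒R-prime {suc zero}    ()
  Integral⇒R-prime {suc (suc m)} q-prime x-int qx∈R with p ℕ.∣? suc (suc m)
  ... | no  p∤q = Integral⇒R-away m q-prime p∤q x-int qx∈R
  ... | yes p∣q with prime⇒irreducible q-prime p∣q
  ...   | inj₂ ≡.refl = Integral⇒R-at-p N 0 ≡.refl x-int qx∈R (sym (*-identityˡ _))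

  -- The prime factors of a denominator are removed one at a time; the product of the remaining ones
  -- times x is still integral.
  Integral⇒R : ∀ {x} → Integral x → x ∈ R
  Integral⇒R {x} x-int with clear x
  ... | d , d≢0 , dx∈R = strip factors factorsPrime x-int (≡.subst (λ l → ⟦ + l ⟧ * x ∈ R) isFactorisation (abs∈R {d} dx∈R))
    where
    instance _ = ℕ.≢-nonZero (d≢0 ∘ ℤ.∣i∣≡0⇒i≡0)
    open PrimeFactorisation (factorise ℤ.∣ d ∣)
    abs∈R : ∀ {d} → ⟦ d ⟧ * x ∈ R → ⟦ + ℤ.∣ d ∣ ⟧ * x ∈ R
    abs∈R {+ _}      dx∈R = dx∈R
    abs∈R { -[1+ _ ]} dx∈R = R-resp (trans (-‿distribˡ-* _ _) (*-congʳ (-‿involutive _))) (R-neg dx∈R)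
    strip : ∀ qs → All Prime qs → ∀ {x} → Integral x → ⟦ + product qs ⟧ * x ∈ R → x ∈ R
    strip []       []          x-int x∈R  = R-resp (trans (*-congʳ ⟦1⟧) (*-identityˡ _)) x∈R
    strip (q ∷ qs) (pr ∷ prs) {x} x-int qx∈R = strip qs prs x-int (Integral⇒R-prime pr (Integral-scale (R-⟦⟧ (+ product qs)) x-int)
      (R-resp (trans (*-congʳ (trans (⟦⟧-cong (ℤ.pos-* q (product qs))) (⟦*⟧ (+ q) (+ product qs)))) (*-assoc _ _ _)) qx∈R))

  ζ^-% : ∀ k → ζ ^ k ≈ ζ ^ (k ℕ.% p)
  ζ^-% k = ∣⇒ζ^≈ {k ℕ.% p} {k} (%≡⇒∣∸ p (k ℕ.% p) k (ℕ.m%n%n≡m%n k p)) (ℕ.m%n≤m k p)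

  %≡⇒ζ^≈ : ∀ {i j} → i ℕ.% p ≡ j ℕ.% p → ζ ^ i ≈ ζ ^ j
  %≡⇒ζ^≈ {i} {j} eq = trans (ζ^-% i) (trans (reflexive (≡.cong (ζ ^_) eq)) (sym (ζ^-% j)))

  -- A root y of X^p − 1 that is no power of ζ would make all sums Σ_j (y ζ^k)^j vanish,
  -- but their sum over k is p.
  root-of-unity : ∀ {y} → y ^ p ≈ 1# → ∃ λ k → k ℕ.< p × y ≈ ζ ^ k
  root-of-unity {y} y^p≈1 = decide (Fin.any? {n = p} (λ k → ≈0? (y - ζ ^ toℕ k)))
    where
    module NoRoot (none : ¬ ∃ λ (k : Fin p) → y - ζ ^ toℕ k ≈ 0#) where
      none′ : ∀ i → i ℕ.< p → ¬ y ≈ ζ ^ i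
      none′ i i<p eq = none (Fin.fromℕ< i<p , ≈⇒-≈0 (trans eq (reflexive (≡.cong (ζ ^_) (≡.sym (Fin.toℕ-fromℕ< i<p))))))
      S : ℕ → Carrier
      S k = ∑< p ((y * ζ ^ k) ^_)
      S≈0 : ∀ k → k ℕ.< p → S k ≈ 0#
      S≈0 k k<p = *-nonzeroˡ z-1≉0 (trans (geometric (y * ζ ^ k) p) (≈⇒-≈0 (begin
        (y * ζ ^ k) ^ p        ≈⟨ ^-distrib-* y (ζ ^ k) p ⟩
        y ^ p * (ζ ^ k) ^ p    ≈⟨ *-cong y^p≈1 (trans (^-assocʳ ζ k p) (trans (reflexive (≡.cong (ζ ^_) (ℕ.*-comm k p)))
                                    (trans (sym (^-assocʳ ζ p k)) (trans (^-congˡ k ζ^p≈1) (1^n≈1 k))))) ⟩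
        1# * 1#                ≈⟨ *-identityˡ 1# ⟩
        1#                     ∎)))
        where
        z-1≉0 : ¬ y * ζ ^ k - 1# ≈ 0#
        z-1≉0 eq = none′ ((p ∸ k) ℕ.% p) (ℕ.m%n<n (p ∸ k) p) (begin
          y                              ≈⟨ *-identityʳ y ⟨
          y * 1#                         ≈⟨ *-congˡ (trans (sym ζ^p≈1) (reflexive (≡.cong (ζ ^_) (≡.sym (ℕ.m+[n∸m]≡n (ℕ.<⇒≤ k<p)))))) ⟩
          y * ζ ^ (k ℕ.+ (p ∸ k))        ≈⟨ trans (*-congˡ (^-homo-* ζ k (p ∸ k))) (sym (*-assoc _ _ _)) ⟩
          y * ζ ^ k * ζ ^ (p ∸ k)        ≈⟨ trans (*-congʳ (-≈0⇒≈ eq)) (*-identityˡ _) ⟩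
          ζ ^ (p ∸ k)                    ≈⟨ ζ^-% (p ∸ k) ⟩
          ζ ^ ((p ∸ k) ℕ.% p)            ∎)
      -- The inner sum after exchanging summation: y^j times the sum of all powers of ζ^j, which
      -- vanishes unless j = 0.
      column : ℕ → Carrier
      column j = y ^ j * ∑< p ((ζ ^ j) ^_)
      column≈0 : ∀ j → suc j ℕ.< p → column (suc j) ≈ 0#
      column≈0 j j<p = trans (*-congˡ (*-nonzeroˡ (ζ^k≉1 (suc j) (s≤s z≤n) j<p ∘ -≈0⇒≈)
        (trans (geometric (ζ ^ suc j) p) (≈⇒-≈0 (trans (^-assocʳ ζ (suc j) p) (trans (reflexive (≡.cong (ζ ^_) (ℕ.*-comm (suc j) p)))
          (trans (sym (^-assocʳ ζ p (suc j))) (trans (^-congˡ (suc j) ζ^p≈1) (1^n≈1 (suc j)))))))))) (zeroʳ _)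
      ∑1 : ∀ m → ∑< m (1# ^_) ≈ ⟦ + m ⟧
      ∑1 zero    = refl
      ∑1 (suc m) = +-congˡ (trans (∑<-cong m {λ i → 1# ^ suc i} {1# ^_} (λ i _ → *-identityˡ (1# ^ i))) (∑1 m))
      p≈0 : ⟦ + p ⟧ ≈ 0#
      p≈0 = begin
        ⟦ + p ⟧                                      ≈⟨ trans (*-identityˡ _) (∑1 p) ⟨
        column 0                                     ≈⟨ trans (+-congˡ (∑<-zero N λ j j<N → column≈0 j (s≤s j<N))) (+-identityʳ _) ⟨
        ∑< p column                                  ≈⟨ ∑<-cong p (λ j _ → ∑<-*ˡ p (y ^ j) ((ζ ^ j) ^_)) ⟨
        ∑< p (λ j → ∑< p (λ k → y ^ j * (ζ ^ j) ^ k))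
          ≈⟨ ∑<-swap p p (λ j k → y ^ j * (ζ ^ j) ^ k) ⟩
        ∑< p (λ k → ∑< p (λ j → y ^ j * (ζ ^ j) ^ k))
          ≈⟨ ∑<-cong p (λ k _ → ∑<-cong p λ j _ → trans (*-congˡ {y ^ j} (trans (^-assocʳ ζ j k)
               (trans (reflexive (≡.cong (ζ ^_) (ℕ.*-comm j k))) (sym (^-assocʳ ζ k j))))) (sym (^-distrib-* y (ζ ^ k) j))) ⟩
        ∑< p S                                       ≈⟨ ∑<-zero p S≈0 ⟩
        0#                                           ∎
    decide : Dec (∃ λ (k : Fin p) → y - ζ ^ toℕ k ≈ 0#) → ∃ λ k → k ℕ.< p × y ≈ ζ ^ k
    decide (yes (k , eq)) = toℕ k , Fin.toℕ<n k , -≈0⇒≈ eq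
    decide (no none)      = contradiction (NoRoot.p≈0 none) (suc≉0 N)

  -- Homomorphisms, the normal basis, and independence of characters.

  module Hom {τ : Carrier → Carrier} (hom : IsRingHomomorphism rawRing rawRing τ) where

    open IsRingHomomorphism hom public using () renaming (⟦⟧-cong to τ-cong; +-homo to τ-+; *-homo to τ-*; 0#-homo to τ-0; 1#-homo to τ-1; -‿homo to τ-neg)

    τ-ℕ : ∀ i → τ ⟦ + i ⟧ ≈ ⟦ + i ⟧
    τ-ℕ zero    = τ-0
    τ-ℕ (suc i) = trans (τ-+ 1# ⟦ + i ⟧) (+-cong τ-1 (τ-ℕ i))

    τ-⟦⟧ : ∀ i → τ ⟦ i ⟧ ≈ ⟦ i ⟧
    τ-⟦⟧ (+ i)    = τ-ℕ i
    τ-⟦⟧ -[1+ i ] = trans (τ-neg ⟦ + suc i ⟧) (-‿cong (τ-ℕ (suc i)))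

    τ-sum : ∀ {m} (f : Fin m → Carrier) → τ (sum f) ≈ sum (τ ∘ f)
    τ-sum {zero}  f = τ-0
    τ-sum {suc m} f = trans (τ-+ (f zero) (sum (f ∘ suc))) (+-congˡ (τ-sum (f ∘ suc)))

    τ-^ : ∀ x k → τ (x ^ k) ≈ τ x ^ k
    τ-^ x zero    = τ-1
    τ-^ x (suc k) = trans (τ-* x (x ^ k)) (*-congˡ (τ-^ x k))

    τ-⟦⟧* : ∀ i x → τ (⟦ i ⟧ * x) ≈ ⟦ i ⟧ * τ x
    τ-⟦⟧* i x = trans (τ-* ⟦ i ⟧ x) (*-congʳ (τ-⟦⟧ i))

    τ-combination : ∀ {m} (a : Fin m → ℤ) (f : Fin m → Carrier) →
                    τ (sum (λ i → ⟦ a i ⟧ * f i)) ≈ sum (λ i → ⟦ a i ⟧ * τ (f i))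
    τ-combination {m} a f = trans (τ-sum (λ i → ⟦ a i ⟧ * f i)) (sum-cong-≋ {m} λ i → τ-⟦⟧* (a i) (f i))

  agree : ∀ {τ τ′} → IsRingHomomorphism rawRing rawRing τ → IsRingHomomorphism rawRing rawRing τ′ →
          τ ζ ≈ τ′ ζ → ∀ x → τ x ≈ τ′ x
  agree {τ} {τ′} hom hom′ eq x = case clear x of λ where
      (d , d≢0 , a , dx≈) → *-cancelˡ (⟦⟧≉0 d≢0) (begin
        ⟦ d ⟧ * τ x                                  ≈⟨ T.τ-⟦⟧* d x ⟨
        τ (⟦ d ⟧ * x)                                ≈⟨ T.τ-cong dx≈ ⟩
        τ (∑< p (λ i → ⟦ a i ⟧ * ζ ^ i))             ≈⟨ T.τ-combination {p} (a ∘ toℕ) (λ i → ζ ^ toℕ i) ⟩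
        ∑< p (λ i → ⟦ a i ⟧ * τ (ζ ^ i))
          ≈⟨ ∑<-cong p (λ i _ → *-congˡ {⟦ a i ⟧} (trans (T.τ-^ ζ i) (trans (^-congˡ i eq) (sym (T′.τ-^ ζ i))))) ⟩
        ∑< p (λ i → ⟦ a i ⟧ * τ′ (ζ ^ i))            ≈⟨ T′.τ-combination {p} (a ∘ toℕ) (λ i → ζ ^ toℕ i) ⟨
        τ′ (∑< p (λ i → ⟦ a i ⟧ * ζ ^ i))            ≈⟨ T′.τ-cong dx≈ ⟨
        τ′ (⟦ d ⟧ * x)                               ≈⟨ T′.τ-⟦⟧* d x ⟩
        ⟦ d ⟧ * τ′ x                                 ∎)
    where
    module T  = Hom hom
    module T′ = Hom hom′

  module Normal (v : ℕ) (p∤v : ¬ p ℕ.∣ v) (generates : ∀ j → 0 ℕ.< j → j ℕ.< p → ∃ λ k → v ℕ.^ k ℕ.% p ≡ j) where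

    private
      module U = UnitsMod.PrimitiveRoot p N ≡.refl prime v p∤v generates

    -- The conjugates of ζ numbered by discrete logarithm; in this numbering σ acts as a shift by
    -- one.
    w : ℕ → Carrier
    w a = ζ ^ (v ℕ.^ a)

    w-period : ∀ a → w (a ℕ.+ N) ≈ w a
    w-period a = %≡⇒ζ^≈ {v ℕ.^ (a ℕ.+ N)} {v ℕ.^ a} (U.^+period U.^N≡1 a)

    w-exp : ∀ a → w a ≈ ζ ^ suc (toℕ (U.exp a))
    w-exp a = trans (ζ^-% (v ℕ.^ a)) (reflexive (≡.cong (ζ ^_) (≡.sym (U.suc-exp a))))

    ∑-permute : ∀ (F : Fin N → Carrier) → sum F ≈ sum {N} (λ a → F (U.exp (toℕ a)))
    ∑-permute F = sum-permute F U.exponential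

    w-combination : (ℕ → ℤ) → Carrier
    w-combination a = ∑< N (λ i → ⟦ a i ⟧ * w i)

    opaque
      R⇒w : ∀ {x} → x ∈ R → Σ (ℕ → ℤ) λ a → x ≈ w-combination a
      R⇒w x∈R with R⇒evalζ⁺ x∈R
      ... | a , x≈ = a ∘ toℕ ∘ U.exp , trans x≈ (trans (∑-permute (λ i → ⟦ a (toℕ i) ⟧ * ζ ^ suc (toℕ i)))
        (∑<-cong N λ i _ → *-congˡ {⟦ a (toℕ (U.exp i)) ⟧} (sym (w-exp i))))

    -- The coefficients are carried along the discrete logarithm to the powers ζ, ..., ζ^N, whose
    -- independence is known.
    w-independent : ∀ a → w-combination a ≈ 0# → ∀ i → i ℕ.< N → a i ≡ + 0
    w-independent a rel i i<N = ≡.trans (≡.sym (b-exp (Fin.fromℕ< i<N) (Fin.toℕ-fromℕ< i<N)))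
        (evalζ⁺-independent b b-rel (toℕ (U.exp i)) (Fin.toℕ<n (U.exp i)))
      where
      b : ℕ → ℤ
      b j with j ℕ.<? N
      ... | yes j<N = a (toℕ (U.log% (Fin.fromℕ< j<N)))
      ... | no  _   = + 0
      b-toℕ : ∀ j → b (toℕ j) ≡ a (toℕ (U.log% j))
      b-toℕ j with toℕ j ℕ.<? N
      ... | yes j<N = ≡.cong (a ∘ toℕ ∘ U.log%) (Fin.fromℕ<-toℕ j j<N)
      ... | no  j≮N = contradiction (Fin.toℕ<n j) j≮N
      b-exp : ∀ (k : Fin N) {i} → toℕ k ≡ i → b (toℕ (U.exp i)) ≡ a i
      b-exp k ≡.refl = ≡.trans (b-toℕ (U.exp (toℕ k))) (≡.cong (a ∘ toℕ) (U.log%-exp k))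
      b-rel : evalζ⁺ b ≈ 0#
      b-rel = trans (∑-permute (λ i → ⟦ b (toℕ i) ⟧ * ζ ^ suc (toℕ i)))
        (trans (sum-cong-≋ {N} λ k → *-cong (⟦⟧-cong (b-exp k ≡.refl)) (sym (w-exp (toℕ k)))) rel)

    -- The image of ζ is again a p-th root of unity, so a power of ζ; injectivity excludes the
    -- exponent 0, and `v` generates the others.
    automorphism-ζ : ∀ {τ} → IsAutomorphism L τ → ∃ λ a → τ ζ ≈ w a
    automorphism-ζ {τ} auto = case root-of-unity (trans (sym (τ-^ ζ p)) (trans (τ-cong ζ^p≈1) τ-1)) of λ where
        (zero  , _   , eq) → contradiction (injective (trans eq (sym τ-1)))
                               (ζ^k≉1 1 (s≤s z≤n) (s≤s (s≤s z≤n)) ∘ trans (*-identityʳ ζ))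
        (suc k , k<p , eq) → case generates (suc k) (s≤s z≤n) k<p of λ where
          (a , v^a≡) → a , trans eq (trans (reflexive (≡.cong (ζ ^_) (≡.sym v^a≡))) (sym (ζ^-% (v ℕ.^ a))))
      where
      open IsRingIsomorphism auto using (injective; isRingHomomorphism)
      open Hom isRingHomomorphism

  IsPower⇒ : ∀ {y} u v → u ≡ + v ℤ.+ u ℤ./ℕ p ℤ.* + p → IsPower L y ζ u → y ≈ ζ ^ v
  IsPower⇒ (+ m) v u≡ y≈ = trans y≈ (%≡⇒ζ^≈ {m} {v} ([mod]⇒%≡ p m v (ℤ.∣⇒∣ᵤ {+ p} {+ m ℤ.- + v} (ℤ.divides (+ m ℤ./ℕ p)
    (≡.trans (≡.cong (ℤ._- + v) u≡) (ℤsolve 2 (λ x y → (x ⊕ y) ⊝ x ⊜ y) ≡.refl (+ v) (+ m ℤ./ℕ p ℤ.* + p)))))))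
  IsPower⇒ {y} -[1+ m ] v u≡ y*≈1 = *-cancelˡ (ζ^≉0 (suc m)) (trans (*-comm _ _) (trans y*≈1 (sym (trans (sym (^-homo-* ζ (suc m) v))
      (∣⇒ζ^≈ {0} {suc m ℕ.+ v} p∣ z≤n)))))
    where
    q : ℤ
    q = -[1+ m ] ℤ./ℕ p
    p∣ : p ℕ.∣ suc m ℕ.+ v
    p∣ = ℤ.∣⇒∣ᵤ {+ p} {+ (suc m ℕ.+ v)} (ℤ.divides (ℤ.- q) (≡.trans
      (ℤsolve 3 (λ s v x → s ⊕ v ⊜ (s ⊕ (v ⊕ x)) ⊕ (⊖ x)) ≡.refl (+ suc m) (+ v) (q ℤ.* + p))
      (≡.trans (≡.cong (ℤ._+ (ℤ.- (q ℤ.* + p))) (≡.trans (≡.cong (ℤ._+_ (+ suc m)) (≡.sym u≡)) (ℤ.+-inverseʳ (+ suc m))))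
        (≡.trans (ℤ.+-identityˡ (ℤ.- (q ℤ.* + p))) (ℤ.neg-distribˡ-* q (+ p))))))

  -- Subtracting χ₀(y) times the relation at x from the relation at y x removes χ₀. The y separating
  -- χᵢ from χ₀ depends on i, so a new shorter relation is formed for each i.
  dedekind : ∀ {k} (K : Pred Carrier k) → 1# ∈ K → (∀ {x y} → x ∈ K → y ∈ K → x * y ∈ K) →
             ∀ m (χ : Fin m → Carrier → Carrier) → (∀ i x y → χ i (x * y) ≈ χ i x * χ i y) → (∀ i → χ i 1# ≈ 1#) →
             (∀ i j → ¬ i ≡ j → ∃ λ y → y ∈ K × ¬ χ i y ≈ χ j y) →
             ∀ (a : Fin m → Carrier) → (∀ x → x ∈ K → sum (λ i → a i * χ i x) ≈ 0#) → ∀ i → a i ≈ 0#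
  dedekind K 1∈K K-* (suc m) χ χ-* χ-1 χ-≢ a rel = λ { zero → a₀≈0 ; (suc i) → rest i }
    where
    rest : ∀ i → a (suc i) ≈ 0#
    rest i with χ-≢ (suc i) zero (λ ())
    ... | y , y∈K , χy≉ = *-nonzeroˡ (χy≉ ∘ -≈0⇒≈) (trans (*-comm _ _)
      (dedekind K 1∈K K-* m (χ ∘ suc) (χ-* ∘ suc) (χ-1 ∘ suc) (λ i j i≢j → χ-≢ (suc i) (suc j) (i≢j ∘ Fin.suc-injective))
        (λ j → a (suc j) * (χ (suc j) y - χ zero y)) rel′ i))
      where
      rel′ : ∀ x → x ∈ K → sum (λ j → a (suc j) * (χ (suc j) y - χ zero y) * χ (suc j) x) ≈ 0#
      rel′ x x∈K = begin
        sum (λ j → a (suc j) * (χ (suc j) y - χ zero y) * χ (suc j) x)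
          ≈⟨ +-identityˡ _ ⟨
        0# + sum (λ j → a (suc j) * (χ (suc j) y - χ zero y) * χ (suc j) x)
          ≈⟨ +-congʳ (trans (*-congʳ (trans (*-congˡ (-‿inverseʳ _)) (zeroʳ _))) (zeroˡ _)) ⟨
        sum (λ j → a j * (χ j y - χ zero y) * χ j x)
          ≈⟨ sum-cong-≋ {suc m} (λ j → trans (solve 4 (λ a X x₀ x → a :* (X :- x₀) :* x := a :* (X :* x) :+ :- x₀ :* (a :* x)) refl (a j) (χ j y) (χ zero y) (χ j x))
               (+-congʳ (*-congˡ {a j} (sym (χ-* j y x))))) ⟩
        sum (λ j → a j * χ j (y * x) + - χ zero y * (a j * χ j x))
          ≈⟨ ∑-distrib-+ {suc m} (λ j → a j * χ j (y * x)) (λ j → - χ zero y * (a j * χ j x)) ⟩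
        sum (λ j → a j * χ j (y * x)) + sum (λ j → - χ zero y * (a j * χ j x))
          ≈⟨ +-cong (rel (y * x) (K-* y∈K x∈K)) (trans (sym (*-distribˡ-sum {suc m} (- χ zero y) (λ j → a j * χ j x))) (trans (*-congˡ (rel x x∈K)) (zeroʳ _))) ⟩
        0# + 0#
          ≈⟨ +-identityˡ 0# ⟩
        0# ∎
    a₀≈0 : a zero ≈ 0#
    a₀≈0 = begin
      a zero                                          ≈⟨ trans (*-congˡ (χ-1 zero)) (*-identityʳ _) ⟨
      a zero * χ zero 1#                              ≈⟨ trans (+-congˡ (sum-zero {m} λ i → trans (*-congʳ {χ (suc i) 1#} (rest i)) (zeroˡ (χ (suc i) 1#)))) (+-identityʳ _) ⟨
      sum (λ i → a i * χ i 1#)                        ≈⟨ rel 1# 1∈K ⟩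
      0#                                              ∎

  -- The powers of σ and the Gaussian periods.

  module Cyclic (v : ℕ) (p∤v : ¬ p ℕ.∣ v) (generates : ∀ j → 0 ℕ.< j → j ℕ.< p → ∃ λ k → v ℕ.^ k ℕ.% p ≡ j)
                (σ : Carrier → Carrier) (σ-auto : IsAutomorphism L σ) (σζ≈ : σ ζ ≈ ζ ^ v) where

    open Normal v p∤v generates

    σ^ : ℕ → Carrier → Carrier
    σ^ a x = fold x σ a

    σ^-auto : ∀ a → IsAutomorphism L (σ^ a)
    σ^-auto zero    = Identity.isRingIsomorphism rawRing refl
    σ^-auto (suc a) = Composition.isRingIsomorphism trans (σ^-auto a) σ-auto

    σ^-hom : ∀ a → IsRingHomomorphism rawRing rawRing (σ^ a)
    σ^-hom a = IsRingIsomorphism.isRingHomomorphism (σ^-auto a)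

    module σ^ a = Hom (σ^-hom a)
    module σ  = Hom (IsRingIsomorphism.isRingHomomorphism σ-auto)

    σ^-+ : ∀ a b x → σ^ (a ℕ.+ b) x ≈ σ^ a (σ^ b x)
    σ^-+ a b x = reflexive (fold-+ x σ a)

    σ-w : ∀ a → σ (w a) ≈ w (suc a)
    σ-w a = trans (σ.τ-^ ζ (v ℕ.^ a)) (trans (^-congˡ (v ℕ.^ a) σζ≈) (^-assocʳ ζ v (v ℕ.^ a)))

    σ^-w : ∀ a b → σ^ a (w b) ≈ w (a ℕ.+ b)
    σ^-w zero    b = refl
    σ^-w (suc a) b = trans (σ.τ-cong (σ^-w a b)) (σ-w (a ℕ.+ b))

    w0≈ζ : w 0 ≈ ζ
    w0≈ζ = *-identityʳ ζ

    σ^ζ≈w : ∀ a → σ^ a ζ ≈ w a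
    σ^ζ≈w a = trans (σ^.τ-cong a (sym w0≈ζ)) (trans (σ^-w a 0) (reflexive (≡.cong w (ℕ.+-identityʳ a))))

    σ^N≈id : ∀ x → σ^ N x ≈ x
    σ^N≈id = agree (σ^-hom N) (σ^-hom 0) (trans (σ^ζ≈w N) (trans (w-period 0) w0≈ζ))

    w-cong-% : ∀ a → w a ≈ w (a ℕ.% N)
    w-cong-% a = trans (reflexive (≡.cong w (ℕ.m≡m%n+[m/n]*n a N))) (multiples (a ℕ./ N))
      where
      multiples : ∀ k → w (a ℕ.% N ℕ.+ k ℕ.* N) ≈ w (a ℕ.% N)
      multiples zero    = reflexive (≡.cong w (ℕ.+-identityʳ (a ℕ.% N)))
      multiples (suc k) = trans (reflexive (≡.cong w (≡.trans (≡.cong (a ℕ.% N ℕ.+_) (ℕ.+-comm N (k ℕ.* N))) (≡.sym (ℕ.+-assoc (a ℕ.% N) (k ℕ.* N) N)))))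
        (trans (w-period (a ℕ.% N ℕ.+ k ℕ.* N)) (multiples k))

    module Periods (d e : ℕ) .{{_ : ℕ.NonZero d}} (N≡ : N ≡ e ℕ.* d) where

      -- The Gaussian period: the sum over the orbit of `w i` under σ^d, which has e elements.
      η : ℕ → Carrier
      η i = ∑< e (λ k → w (k ℕ.* d ℕ.+ i))

      d≤N : d ℕ.≤ N
      d≤N = ℕ.∣⇒≤ (ℕ.divides e N≡)

      periodic-combination : ∀ a → (∀ k i → a (k ℕ.* d ℕ.+ i) ≡ a i) → w-combination a ≈ ∑< d (λ i → ⟦ a i ⟧ * η i)
      periodic-combination a per = begin
        ∑< N (λ i → ⟦ a i ⟧ * w i)
          ≡⟨ ≡.cong (λ m → ∑< m (λ i → ⟦ a i ⟧ * w i)) N≡ ⟩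
        ∑< (e ℕ.* d) (λ i → ⟦ a i ⟧ * w i)
          ≈⟨ ∑<-blocks e d (λ i → ⟦ a i ⟧ * w i) ⟩
        ∑< e (λ k → ∑< d (λ i → ⟦ a (k ℕ.* d ℕ.+ i) ⟧ * w (k ℕ.* d ℕ.+ i)))
          ≈⟨ ∑<-cong e (λ k _ → ∑<-cong d λ i _ → *-congʳ {w (k ℕ.* d ℕ.+ i)} (⟦⟧-cong (per k i))) ⟩
        ∑< e (λ k → ∑< d (λ i → ⟦ a i ⟧ * w (k ℕ.* d ℕ.+ i)))
          ≈⟨ ∑<-swap e d (λ k i → ⟦ a i ⟧ * w (k ℕ.* d ℕ.+ i)) ⟩
        ∑< d (λ i → ∑< e (λ k → ⟦ a i ⟧ * w (k ℕ.* d ℕ.+ i)))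
          ≈⟨ ∑<-cong d (λ i _ → ∑<-*ˡ e ⟦ a i ⟧ (λ k → w (k ℕ.* d ℕ.+ i))) ⟩
        ∑< d (λ i → ⟦ a i ⟧ * η i) ∎

      -- Extended with period d, the coefficients give a relation in the normal basis.
      η-independent : ∀ a → ∑< d (λ i → ⟦ a i ⟧ * η i) ≈ 0# → ∀ i → i ℕ.< d → a i ≡ + 0
      η-independent a rel i i<d = ≡.trans (≡.cong a (≡.sym (ℕ.m<n⇒m%n≡m i<d)))
        (w-independent (λ j → a (j ℕ.% d))
          (trans (periodic-combination (λ j → a (j ℕ.% d)) (λ k j → ≡.cong a (≡.trans (≡.cong (ℕ._% d) (ℕ.+-comm (k ℕ.* d) j)) (ℕ.[m+kn]%n≡m%n j k d))))
            (trans (∑<-cong d λ j j<d → *-congʳ {η j} (⟦⟧-cong (≡.cong a (ℕ.m<n⇒m%n≡m j<d)))) rel))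
          i (ℕ.<-≤-trans i<d d≤N))

      -- σ^d shifts the normal-basis coefficients cyclically by d, so by uniqueness the coefficients
      -- of a fixed element have period d and collect into periods.
      fixed⇒η : ∀ {x} → x ∈ R → σ^ d x ≈ x → Σ (ℕ → ℤ) λ a → x ≈ ∑< d (λ i → ⟦ a i ⟧ * η i)
      fixed⇒η {x} x∈R fixed = c′ , trans x≈ (periodic-combination c′ per)
        where
        c₀ = proj₁ (R⇒w x∈R)
        c′ : ℕ → ℤ
        c′ j = c₀ (j ℕ.% N)
        -- For N-periodic coefficients a shift by `M` is the shift by - d, which natural numbers
        -- cannot express.
        M = N ∸ d
        x≈ : x ≈ w-combination c′
        x≈ = trans (proj₂ (R⇒w x∈R)) (∑<-cong N λ i i<N → *-congʳ {w i} (⟦⟧-cong (≡.cong c₀ (≡.sym (ℕ.m<n⇒m%n≡m i<N)))))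
        c′+N : ∀ j → c′ (j ℕ.+ N) ≡ c′ j
        c′+N j = ≡.cong c₀ (≡.trans (≡.cong (λ k → (j ℕ.+ k) ℕ.% N) (≡.sym (ℕ.*-identityˡ N))) (ℕ.[m+kn]%n≡m%n j 1 N))
        shifted : w-combination c′ ≈ w-combination (λ b → c′ (b ℕ.+ M))
        shifted = begin
          w-combination c′                                   ≈⟨ x≈ ⟨
          x                                                  ≈⟨ fixed ⟨
          σ^ d x                                             ≈⟨ σ^.τ-cong d x≈ ⟩
          σ^ d (w-combination c′)                            ≈⟨ σ^.τ-combination d {N} (c′ ∘ toℕ) (w ∘ toℕ) ⟩
          ∑< N (λ i → ⟦ c′ i ⟧ * σ^ d (w i))
            ≈⟨ ∑<-cong N (λ i _ → *-cong (⟦⟧-cong (≡.sym (≡.trans (≡.cong c′ (≡.trans (ℕ.+-assoc i d M) (≡.cong (i ℕ.+_) (ℕ.m+[n∸m]≡n d≤N)))) (c′+N i))))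
                 (trans (σ^-w d i) (reflexive (≡.cong w (ℕ.+-comm d i))))) ⟩
          ∑< N (λ i → ⟦ c′ (i ℕ.+ d ℕ.+ M) ⟧ * w (i ℕ.+ d))
            ≈⟨ ∑<-shift N (λ b → ⟦ c′ (b ℕ.+ M) ⟧ * w b) (λ b → *-cong (⟦⟧-cong (≡.trans (≡.cong c′
                 (≡.trans (ℕ.+-assoc b N M) (≡.trans (≡.cong (b ℕ.+_) (ℕ.+-comm N M)) (≡.sym (ℕ.+-assoc b M N))))) (c′+N (b ℕ.+ M)))) (w-period b)) d ⟩
          w-combination (λ b → c′ (b ℕ.+ M))                 ∎
        c′+M<N : ∀ b → b ℕ.< N → c′ (b ℕ.+ M) ≡ c′ b
        c′+M<N b b<N = ≡.sym (ℤ.i-j≡0⇒i≡j (c′ b) (c′ (b ℕ.+ M)) (w-independent (λ b → c′ b ℤ.- c′ (b ℕ.+ M)) (begin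
          ∑< N (λ b → ⟦ c′ b ℤ.- c′ (b ℕ.+ M) ⟧ * w b)
            ≈⟨ ∑<-cong N (λ b _ → trans (*-congʳ {w b} (trans (⟦+⟧ (c′ b) (ℤ.- c′ (b ℕ.+ M))) (+-congˡ (⟦-⟧ (c′ (b ℕ.+ M))))))
                 (solve 3 (λ x y w → (x :- y) :* w := x :* w :+ con (ℤ.- + 1) :* (y :* w)) refl ⟦ c′ b ⟧ ⟦ c′ (b ℕ.+ M) ⟧ (w b))) ⟩
          ∑< N (λ b → ⟦ c′ b ⟧ * w b + ⟦ ℤ.- + 1 ⟧ * (⟦ c′ (b ℕ.+ M) ⟧ * w b))
            ≈⟨ ∑<-+ N (λ b → ⟦ c′ b ⟧ * w b) (λ b → ⟦ ℤ.- + 1 ⟧ * (⟦ c′ (b ℕ.+ M) ⟧ * w b)) ⟩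
          w-combination c′ + ∑< N (λ b → ⟦ ℤ.- + 1 ⟧ * (⟦ c′ (b ℕ.+ M) ⟧ * w b))
            ≈⟨ +-cong shifted (∑<-*ˡ N ⟦ ℤ.- + 1 ⟧ (λ b → ⟦ c′ (b ℕ.+ M) ⟧ * w b)) ⟩
          W + ⟦ ℤ.- + 1 ⟧ * W
            ≈⟨ solve 1 (λ x → x :+ con (ℤ.- + 1) :* x := con (+ 0)) refl W ⟩
          0# ∎) b b<N))
          where W = w-combination (λ b → c′ (b ℕ.+ M))
        c′+M : ∀ b → c′ (b ℕ.+ M) ≡ c′ b
        c′+M b = ≡.trans (≡.cong c₀ (%-cong-+ b)) (≡.trans (c′+M<N (b ℕ.% N) (ℕ.m%n<n b N)) (≡.cong c₀ (ℕ.m%n%n≡m%n b N)))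
          where
          %-cong-+ : ∀ b → (b ℕ.+ M) ℕ.% N ≡ (b ℕ.% N ℕ.+ M) ℕ.% N
          %-cong-+ b = ≡.trans (ℕ.%-distribˡ-+ b M N) (≡.trans (≡.cong (λ r → (r ℕ.+ M ℕ.% N) ℕ.% N) (≡.sym (ℕ.m%n%n≡m%n b N))) (≡.sym (ℕ.%-distribˡ-+ (b ℕ.% N) M N)))
        c′+d : ∀ b → c′ (d ℕ.+ b) ≡ c′ b
        c′+d b = ≡.trans (≡.sym (c′+M (d ℕ.+ b))) (≡.trans (≡.cong c′ (≡.trans (≡.cong (ℕ._+ M) (ℕ.+-comm d b)) (≡.trans (ℕ.+-assoc b d M) (≡.cong (b ℕ.+_) (ℕ.m+[n∸m]≡n d≤N))))) (c′+N b))
        per : ∀ k i → c′ (k ℕ.* d ℕ.+ i) ≡ c′ i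
        per zero    i = ≡.refl
        per (suc k) i = ≡.trans (≡.cong c′ (ℕ.+-assoc d (k ℕ.* d) i)) (≡.trans (c′+d (k ℕ.* d ℕ.+ i)) (per k i))

      σ^-η : ∀ a i → σ^ a (η i) ≈ η (a ℕ.+ i)
      σ^-η a i = trans (σ^.τ-sum a {e} (λ k → w (toℕ k ℕ.* d ℕ.+ i))) (∑<-cong e λ k _ → trans (σ^-w a (k ℕ.* d ℕ.+ i))
        (reflexive (≡.cong w (≡.trans (≡.sym (ℕ.+-assoc a (k ℕ.* d) i)) (≡.trans (≡.cong (ℕ._+ i) (ℕ.+-comm a (k ℕ.* d))) (ℕ.+-assoc (k ℕ.* d) a i))))))

      R-η : ∀ i → η i ∈ R
      R-η i = R-sum {e} λ k → R-^ (v ℕ.^ (toℕ k ℕ.* d ℕ.+ i)) R-ζ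

  -- The subfield `K`: its stabiliser, its periods and the trace.

  module SubfieldOfDegree (v : ℕ) (p∤v : ¬ p ℕ.∣ v) (generates : ∀ j → 0 ℕ.< j → j ℕ.< p → ∃ λ k → v ℕ.^ k ℕ.% p ≡ j)
                (σ : Carrier → Carrier) (σ-auto : IsAutomorphism L σ) (σζ≈ : σ ζ ≈ ζ ^ v)
                {κ} (K : Pred Carrier κ) (subfield : IsSubfield L K) (s : ℕ) .{{_ : ℕ.NonZero s}} (degree : HasDegree L ι K s) where

    open Normal v p∤v generates
    open Cyclic v p∤v generates σ σ-auto σζ≈
    open IsSubfield subfield using (1#-closed; 0#-closed) renaming (resp to K-resp; +-closed to K-+; -‿closed to K-neg; *-closed to K-*; inverse to K-inverse)
    open HasDegree degree using () renaming (basis to b; basis∈K to b∈K; spanning to spanningℚ; independent to independentℚ)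

    K-sum : ∀ {m} {f : Fin m → Carrier} → (∀ i → f i ∈ K) → sum f ∈ K
    K-sum {zero}  _   = 0#-closed
    K-sum {suc m} f∈K = K-+ (f∈K zero) (K-sum (f∈K ∘ suc))

    K-⟦⟧ : ∀ i → ⟦ i ⟧ ∈ K
    K-⟦⟧ (+ i)    = K-ℕ i
      where
      K-ℕ : ∀ i → ⟦ + i ⟧ ∈ K
      K-ℕ zero    = 0#-closed
      K-ℕ (suc i) = K-+ 1#-closed (K-ℕ i)
    K-⟦⟧ -[1+ i ] = K-neg (K-⟦⟧ (+ suc i))

    K-divide : ∀ {i x} → ¬ i ≡ + 0 → ⟦ i ⟧ * x ∈ K → x ∈ K
    K-divide {i} {x} i≢0 ix∈K with inverse ⟦ i ⟧ (⟦⟧≉0 i≢0)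
    ... | y , iy≈1 = K-resp (trans (sym (*-assoc _ _ _)) (trans (*-congʳ (trans (*-comm _ _) iy≈1)) (*-identityˡ x)))
      (K-* (K-inverse (K-⟦⟧ i) iy≈1) ix∈K)

    opaque
      common-denominator : ∀ m (q : Fin m → ℚ) → Σ ℤ λ d → ¬ d ≡ + 0 × Σ (Fin m → ℤ) λ l → ∀ i → ⟦ d ⟧ * ι (q i) ≈ ⟦ l i ⟧
      common-denominator zero    q = + 1 , (λ ()) , (λ ()) , λ ()
      common-denominator (suc m) q with common-denominator m (q ∘ suc)
      ... | d , d≢0 , l , eq = ℚ.↧ q zero ℤ.* d , ℤ-*-≢0 {ℚ.↧ q zero} (λ ()) d≢0 ,
          (λ { zero → d ℤ.* ℚ.↥ q zero ; (suc i) → ℚ.↧ q zero ℤ.* l i }) , λ where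
            zero → begin
              ⟦ ℚ.↧ q zero ℤ.* d ⟧ * ι (q zero)         ≈⟨ *-congʳ (⟦*⟧ (ℚ.↧ q zero) d) ⟩
              ⟦ ℚ.↧ q zero ⟧ * ⟦ d ⟧ * ι (q zero)       ≈⟨ solve 3 (λ x y z → x :* y :* z := y :* (x :* z)) refl ⟦ ℚ.↧ q zero ⟧ ⟦ d ⟧ (ι (q zero)) ⟩
              ⟦ d ⟧ * (⟦ ℚ.↧ q zero ⟧ * ι (q zero))     ≈⟨ *-congˡ (⟦↧⟧*ι≈⟦↥⟧ (q zero)) ⟩
              ⟦ d ⟧ * ⟦ ℚ.↥ q zero ⟧                    ≈⟨ ⟦*⟧ d (ℚ.↥ q zero) ⟨
              ⟦ d ℤ.* ℚ.↥ q zero ⟧                      ∎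
            (suc i) → begin
              ⟦ ℚ.↧ q zero ℤ.* d ⟧ * ι (q (suc i))      ≈⟨ trans (*-congʳ (⟦*⟧ (ℚ.↧ q zero) d)) (*-assoc _ _ _) ⟩
              ⟦ ℚ.↧ q zero ⟧ * (⟦ d ⟧ * ι (q (suc i)))  ≈⟨ *-congˡ (eq i) ⟩
              ⟦ ℚ.↧ q zero ⟧ * ⟦ l i ⟧                  ≈⟨ ⟦*⟧ (ℚ.↧ q zero) (l i) ⟨
              ⟦ ℚ.↧ q zero ℤ.* l i ⟧                    ∎

      -- Rational coordinates become integers over one denominator, the form in which homomorphisms
      -- and `ℤ-dependent` can use them.
      spanning : ∀ {x} → x ∈ K → Σ ℤ λ d → ¬ d ≡ + 0 × Σ (Fin s → ℤ) λ l → ⟦ d ⟧ * x ≈ sum (λ i → ⟦ l i ⟧ * b i)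
      spanning {x} x∈K with spanningℚ x∈K
      ... | q , x≈ with common-denominator s q
      ...   | d , d≢0 , l , eq = d , d≢0 , l , (begin
        ⟦ d ⟧ * x                               ≈⟨ *-congˡ x≈ ⟩
        ⟦ d ⟧ * sum (λ i → ι (q i) * b i)       ≈⟨ *-distribˡ-sum {s} ⟦ d ⟧ (λ i → ι (q i) * b i) ⟩
        sum (λ i → ⟦ d ⟧ * (ι (q i) * b i))     ≈⟨ sum-cong-≋ {s} (λ i → trans (sym (*-assoc _ _ _)) (*-congʳ {b i} (eq i))) ⟩
        sum (λ i → ⟦ l i ⟧ * b i)               ∎)

    independent : ∀ (l : Fin s → ℤ) → sum (λ i → ⟦ l i ⟧ * b i) ≈ 0# → ∀ i → l i ≡ + 0
    independent l rel i = ⟦⟧≈0⇒≡0 (l i) (begin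
      ⟦ l i ⟧           ≈⟨ fromℤ≈⟦⟧ (l i) ⟨
      ι (l i ℚ./ 1)     ≡⟨ ≡.cong ι (independentℚ (λ i → l i ℚ./ 1) (trans (sum-cong-≋ {s} λ i → *-congʳ {b i} (fromℤ≈⟦⟧ (l i))) rel) i) ⟩
      ι ℚ.0ℚ            ≈⟨ IsRingHomomorphism.0#-homo ι-homomorphism ⟩
      0#                ∎)

    -- Tested on the basis only, hence decidable; `Fixes⇒` extends it to all of `K`.
    Fixes : ℕ → Set ℓ
    Fixes a = ∀ i → σ^ a (b i) ≈ b i

    Fixes? : ∀ a → Dec (Fixes a)
    Fixes? a = Fin.all? λ i → Dec.map′ -≈0⇒≈ ≈⇒-≈0 (≈0? (σ^ a (b i) - b i))

    Fixes⇒ : ∀ a → Fixes a → ∀ {x} → x ∈ K → σ^ a x ≈ x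
    Fixes⇒ a fix {x} x∈K with spanning x∈K
    ... | d , d≢0 , l , dx≈ = *-cancelˡ (⟦⟧≉0 d≢0) (begin
      ⟦ d ⟧ * σ^ a x                       ≈⟨ σ^.τ-⟦⟧* a d x ⟨
      σ^ a (⟦ d ⟧ * x)                     ≈⟨ σ^.τ-cong a dx≈ ⟩
      σ^ a (sum (λ i → ⟦ l i ⟧ * b i))     ≈⟨ σ^.τ-combination a {s} l b ⟩
      sum (λ i → ⟦ l i ⟧ * σ^ a (b i))     ≈⟨ sum-cong-≋ {s} (λ i → *-congˡ {⟦ l i ⟧} (fix i)) ⟩
      sum (λ i → ⟦ l i ⟧ * b i)            ≈⟨ dx≈ ⟨
      ⟦ d ⟧ * x                            ∎)

    opaque
      Fixes-N : Fixes N
      Fixes-N i = σ^N≈id (b i)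

    private
      -- The shift by one excludes the exponent 0, which fixes everything; the search stops at N = n
      -- + 1 at the latest.
      found = least {P = λ k → Fixes (suc k)} (λ k → Fixes? (suc k)) n Fixes-N

    opaque
      d : ℕ
      d = suc (proj₁ found)

      instance
        d≢0 : ℕ.NonZero d
        d≢0 = _

      Fixes-d : Fixes d
      Fixes-d = proj₁ (proj₂ found)

      d-minimal : ∀ a → 0 ℕ.< a → a ℕ.< d → ¬ Fixes a
      d-minimal (suc a) _ (s≤s a<d) = proj₂ (proj₂ found) a a<d

    Fixes-multiple : ∀ k → Fixes (k ℕ.* d)
    Fixes-multiple zero    i = refl
    Fixes-multiple (suc k) i = trans (σ^-+ d (k ℕ.* d) (b i)) (trans (σ^.τ-cong d (Fixes-multiple k i)) (Fixes-d i))

    -- Multiples of d fix `K`, so the remainder of a modulo d does as well and must be zero by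
    -- minimality.
    Fixes⇒d∣ : ∀ {a} → Fixes a → d ℕ.∣ a
    Fixes⇒d∣ {a} fix with a ℕ.% d in eq
    ... | zero  = ℕ.m%n≡0⇒n∣m a d eq
    ... | suc r = contradiction fix′ (d-minimal (suc r) (s≤s z≤n) (≡.subst (ℕ._< d) eq (ℕ.m%n<n a d)))
      where
      fix′ : Fixes (suc r)
      fix′ i = begin
        σ^ (suc r) (b i)                              ≈⟨ σ^.τ-cong (suc r) (Fixes-multiple (a ℕ./ d) i) ⟨
        σ^ (suc r) (σ^ (a ℕ./ d ℕ.* d) (b i))         ≈⟨ σ^-+ (suc r) (a ℕ./ d ℕ.* d) (b i) ⟨
        σ^ (suc r ℕ.+ a ℕ./ d ℕ.* d) (b i)            ≡⟨ ≡.cong (λ k → σ^ k (b i)) (≡.trans (≡.cong (ℕ._+ a ℕ./ d ℕ.* d) (≡.sym eq)) (≡.sym (ℕ.m≡m%n+[m/n]*n a d))) ⟩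
        σ^ a (b i)                                    ≈⟨ fix i ⟩
        b i                                           ∎

    opaque
      e : ℕ
      e = ℕ.quotient (Fixes⇒d∣ {N} Fixes-N)

      N≡e*d : N ≡ e ℕ.* d
      N≡e*d = ℕ._∣_.equality (Fixes⇒d∣ {N} Fixes-N)

    -- Fewer than d elements cannot span K: the restrictions of σ⁰, …, σᵈ⁻¹ to K are distinct.
    d≤s : d ℕ.≤ s
    d≤s = ℕ.≮⇒≥ λ s<d → no-relation s<d (LinearDependence.Domain.dependent L 1≉0 *-nonzeroˡ ≈0? s (λ i j → σ^ (toℕ i) (b j)))
      where
      -- By minimality of d some basis element is moved by σ^(j - i); injectivity of σ^i keeps the
      -- two images apart.
      distinct< : ∀ i j → i ℕ.< j → j ℕ.< d → ∃ λ y → y ∈ K × ¬ σ^ i y ≈ σ^ j y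
      distinct< i j i<j j<d = witness (Fin.¬∀⟶∃¬ s (λ l → σ^ (j ∸ i) (b l) ≈ b l) (λ l → Dec.map′ -≈0⇒≈ ≈⇒-≈0 (≈0? (σ^ (j ∸ i) (b l) - b l)))
          (d-minimal (j ∸ i) (ℕ.m<n⇒0<n∸m i<j) (ℕ.≤-<-trans (ℕ.m∸n≤m j i) j<d)))
        where
        witness : (∃ λ l → ¬ σ^ (j ∸ i) (b l) ≈ b l) → ∃ λ y → y ∈ K × ¬ σ^ i y ≈ σ^ j y
        witness (l , ≉) = b l , b∈K l , λ eq → ≉ (sym (IsRingIsomorphism.injective (σ^-auto i)
          (trans eq (trans (reflexive (≡.cong (λ k → σ^ k (b l)) (≡.sym (ℕ.m+[n∸m]≡n (ℕ.<⇒≤ i<j))))) (σ^-+ i (j ∸ i) (b l))))))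
      distinct : s ℕ.< d → ∀ (i j : Fin (suc s)) → ¬ i ≡ j → ∃ λ y → y ∈ K × ¬ σ^ (toℕ i) y ≈ σ^ (toℕ j) y
      distinct s<d i j i≢j with ℕ.<-cmp (toℕ i) (toℕ j)
      ... | tri< i<j _ _ = distinct< (toℕ i) (toℕ j) i<j (ℕ.<-≤-trans (Fin.toℕ<n j) s<d)
      ... | tri≈ _ i≡j _ = contradiction (Fin.toℕ-injective i≡j) i≢j
      ... | tri> _ _ j<i = swap (distinct< (toℕ j) (toℕ i) j<i (ℕ.<-≤-trans (Fin.toℕ<n i) s<d))
        where
        swap : (∃ λ y → y ∈ K × ¬ σ^ (toℕ j) y ≈ σ^ (toℕ i) y) → ∃ λ y → y ∈ K × ¬ σ^ (toℕ i) y ≈ σ^ (toℕ j) y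
        swap (y , y∈K , ≉) = y , y∈K , ≉ ∘ sym
      vanishes : ∀ (a : Fin (suc s) → Carrier) → (∀ j → sum (λ i → a i * σ^ (toℕ i) (b j)) ≈ 0#) →
                 ∀ x → x ∈ K → sum (λ i → a i * σ^ (toℕ i) x) ≈ 0#
      vanishes a rel x x∈K with spanning x∈K
      ... | D , D≢0 , l , Dx≈ = *-nonzeroˡ (⟦⟧≉0 D≢0) (begin
        ⟦ D ⟧ * sum (λ i → a i * σ^ (toℕ i) x)
          ≈⟨ *-distribˡ-sum {suc s} ⟦ D ⟧ (λ i → a i * σ^ (toℕ i) x) ⟩
        sum (λ i → ⟦ D ⟧ * (a i * σ^ (toℕ i) x))
          ≈⟨ sum-cong-≋ {suc s} (λ i → trans (solve 3 (λ D a x → D :* (a :* x) := a :* (D :* x)) refl ⟦ D ⟧ (a i) (σ^ (toℕ i) x))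
               (trans (*-congˡ {a i} (trans (sym (σ^.τ-⟦⟧* (toℕ i) D x)) (trans (σ^.τ-cong (toℕ i) Dx≈) (σ^.τ-combination (toℕ i) {s} l b))))
                      (*-distribˡ-sum {s} (a i) (λ j → ⟦ l j ⟧ * σ^ (toℕ i) (b j))))) ⟩
        sum (λ i → sum (λ j → a i * (⟦ l j ⟧ * σ^ (toℕ i) (b j))))
          ≈⟨ ∑-comm {suc s} {s} (λ i j → a i * (⟦ l j ⟧ * σ^ (toℕ i) (b j))) ⟩
        sum (λ j → sum (λ i → a i * (⟦ l j ⟧ * σ^ (toℕ i) (b j))))
          ≈⟨ sum-zero {s} (λ j → trans
               (sum-cong-≋ {suc s} λ i → solve 3 (λ a l x → a :* (l :* x) := l :* (a :* x)) refl (a i) ⟦ l j ⟧ (σ^ (toℕ i) (b j)))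
               (trans (sym (*-distribˡ-sum {suc s} ⟦ l j ⟧ (λ i → a i * σ^ (toℕ i) (b j)))) (trans (*-congˡ (rel j)) (zeroʳ ⟦ l j ⟧)))) ⟩
        0# ∎)
      no-relation : s ℕ.< d → ¬ Σ (Fin (suc s) → Carrier) λ a → (∃ λ i → ¬ a i ≈ 0#) × (∀ j → sum (λ i → a i * σ^ (toℕ i) (b j)) ≈ 0#)
      no-relation s<d (a , (i , aᵢ≉0) , rel) = aᵢ≉0 (dedekind K 1#-closed K-* (suc s) (σ^ ∘ toℕ) (λ i → σ^.τ-* (toℕ i)) (λ i → σ^.τ-1 (toℕ i))
        (distinct s<d) a (vanishes a rel) i)

    open Periods d e N≡e*d

    InSpan : Carrier → Set ℓ
    InSpan x = Σ ℤ λ D → ¬ D ≡ + 0 × Σ (ℕ → ℤ) λ a → ⟦ D ⟧ * x ≈ ∑< d (λ i → ⟦ a i ⟧ * η i)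

    opaque
      fixed⇒InSpan : ∀ {x} → σ^ d x ≈ x → InSpan x
      fixed⇒InSpan {x} fixed = result (clear x)
        where
        result : x ∈ Frac → InSpan x
        result (D , D≢0 , Dx∈R) = D , D≢0 , fixed⇒η Dx∈R (trans (σ^.τ-⟦⟧* d D x) (*-congˡ fixed))

      b-η : ∀ j → InSpan (b j)
      b-η j = fixed⇒InSpan (Fixes-d j)

    -- Padding with zeros up to length r only serves to compare r with d.
    opaque
      pad : ∀ {r} → d ℕ.≤ r → (a : ℕ → ℤ) → Σ (ℕ → ℤ) λ a′ → ∑< d (λ i → ⟦ a i ⟧ * η i) ≈ ∑< r (λ i → ⟦ a′ i ⟧ * η i)
      pad {r} d≤r a = a′ , sym (begin
        ∑< r (λ i → ⟦ a′ i ⟧ * η i)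
          ≡⟨ ≡.cong (λ m → ∑< m (λ i → ⟦ a′ i ⟧ * η i)) (ℕ.m+[n∸m]≡n d≤r) ⟨
        ∑< (d ℕ.+ (r ∸ d)) (λ i → ⟦ a′ i ⟧ * η i)
          ≈⟨ ∑<-++ d (r ∸ d) (λ i → ⟦ a′ i ⟧ * η i) ⟩
        ∑< d (λ i → ⟦ a′ i ⟧ * η i) + ∑< (r ∸ d) (λ i → ⟦ a′ (d ℕ.+ i) ⟧ * η (d ℕ.+ i))
          ≈⟨ +-cong (∑<-cong d λ i i<d → *-congʳ {η i} (⟦⟧-cong (a′< i i<d)))
               (∑<-zero (r ∸ d) λ i _ → trans (*-congʳ {η (d ℕ.+ i)} (⟦⟧-cong (a′≥ (d ℕ.+ i) (ℕ.m≤m+n d i)))) (zeroˡ (η (d ℕ.+ i)))) ⟩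
        ∑< d (λ i → ⟦ a i ⟧ * η i) + 0#
          ≈⟨ +-identityʳ _ ⟩
        ∑< d (λ i → ⟦ a i ⟧ * η i) ∎)
        where
        a′ : ℕ → ℤ
        a′ i with i ℕ.<? d
        ... | yes _ = a i
        ... | no  _ = + 0
        a′< : ∀ i → i ℕ.< d → a′ i ≡ a i
        a′< i i<d with i ℕ.<? d
        ... | yes _   = ≡.refl
        ... | no  i≮d = contradiction i<d i≮d
        a′≥ : ∀ i → d ℕ.≤ i → a′ i ≡ + 0
        a′≥ i d≤i with i ℕ.<? d
        ... | yes i<d = contradiction i<d (ℕ.≤⇒≯ d≤i)
        ... | no  _   = ≡.refl

    b-scaled-independent : ∀ (k : Fin s → ℤ) → sum (λ j → ⟦ k j ⟧ * (⟦ proj₁ (b-η j) ⟧ * b j)) ≈ 0# → ∀ j → k j ≡ + 0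
    b-scaled-independent k rel j = ℤ-*-nonzeroˡ (proj₁ (proj₂ (b-η j))) (≡.trans (ℤ.*-comm (proj₁ (b-η j)) (k j))
      (independent (λ j → k j ℤ.* proj₁ (b-η j)) (trans (sum-cong-≋ {s} λ j → trans (*-congʳ {b j} (⟦*⟧ (k j) (proj₁ (b-η j)))) (*-assoc _ _ _)) rel) j))

    opaque
      -- Were d ≤ s - 1, the s basis elements of `K`, up to denominators, would be integer
      -- combinations of s - 1 padded periods and hence dependent.
      s≤d : s ℕ.≤ d
      s≤d = bound s ≡.refl
        where
        bound : ∀ r → r ≡ s → s ℕ.≤ d
        bound zero    ≡.refl = z≤n
        bound (suc r) ≡.refl = ℕ.≮⇒≥ λ { (s≤s d≤r) → no-relation (ℤ-dependent {r} (η ∘ toℕ) (λ j → ⟦ proj₁ (b-η j) ⟧ * b j)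
            (λ j i → proj₁ (pad d≤r (proj₁ (proj₂ (proj₂ (b-η j))))) (toℕ i))
            (λ j → trans (proj₂ (proj₂ (proj₂ (b-η j)))) (proj₂ (pad d≤r (proj₁ (proj₂ (proj₂ (b-η j)))))))) }
          where
          no-relation : ¬ IntegerRelation (λ j → ⟦ proj₁ (b-η j) ⟧ * b j)
          no-relation (k , (j , kⱼ≢0) , rel) = kⱼ≢0 (b-scaled-independent k rel j)

    d≡s : d ≡ s
    d≡s = ℕ.≤-antisym d≤s s≤d

    η-period : ∀ i → η (d ℕ.+ i) ≈ η i
    η-period i = begin
      η (d ℕ.+ i)
        ≈⟨ ∑<-cong e (λ k _ → reflexive (≡.cong w (≡.trans (≡.sym (ℕ.+-assoc (k ℕ.* d) d i)) (≡.cong (ℕ._+ i) (ℕ.+-comm (k ℕ.* d) d))))) ⟩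
      ∑< e (λ k → w (suc k ℕ.* d ℕ.+ i))
        ≈⟨ ∑<-cong e (λ k _ → reflexive (≡.cong (λ m → w (m ℕ.* d ℕ.+ i)) (ℕ.+-comm 1 k))) ⟩
      ∑< e (λ k → w ((k ℕ.+ 1) ℕ.* d ℕ.+ i))
        ≈⟨ ∑<-shift e (λ k → w (k ℕ.* d ℕ.+ i)) (λ k → trans (reflexive (≡.cong w (shift k))) (w-period (k ℕ.* d ℕ.+ i))) 1 ⟩
      η i ∎
      where
      shift : ∀ k → (k ℕ.+ e) ℕ.* d ℕ.+ i ≡ k ℕ.* d ℕ.+ i ℕ.+ N
      shift k = ≡.trans (≡.cong (ℕ._+ i) (≡.trans (ℕ.*-distribʳ-+ d k e) (≡.cong (k ℕ.* d ℕ.+_) (≡.sym N≡e*d))))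
        (≡.trans (ℕ.+-assoc (k ℕ.* d) N i) (≡.trans (≡.cong (k ℕ.* d ℕ.+_) (ℕ.+-comm N i)) (≡.sym (ℕ.+-assoc (k ℕ.* d) i N))))

    -- Together with x the basis of `K` gives s + 1 elements in the span of s periods. In the
    -- resulting relation x has a nonzero coefficient, because the basis is independent, so x is a
    -- quotient of elements of `K`.
    InSpan⇒K : ∀ {x} → InSpan x → x ∈ K
    InSpan⇒K {x} (D , D≢0 , a , Dx≈) = result (ℤ-dependent {s} (η ∘ toℕ) vs coefficients vs≈)
      where
      vs : Fin (suc s) → Carrier
      vs zero    = ⟦ D ⟧ * x
      vs (suc j) = ⟦ proj₁ (b-η j) ⟧ * b j
      coefficients : Fin (suc s) → Fin s → ℤ
      coefficients zero    i = proj₁ (pad d≤s a) (toℕ i)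
      coefficients (suc j) i = proj₁ (pad d≤s (proj₁ (proj₂ (proj₂ (b-η j))))) (toℕ i)
      vs≈ : ∀ j → vs j ≈ sum (λ i → ⟦ coefficients j i ⟧ * η (toℕ i))
      vs≈ zero    = trans Dx≈ (proj₂ (pad d≤s a))
      vs≈ (suc j) = trans (proj₂ (proj₂ (proj₂ (b-η j)))) (proj₂ (pad d≤s (proj₁ (proj₂ (proj₂ (b-η j))))))
      result : IntegerRelation vs → x ∈ K
      result (k , (j , kⱼ≢0) , rel) = conclude (k zero ℤ.≟ + 0)
        where
        rest : Carrier
        rest = sum (λ j → ⟦ k (suc j) ⟧ * vs (suc j))
        all0 : k zero ≡ + 0 → ∀ j → k j ≡ + 0
        all0 k₀≡0 zero    = k₀≡0
        all0 k₀≡0 (suc j) = b-scaled-independent (k ∘ suc) (begin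
          rest                            ≈⟨ +-identityˡ _ ⟨
          0# + rest                       ≈⟨ +-congʳ (trans (*-congʳ (⟦⟧-cong k₀≡0)) (zeroˡ (⟦ D ⟧ * x))) ⟨
          ⟦ k zero ⟧ * vs zero + rest     ≈⟨ rel ⟩
          0#                              ∎) j
        conclude : Dec (k zero ≡ + 0) → x ∈ K
        conclude (yes k₀≡0) = contradiction (all0 k₀≡0 j) kⱼ≢0
        conclude (no k₀≢0) = K-divide D≢0 (K-divide k₀≢0 (K-resp (begin
            - rest                                   ≈⟨ +-identityˡ _ ⟨
            0# - rest                                ≈⟨ +-congʳ rel ⟨
            (⟦ k zero ⟧ * vs zero + rest) - rest     ≈⟨ solve 2 (λ x y → (x :+ y) :- y := x) refl (⟦ k zero ⟧ * vs zero) rest ⟩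
            ⟦ k zero ⟧ * vs zero                     ∎)
          (K-neg (K-sum {s} λ j → K-* (K-⟦⟧ (k (suc j))) (K-* (K-⟦⟧ (proj₁ (b-η j))) (b∈K j))))))

    K-η : ∀ i → η i ∈ K
    K-η i = InSpan⇒K (fixed⇒InSpan (trans (σ^-η d i) (η-period i)))

    w-injective : ∀ {i j} → i ℕ.< N → j ℕ.< N → w i ≈ w j → i ≡ j
    w-injective {i} {j} i<N j<N eq = U.^-injective i<N j<N (ζ^-injective (ℕ.m%n<n (v ℕ.^ i) p) (ℕ.m%n<n (v ℕ.^ j) p)
        (trans (sym (ζ^-% (v ℕ.^ i))) (trans eq (ζ^-% (v ℕ.^ j)))))
      where
      module U = UnitsMod.PrimitiveRoot p N ≡.refl prime v p∤v generates
      ζ^-injective< : ∀ {i j} → i ℕ.< j → j ℕ.< p → ¬ ζ ^ i ≈ ζ ^ j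
      ζ^-injective< {i} {j} i<j j<p eq = ζ^k≉1 (j ∸ i) (ℕ.m<n⇒0<n∸m i<j) (ℕ.≤-<-trans (ℕ.m∸n≤m j i) j<p)
        (*-cancelˡ (ζ^≉0 i) (sym (trans (*-identityʳ _) (trans eq (trans (reflexive (≡.cong (ζ ^_) (≡.sym (ℕ.m+[n∸m]≡n (ℕ.<⇒≤ i<j))))) (^-homo-* ζ i (j ∸ i)))))))
      ζ^-injective : ∀ {i j} → i ℕ.< p → j ℕ.< p → ζ ^ i ≈ ζ ^ j → i ≡ j
      ζ^-injective {i} {j} i<p j<p eq with ℕ.<-cmp i j
      ... | tri< i<j _ _ = contradiction eq (ζ^-injective< i<j j<p)
      ... | tri≈ _ i≡j _ = i≡j
      ... | tri> _ _ j<i = contradiction (sym eq) (ζ^-injective< j<i i<p)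

    -- The given enumeration of the Galois group is matched with the powers of σ^d below the
    -- exponent N: completeness yields one direction, and an automorphism is a power of σ by its
    -- value at ζ. Applied to ζ, these powers run through the terms of the period.
    trace : ∀ {t} → IsTrace L K ζ t → t ≈ η 0
    trace {t} (m , g , galois , t≈) = begin
      t                                       ≈⟨ t≈ ⟩
      sum (λ i → g i ζ)                       ≈⟨ sum-permute (λ i → g i ζ) (permutation from to from-to to-from) ⟩
      sum {e} (λ k → g (from k) ζ)            ≈⟨ sum-cong-≋ {e} (λ k → trans (sym (proj₂ (from-spec k) ζ)) (trans (σ^ζ≈w (toℕ k ℕ.* d)) (reflexive (≡.cong w (≡.sym (ℕ.+-identityʳ (toℕ k ℕ.* d))))))) ⟩
      η 0                                     ∎
      where
      open IsGaloisGroup galois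
      from-spec : ∀ (k : Fin e) → ∃ λ i → ∀ x → σ^ (toℕ k ℕ.* d) x ≈ g i x
      from-spec k = complete (σ^ (toℕ k ℕ.* d)) (σ^-auto (toℕ k ℕ.* d)) (λ x∈K → Fixes⇒ (toℕ k ℕ.* d) (Fixes-multiple (toℕ k)) x∈K)
      to-spec : ∀ i → ∃ λ (k : Fin e) → ∀ x → g i x ≈ σ^ (toℕ k ℕ.* d) x
      to-spec i = result (automorphism-ζ (automorphism i))
        where
        g-hom = IsRingIsomorphism.isRingHomomorphism (automorphism i)
        result : (∃ λ a → g i ζ ≈ w a) → ∃ λ (k : Fin e) → ∀ x → g i x ≈ σ^ (toℕ k ℕ.* d) x
        result (a , gζ≈) = Fin.fromℕ< k<e , λ x → trans (g≈ x) (reflexive (≡.cong (λ l → σ^ l x) (≡.trans a%N≡ (≡.cong (ℕ._* d) (≡.sym (Fin.toℕ-fromℕ< k<e))))))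
          where
          g≈ : ∀ x → g i x ≈ σ^ (a ℕ.% N) x
          g≈ = agree g-hom (σ^-hom (a ℕ.% N)) (trans gζ≈ (trans (w-cong-% a) (sym (σ^ζ≈w (a ℕ.% N)))))
          -- As this automorphism fixes `K`, its exponent is a multiple of d.
          d∣ : d ℕ.∣ a ℕ.% N
          d∣ = Fixes⇒d∣ (λ j → trans (sym (g≈ (b j))) (fixes i (b∈K j)))
          a%N≡ : a ℕ.% N ≡ ℕ.quotient d∣ ℕ.* d
          a%N≡ = ℕ._∣_.equality d∣
          k<e : ℕ.quotient d∣ ℕ.< e
          k<e = ℕ.*-cancelʳ-< d (ℕ.quotient d∣) e (≡.subst₂ ℕ._<_ a%N≡ N≡e*d (ℕ.m%n<n a N))
      from : Fin e → Fin m
      from k = proj₁ (from-spec k)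
      to : Fin m → Fin e
      to i = proj₁ (to-spec i)
      from-to : ∀ i → from (to i) ≡ i
      from-to i = distinct (from (to i)) i λ x → trans (sym (proj₂ (from-spec (to i)) x)) (sym (proj₂ (to-spec i) x))
      k*d<N : ∀ (k : Fin e) → toℕ k ℕ.* d ℕ.< N
      k*d<N k = ≡.subst (toℕ k ℕ.* d ℕ.<_) (≡.sym N≡e*d) (ℕ.*-monoˡ-< d (Fin.toℕ<n k))
      to-from : ∀ k → to (from k) ≡ k
      to-from k = Fin.toℕ-injective (ℕ.*-cancelʳ-≡ (toℕ (to (from k))) (toℕ k) d (w-injective (k*d<N (to (from k))) (k*d<N k)
        (trans (sym (σ^ζ≈w (toℕ (to (from k)) ℕ.* d))) (trans (sym (proj₂ (to-spec (from k)) ζ)) (trans (sym (proj₂ (from-spec k) ζ)) (σ^ζ≈w (toℕ k ℕ.* d)))))))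

    module Trace {t} (isTrace : IsTrace L K ζ t) where

      σ^t≈η : ∀ i → σ^ i t ≈ η i
      σ^t≈η i = trans (σ^.τ-cong i (trace isTrace)) (trans (σ^-η i 0) (reflexive (≡.cong η (ℕ.+-identityʳ i))))

      σ^t∈K : ∀ i → σ^ i t ∈ K
      σ^t∈K i = K-resp (sym (σ^t≈η i)) (K-η i)

      σ^t∈R : ∀ i → σ^ i t ∈ R
      σ^t∈R i = R-resp (sym (σ^t≈η i)) (R-η i)

      coordinates : ∀ {x} → x ∈ K → x ∈ R → Σ (ℕ → ℤ) λ a → x ≈ ∑< s (λ i → ⟦ a i ⟧ * σ^ i t)
      coordinates {x} x∈K x∈R = result (fixed⇒η x∈R (Fixes⇒ d Fixes-d x∈K))
        where
        result : (Σ (ℕ → ℤ) λ a → x ≈ ∑< d (λ i → ⟦ a i ⟧ * η i)) → Σ (ℕ → ℤ) λ a → x ≈ ∑< s (λ i → ⟦ a i ⟧ * σ^ i t)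
        result (a , x≈) = a , trans x≈ (trans (reflexive (≡.cong (λ m → ∑< m (λ i → ⟦ a i ⟧ * η i)) d≡s))
          (∑<-cong s λ i _ → *-congˡ {⟦ a i ⟧} (sym (σ^t≈η i))))

      coordinates-unique : (a : ℕ → ℤ) → ∑< s (λ i → ⟦ a i ⟧ * σ^ i t) ≈ 0# → ∀ i → i ℕ.< s → a i ≡ + 0
      coordinates-unique a rel i i<s = η-independent a (trans (reflexive (≡.cong (λ m → ∑< m (λ i → ⟦ a i ⟧ * η i)) d≡s))
        (trans (∑<-cong s λ i _ → *-congˡ {⟦ a i ⟧} (sym (σ^t≈η i))) rel)) i (≡.subst (i ℕ.<_) (≡.sym d≡s) i<s)

  -- Polynomials with prescribed roots; elements of ℤ[ζ] are integral.

  _·X-_ : (ℕ → Carrier) → Carrier → ℕ → Carrier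
  (f ·X- r) zero    = - r * f zero
  (f ·X- r) (suc j) = f j - r * f (suc j)

  -- Polynomials are coefficient sequences, and `f ·X- r` is f times X - r; this is the product of X
  -- - r k over k below m.
  ∏X- : (ℕ → Carrier) → ℕ → ℕ → Carrier
  ∏X- r zero    zero    = 1#
  ∏X- r zero    (suc j) = 0#
  ∏X- r (suc m) j       = (∏X- r m ·X- r m) j

  ·X-cong : ∀ {f g r r′} → (∀ j → f j ≈ g j) → r ≈ r′ → ∀ j → (f ·X- r) j ≈ (g ·X- r′) j
  ·X-cong f≈g r≈r′ zero    = *-cong (-‿cong r≈r′) (f≈g 0)
  ·X-cong f≈g r≈r′ (suc j) = +-cong (f≈g j) (-‿cong (*-cong r≈r′ (f≈g (suc j))))

  ·X-comm : ∀ f r r′ j → ((f ·X- r) ·X- r′) j ≈ ((f ·X- r′) ·X- r) j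
  ·X-comm f r r′ zero          = solve 3 (λ f r s → :- s :* (:- r :* f) := :- r :* (:- s :* f)) refl (f 0) r r′
  ·X-comm f r r′ (suc zero)    = solve 4 (λ f g r s → :- r :* f :- s :* (f :- r :* g) := :- s :* f :- r :* (f :- s :* g)) refl (f 0) (f 1) r r′
  ·X-comm f r r′ (suc (suc j)) = solve 5 (λ f g h r s → (f :- r :* g) :- s :* (g :- r :* h) := (f :- s :* g) :- r :* (g :- s :* h))
    refl (f j) (f (suc j)) (f (suc (suc j))) r r′

  ∏X-cons : ∀ r m j → (∏X- (r ∘ suc) m ·X- r 0) j ≈ ∏X- r (suc m) j
  ∏X-cons r zero    j = ·X-cong (λ { zero → refl ; (suc _) → refl }) refl j
  ∏X-cons r (suc m) j = trans (·X-comm (∏X- (r ∘ suc) m) (r (suc m)) (r 0) j) (·X-cong (∏X-cons r m) refl j)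

  -- For roots that are successive conjugates under σ, this says that σ fixes the coefficients.
  ∏X-rotate : ∀ r m → r (suc m) ≈ r 0 → ∀ j → ∏X- (r ∘ suc) (suc m) j ≈ ∏X- r (suc m) j
  ∏X-rotate r m eq j = trans (·X-cong (λ _ → refl) eq j) (∏X-cons r m j)

  ∏X-high : ∀ r m j → m ℕ.< j → ∏X- r m j ≈ 0#
  ∏X-high r zero    (suc j) _         = refl
  ∏X-high r (suc m) (suc j) (s≤s m<j) = trans (+-cong (∏X-high r m j m<j) (-‿cong (trans (*-congˡ (∏X-high r m (suc j) (ℕ.m<n⇒m<1+n m<j))) (zeroʳ _))))
    (-‿inverseʳ 0#)

  ∏X-leading : ∀ r m → ∏X- r m m ≈ 1#
  ∏X-leading r zero    = refl
  ∏X-leading r (suc m) = trans (+-cong (∏X-leading r m) (trans (-‿cong (trans (*-congˡ (∏X-high r m (suc m) (ℕ.n<1+n m))) (zeroʳ _))) -0#≈0#)) (+-identityʳ 1#)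

  eval : (ℕ → Carrier) → ℕ → Carrier → Carrier
  eval f m x = ∑< m (λ j → f j * x ^ j)

  -- The truncation lengths differ because multiplication by X raises every exponent by one.
  eval-·X- : ∀ f r x m → eval (f ·X- r) (suc m) x ≈ x * eval f m x - r * eval f (suc m) x
  eval-·X- f r x zero    = solve 4 (λ f r x o → :- r :* f :* o :+ con (+ 0) := x :* con (+ 0) :- r :* (f :* o :+ con (+ 0))) refl (f 0) r x 1#
  eval-·X- f r x (suc m) = begin
    eval (f ·X- r) (suc (suc m)) x
      ≈⟨ ∑<-last (suc m) (λ j → (f ·X- r) j * x ^ j) ⟩
    eval (f ·X- r) (suc m) x + (f m - r * f (suc m)) * (x * x ^ m)
      ≈⟨ +-congʳ (eval-·X- f r x m) ⟩
    (x * eval f m x - r * eval f (suc m) x) + (f m - r * f (suc m)) * (x * x ^ m)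
      ≈⟨ solve 7 (λ x e r e′ f f′ y → (x :* e :- r :* e′) :+ (f :- r :* f′) :* (x :* y) := x :* (e :+ f :* y) :- r :* (e′ :+ f′ :* (x :* y)))
           refl x (eval f m x) r (eval f (suc m) x) (f m) (f (suc m)) (x ^ m) ⟩
    x * (eval f m x + f m * x ^ m) - r * (eval f (suc m) x + f (suc m) * x ^ suc m)
      ≈⟨ +-cong (*-congˡ (∑<-last m (λ j → f j * x ^ j))) (-‿cong (*-congˡ (∑<-last (suc m) (λ j → f j * x ^ j)))) ⟨
    x * eval f (suc m) x - r * eval f (suc (suc m)) x ∎

  -- The factor X - r 0 was the first to enter; every later factor multiplies a value that is
  -- already zero.
  eval-∏X- : ∀ r m → eval (∏X- r (suc m)) (suc (suc m)) (r 0) ≈ 0#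
  eval-∏X- r m = trans (eval-·X- (∏X- r m) (r m) (r 0) (suc m))
    (trans (+-congˡ (-‿cong (*-congˡ (trans (∑<-last (suc m) (λ j → ∏X- r m j * r 0 ^ j))
        (trans (+-congˡ (trans (*-congʳ (∏X-high r m (suc m) (ℕ.n<1+n m))) (zeroˡ _))) (+-identityʳ _))))))
      (cases m))
    where
    cases : ∀ m → r 0 * eval (∏X- r m) (suc m) (r 0) - r m * eval (∏X- r m) (suc m) (r 0) ≈ 0#
    cases zero    = -‿inverseʳ _
    cases (suc m) = trans (+-cong (trans (*-congˡ (eval-∏X- r m)) (zeroʳ _)) (-‿cong (trans (*-congˡ (eval-∏X- r m)) (zeroʳ _)))) (-‿inverseʳ 0#)

  ∏X-∈R : ∀ r → (∀ k → r k ∈ R) → ∀ m j → ∏X- r m j ∈ R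
  ∏X-∈R r r∈R zero    zero    = R-1
  ∏X-∈R r r∈R zero    (suc j) = R-0
  ∏X-∈R r r∈R (suc m) zero    = R-* (R-neg (r∈R m)) (∏X-∈R r r∈R m 0)
  ∏X-∈R r r∈R (suc m) (suc j) = R-sub (∏X-∈R r r∈R m j) (R-* (r∈R m) (∏X-∈R r r∈R m (suc j)))

  module _ {τ : Carrier → Carrier} (hom : IsRingHomomorphism rawRing rawRing τ) where

    open Hom hom

    τ-∏X- : ∀ r m j → τ (∏X- r m j) ≈ ∏X- (τ ∘ r) m j
    τ-∏X- r zero    zero    = τ-1
    τ-∏X- r zero    (suc j) = τ-0
    τ-∏X- r (suc m) zero    = trans (τ-* (- r m) (∏X- r m 0)) (*-cong (τ-neg (r m)) (τ-∏X- r m 0))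
    τ-∏X- r (suc m) (suc j) = trans (τ-+ (∏X- r m j) (- (r m * ∏X- r m (suc j)))) (+-cong (τ-∏X- r m j)
      (trans (τ-neg (r m * ∏X- r m (suc j))) (-‿cong (trans (τ-* (r m) (∏X- r m (suc j))) (*-congˡ (τ-∏X- r m (suc j)))))))

  module Conjugates (v : ℕ) (p∤v : ¬ p ℕ.∣ v) (generates : ∀ j → 0 ℕ.< j → j ℕ.< p → ∃ λ k → v ℕ.^ k ℕ.% p ≡ j)
                    (σ : Carrier → Carrier) (σ-auto : IsAutomorphism L σ) (σζ≈ : σ ζ ≈ ζ ^ v) where

    open Normal v p∤v generates
    open Cyclic v p∤v generates σ σ-auto σζ≈
    open Periods 1 N (≡.sym (ℕ.*-identityʳ N))

    ∑w≈-1 : ∑< N w ≈ - 1#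
    ∑w≈-1 = begin
      ∑< N w                                     ≈⟨ ∑<-cong N {w} {λ a → ζ ^ suc (toℕ (exp a))} (λ a _ → w-exp a) ⟩
      sum {N} (λ a → ζ ^ suc (toℕ (exp (toℕ a))))  ≈⟨ ∑-permute (λ i → ζ ^ suc (toℕ i)) ⟨
      ∑< N (λ i → ζ ^ suc i)                     ≈⟨ solve 2 (λ x y → x := (y :+ x) :- y) refl _ 1# ⟩
      ∑< p (ζ ^_) - 1#                           ≈⟨ trans (+-congʳ ∑ζ^≈0) (+-identityˡ _) ⟩
      - 1#                                       ∎
      where open UnitsMod.PrimitiveRoot p N ≡.refl prime v p∤v generates using (exp)

    -- The case d = 1 of the fixed elements: the only period is the sum of all p-th roots of unity
    -- except 1, which is -1.
    rational : ∀ {x} → x ∈ R → σ x ≈ x → ∃ λ i → x ≈ ⟦ i ⟧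
    rational {x} x∈R fixed = result (fixed⇒η x∈R fixed)
      where
      result : (Σ (ℕ → ℤ) λ a → x ≈ ∑< 1 (λ i → ⟦ a i ⟧ * η i)) → ∃ λ i → x ≈ ⟦ i ⟧
      result (a , x≈) = ℤ.- a 0 , (begin
        x                        ≈⟨ trans x≈ (+-identityʳ _) ⟩
        ⟦ a 0 ⟧ * η 0            ≈⟨ *-congˡ (trans (∑<-cong N {λ k → w (k ℕ.* 1 ℕ.+ 0)} {w} (λ k _ → reflexive (≡.cong w (≡.trans (ℕ.+-identityʳ (k ℕ.* 1)) (ℕ.*-identityʳ k))))) ∑w≈-1) ⟩
        ⟦ a 0 ⟧ * - 1#           ≈⟨ trans (sym (-‿distribʳ-* _ _)) (-‿cong (*-identityʳ _)) ⟩
        - ⟦ a 0 ⟧                ≈⟨ ⟦-⟧ (a 0) ⟨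
        ⟦ ℤ.- a 0 ⟧              ∎)

    -- z is a root of the monic polynomial with roots σ^k z for k < N. Its coefficients lie in `R`
    -- and are fixed by σ, so they are integers.
    R⇒IsIntegral : ∀ {z} → z ∈ R → IsIntegral L ι z
    R⇒IsIntegral {z} z∈R = N , (λ i → proj₁ (integer (toℕ i))) , (begin
        z ^ N + ∑< N (λ i → fromℤ L ι (proj₁ (integer i)) * z ^ i)
          ≈⟨ +-cong (sym (trans (*-congʳ (∏X-leading r N)) (*-identityˡ _)))
               (∑<-cong N λ i _ → *-congʳ {z ^ i} (trans (fromℤ≈⟦⟧ (proj₁ (integer i))) (sym (proj₂ (integer i))))) ⟩
        ∏X- r N N * z ^ N + eval (∏X- r N) N z
          ≈⟨ +-comm _ _ ⟩
        eval (∏X- r N) N z + ∏X- r N N * z ^ N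
          ≈⟨ ∑<-last N (λ j → ∏X- r N j * z ^ j) ⟨
        eval (∏X- r N) (suc N) z
          ≈⟨ eval-∏X- r n ⟩
        0# ∎)
      where
      r : ℕ → Carrier
      r k = σ^ k z
      r∈R : ∀ k → r k ∈ R
      r∈R k = R-resp (sym (trans (σ^.τ-cong k (proj₂ z∈R)) (σ^.τ-combination k {p} (proj₁ z∈R ∘ toℕ) (λ i → ζ ^ toℕ i))))
        (R-sum {p} λ i → R-⟦⟧* (proj₁ z∈R (toℕ i)) (R-resp (sym (trans (σ^.τ-^ k ζ (toℕ i)) (^-congˡ (toℕ i) (σ^ζ≈w k)))) (R-^ (toℕ i) (R-^ (v ℕ.^ k) R-ζ))))
      integer : ∀ j → ∃ λ i → ∏X- r N j ≈ ⟦ i ⟧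
      integer j = rational (∏X-∈R r r∈R N j)
        (trans (τ-∏X- (IsRingIsomorphism.isRingHomomorphism σ-auto) r N j) (∏X-rotate r n (σ^N≈id z) j))

  -- The index of 𝓜 in 𝓞.

  module Index (v : ℕ) (p∤v : ¬ p ℕ.∣ v) (generates : ∀ j → 0 ℕ.< j → j ℕ.< p → ∃ λ k → v ℕ.^ k ℕ.% p ≡ j)
               (σ : Carrier → Carrier) (σ-auto : IsAutomorphism L σ) (σζ≈ : σ ζ ≈ ζ ^ v)
               {κ} (K : Pred Carrier κ) (subfield : IsSubfield L K) (s : ℕ) .{{_ : ℕ.NonZero s}} (degree : HasDegree L ι K s)
               (t : Carrier) (isTrace : IsTrace L K ζ t)
               (e : ℕ) (1+es≡p : suc (e ℕ.* s) ≡ p) (α : ℤ) (α^s≈1 : IntegersMod._≈ₘ_ p (α ℤ.^ s) (+ 1))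
               (α^k≉1 : ∀ k → 0 ℕ.< k → k ℕ.< s → ¬ IntegersMod._≈ₘ_ p (α ℤ.^ k) (+ 1))
               -- The parity of s enters only through the number m of congruences.
               (m : ℕ) (m≤s : m ℕ.≤ s)
               (congruences⇒ : ∀ {a} → Congruences p s α a → ∀ k → k ℕ.< m → a · μ α k ≡ + 0 [mod p ])
               (⇒congruences : ∀ {a} → (∀ k → k ℕ.< m → a · μ α k ≡ + 0 [mod p ]) → Congruences p s α a) where

    open Cyclic v p∤v generates σ σ-auto σζ≈
    open Conjugates v p∤v generates σ σ-auto σζ≈
    open SubfieldOfDegree v p∤v generates σ σ-auto σζ≈ K subfield s degree hiding (d; e)
    open Trace isTrace
    open IntegersMod p
    private
      module ℤₚ = CommutativeRing ℤ/q
      module ∑ₚ = Sums ℤ/q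
    open TransformMod p prime s e 1+es≡p α α^s≈1 α^k≉1 using (prescribe)

    lin : (ℕ → ℤ) → Carrier
    lin a = ∑< s (λ i → ⟦ a i ⟧ * σ^ i t)

    infixl 6 _⊖_
    _⊖_ : (ℕ → ℤ) → (ℕ → ℤ) → ℕ → ℤ
    (a ⊖ b) i = a i ℤ.- b i

    lin-⊖ : ∀ a b → lin (a ⊖ b) ≈ lin a - lin b
    lin-⊖ a b = begin
      lin (a ⊖ b)
        ≈⟨ ∑<-cong s (λ i _ → trans (*-congʳ {σ^ i t} (trans (⟦+⟧ (a i) (ℤ.- b i)) (+-congˡ (⟦-⟧ (b i)))))
             (trans (distribʳ (σ^ i t) ⟦ a i ⟧ (- ⟦ b i ⟧)) (+-congˡ (sym (-‿distribˡ-* ⟦ b i ⟧ (σ^ i t)))))) ⟩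
      ∑< s (λ i → ⟦ a i ⟧ * σ^ i t + - (⟦ b i ⟧ * σ^ i t))
        ≈⟨ ∑<-+ s (λ i → ⟦ a i ⟧ * σ^ i t) (λ i → - (⟦ b i ⟧ * σ^ i t)) ⟩
      lin a + ∑< s (λ i → - (⟦ b i ⟧ * σ^ i t))
        ≈⟨ +-congˡ (sum-neg {s} (λ i → ⟦ b (toℕ i) ⟧ * σ^ (toℕ i) t)) ⟩
      lin a - lin b ∎

    lin∈𝓞 : ∀ {x} a → x ≈ lin a → x ∈ 𝓞 L ι K
    lin∈𝓞 {x} a x≈ = IsSubfield.resp subfield (sym x≈) (K-sum {s} λ i → IsSubfield.*-closed subfield (K-⟦⟧ (a (toℕ i))) (σ^t∈K (toℕ i))) ,
      R⇒IsIntegral (R-resp (sym x≈) (R-sum {s} λ i → R-⟦⟧* (a (toℕ i)) (σ^t∈R (toℕ i))))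

    𝓞⇒lin : ∀ {x} → x ∈ 𝓞 L ι K → Σ (ℕ → ℤ) λ a → x ≈ lin a
    𝓞⇒lin (x∈K , x-int) = coordinates x∈K (Integral⇒R (IsIntegral⇒Integral x-int))

    -- By definition equal to `(a ∘ toℕ) · μ α k`, but with the sum taken in the ring modulo p,
    -- whose lemmas then apply.
    dot : (ℕ → ℤ) → ℕ → ℤ
    dot a k = ∑ₚ.∑< s (λ j → a j ℤ.* α ℤ.^ (j ℕ.* k))

    dot-⊖ : ∀ a b k → dot (a ⊖ b) k ≈ₘ dot a k ℤ.- dot b k
    dot-⊖ a b k = ℤₚ.trans
      (∑ₚ.∑<-cong s {λ j → (a ⊖ b) j ℤ.* α ℤ.^ (j ℕ.* k)} {λ j → a j ℤ.* α ℤ.^ (j ℕ.* k) ℤ.+ ℤ.- (b j ℤ.* α ℤ.^ (j ℕ.* k))} λ j _ →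
        ≡⇒≈ₘ (≡.trans (ℤ.*-distribʳ-+ (α ℤ.^ (j ℕ.* k)) (a j) (ℤ.- b j))
          (≡.cong (ℤ._+_ (a j ℤ.* α ℤ.^ (j ℕ.* k))) (≡.sym (ℤ.neg-distribˡ-* (b j) (α ℤ.^ (j ℕ.* k)))))))
      (ℤₚ.trans (∑ₚ.∑<-+ s (λ j → a j ℤ.* α ℤ.^ (j ℕ.* k)) (λ j → ℤ.- (b j ℤ.* α ℤ.^ (j ℕ.* k))))
        (≈ₘ-+ {dot a k} (≡⇒≈ₘ ≡.refl) (∑ₚ.sum-neg {s} (λ j → b (toℕ j) ℤ.* α ℤ.^ (toℕ j ℕ.* k)))))

    [mod]⇒≈ₘ : ∀ {x y} → x ≡ y [mod p ] → x ≈ₘ y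
    [mod]⇒≈ₘ d = modulo (ℤ.∣ᵤ⇒∣ d)

    ≈ₘ⇒[mod] : ∀ {x y} → x ≈ₘ y → x ≡ y [mod p ]
    ≈ₘ⇒[mod] (modulo d) = ℤ.∣⇒∣ᵤ d

    lin∈𝓜 : ∀ {x} a → x ≈ lin a → (∀ k → k ℕ.< m → dot a k ≈ₘ + 0) → x ∈ 𝓜 L ι K σ t p s α
    lin∈𝓜 a x≈ dot≈0 = lin∈𝓞 a x≈ , a ∘ toℕ ,
      trans x≈ (∑<-cong s λ i _ → *-congʳ {σ^ i t} (sym (fromℤ≈⟦⟧ (a i)))) ,
      ⇒congruences (λ k k<m → ≈ₘ⇒[mod] (dot≈0 k k<m))

    -- Membership in 𝓜 supplies some coordinate vector satisfying the congruences; uniqueness of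
    -- coordinates identifies it with `a`.
    𝓜⇒dot≈0 : ∀ {x} a → x ≈ lin a → x ∈ 𝓜 L ι K σ t p s α → ∀ k → k ℕ.< m → dot a k ≈ₘ + 0
    𝓜⇒dot≈0 {x} a x≈ (_ , a′ , x≈′ , cong) k k<m = ℤₚ.trans
      (∑ₚ.∑<-cong s {λ j → a j ℤ.* α ℤ.^ (j ℕ.* k)} {λ j → a″ j ℤ.* α ℤ.^ (j ℕ.* k)} λ j j<s → ≡⇒≈ₘ (≡.cong (ℤ._* α ℤ.^ (j ℕ.* k)) (≡.sym (ℤ.i-j≡0⇒i≡j (a″ j) (a j) (a″⊖a≡0 j j<s)))))
      (ℤₚ.trans (≡⇒≈ₘ (ℤ-sum-cong λ j → ≡.cong (ℤ._* α ℤ.^ (toℕ j ℕ.* k)) (a″-toℕ j)))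
        ([mod]⇒≈ₘ (congruences⇒ cong k k<m)))
      where
      open import Algebra.Properties.CommutativeMonoid.Sum ℤ.+-0-commutativeMonoid using () renaming (sum-cong-≗ to ℤ-sum-cong)
      a″ : ℕ → ℤ
      a″ j with j ℕ.<? s
      ... | yes j<s = a′ (Fin.fromℕ< j<s)
      ... | no  _   = + 0
      a″-toℕ : ∀ j → a″ (toℕ j) ≡ a′ j
      a″-toℕ j with toℕ j ℕ.<? s
      ... | yes j<s = ≡.cong a′ (Fin.fromℕ<-toℕ j j<s)
      ... | no  j≮s = contradiction (Fin.toℕ<n j) j≮s
      a″⊖a≡0 : ∀ j → j ℕ.< s → (a″ ⊖ a) j ≡ + 0
      a″⊖a≡0 = coordinates-unique (a″ ⊖ a) (trans (lin-⊖ a″ a) (≈⇒-≈0 (begin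
        lin a″
          ≈⟨ sum-cong-≋ {s} (λ j → *-congʳ {σ^ (toℕ j) t} (trans (⟦⟧-cong (a″-toℕ j)) (sym (fromℤ≈⟦⟧ (a′ j))))) ⟩
        sum {s} (λ j → fromℤ L ι (a′ j) * σ^ (toℕ j) t)
          ≈⟨ x≈′ ⟨
        x
          ≈⟨ x≈ ⟩
        lin a ∎)))

    -- A number below p^m is read as the m residues that the transform takes on its coset.
    digit : Fin (p ℕ.^ m) → Fin m → Fin p
    digit = Fin.finToFun {p} {m}

    private
      prescribed : Fin (p ℕ.^ m) → ℕ → ℤ
      prescribed i k with k ℕ.<? m
      ... | yes k<m = + toℕ (digit i (Fin.fromℕ< k<m))
      ... | no  _   = + 0

      prescribed-toℕ : ∀ i k → prescribed i (toℕ k) ≡ + toℕ (digit i k)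
      prescribed-toℕ i k with toℕ k ℕ.<? m
      ... | yes k<m = ≡.cong (λ j → + toℕ (digit i j)) (Fin.fromℕ<-toℕ k k<m)
      ... | no  k≮m = contradiction (Fin.toℕ<n k) k≮m

    opaque
      representative : Fin (p ℕ.^ m) → ℕ → ℤ
      representative i = proj₁ (prescribe m m≤s (prescribed i))

      dot-representative : ∀ i k → dot (representative i) (toℕ k) ≈ₘ + toℕ (digit i k)
      dot-representative i k = ℤₚ.trans (proj₂ (prescribe m m≤s (prescribed i)) (toℕ k) (Fin.toℕ<n k)) (≡⇒≈ₘ (prescribed-toℕ i k))

    opaque
      class : (a : ℕ → ℤ) → Σ (Fin (p ℕ.^ m)) λ i → ∀ k → dot a (toℕ k) ≈ₘ + toℕ (digit i k)
      class a = Fin.funToFin {m} {p} (λ k → proj₁ (residueₘ (dot a (toℕ k)))) , λ k →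
        ℤₚ.trans (proj₂ (residueₘ (dot a (toℕ k))))
          (≡⇒≈ₘ (≡.cong (λ r → + toℕ r) (≡.sym (Fin.finToFun-funToFin {m} {p} (λ k → proj₁ (residueₘ (dot a (toℕ k)))) k))))

    funToFin-cong : ∀ {l q} {f g : Fin l → Fin q} → (∀ k → f k ≡ g k) → Fin.funToFin f ≡ Fin.funToFin g
    funToFin-cong {zero}  f≡g = ≡.refl
    funToFin-cong {suc l} f≡g = ≡.cong₂ Fin.combine (f≡g zero) (funToFin-cong (f≡g ∘ suc))

    digit-injective : ∀ {i j} → (∀ k → digit i k ≡ digit j k) → i ≡ j
    digit-injective {i} {j} eq = ≡.trans (≡.sym (Fin.funToFin-finToFin {m} {p} i)) (≡.trans (funToFin-cong {m} {p} eq) (Fin.funToFin-finToFin {m} {p} j))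

    -- Two elements of 𝓞 are congruent modulo 𝓜 exactly when their first m transform values agree
    -- modulo p, and every tuple of residues occurs.
    hasIndex : HasIndex L (𝓞 L ι K) (𝓜 L ι K σ t p s α) (p ℕ.^ m)
    hasIndex = lin ∘ representative , (λ i → lin∈𝓞 (representative i) refl) , λ x x∈𝓞 → unique x (𝓞⇒lin x∈𝓞)
      where
      unique : ∀ x → (Σ (ℕ → ℤ) λ a → x ≈ lin a) → ∃! _≡_ λ i → x - lin (representative i) ∈ 𝓜 L ι K σ t p s α
      unique x (a , x≈) = proj₁ (class a) , lin∈𝓜 (a ⊖ representative (proj₁ (class a))) (difference (proj₁ (class a)))
          (λ k k<m → ≡.subst (λ l → dot (a ⊖ representative (proj₁ (class a))) l ≈ₘ + 0) (Fin.toℕ-fromℕ< k<m) (dot≈0 (Fin.fromℕ< k<m))) ,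
          λ {j} x∈𝓜 → digit-injective λ k → Fin.toℕ-injective (+-injectiveₘ (Fin.toℕ<n (digit (proj₁ (class a)) k)) (Fin.toℕ<n (digit j k))
            (ℤₚ.trans (ℤₚ.sym (proj₂ (class a) k)) (ℤₚ.trans (same j x∈𝓜 k) (dot-representative j k))))
        where
        difference : ∀ i → x - lin (representative i) ≈ lin (a ⊖ representative i)
        difference i = trans (+-congʳ x≈) (sym (lin-⊖ a (representative i)))
        dot≈0 : ∀ (k : Fin m) → dot (a ⊖ representative (proj₁ (class a))) (toℕ k) ≈ₘ + 0
        dot≈0 k = ℤₚ.trans (dot-⊖ a (representative (proj₁ (class a))) (toℕ k))
          (ℤₚ.trans (ℤₚ.+-cong (proj₂ (class a) k) (ℤₚ.-‿cong (dot-representative (proj₁ (class a)) k)))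
            (ℤₚ.-‿inverseʳ (+ toℕ (digit (proj₁ (class a)) k))))
        same : ∀ j → x - lin (representative j) ∈ 𝓜 L ι K σ t p s α → ∀ (k : Fin m) → dot a (toℕ k) ≈ₘ dot (representative j) (toℕ k)
        same j x∈𝓜 k = -≈ₘ0⇒≈ₘ (ℤₚ.trans (ℤₚ.sym (dot-⊖ a (representative j) (toℕ k)))
          (𝓜⇒dot≈0 (a ⊖ representative j) (difference j) x∈𝓜 (toℕ k) (Fin.toℕ<n k)))

-- Replacing the integer generator by its remainder modulo p.

module Generator (p : ℕ) .{{_ : ℕ.NonZero p}} (u : ℤ) (generatesUnits : GeneratesUnits p u) where

  open IntegersMod p
  open GeneratesUnits generatesUnits
  private
    module ℤₚ = CommutativeRing ℤ/q

  v : ℕ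
  v = u ℤ.%ℕ p

  u≡v+qp : u ≡ + v ℤ.+ u ℤ./ℕ p ℤ.* + p
  u≡v+qp = ℤ.a≡a%ℕn+[a/ℕn]*n u p

  u≈v : u ≈ₘ + v
  u≈v = modulo (ℤ.divides (u ℤ./ℕ p) (≡.trans (≡.cong (ℤ._- + v) u≡v+qp)
    (ℤsolve 2 (λ x y → (x ⊕ y) ⊝ x ⊜ y) ≡.refl (+ v) (u ℤ./ℕ p ℤ.* + p))))

  p∤v : ¬ p ℕ.∣ v
  p∤v p∣v = unit (ℤ.∣⇒∣ᵤ (_≈ₘ_.divides (ℤₚ.trans {u} {+ v} {+ 0} u≈v (modulo (≡.subst (+ p ℤ.∣_) (≡.sym (ℤ.+-identityʳ (+ v))) (ℤ.∣ᵤ⇒∣ {+ p} {+ v} p∣v))))))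

  u^≈v^ : ∀ k → u ℤ.^ k ≈ₘ + (v ℕ.^ k)
  u^≈v^ zero    = ≡⇒≈ₘ ≡.refl
  u^≈v^ (suc k) = ℤₚ.trans (≈ₘ-* u≈v (u^≈v^ k)) (≡⇒≈ₘ (≡.sym (ℤ.pos-* v (v ℕ.^ k))))

  powers : ∀ j → 0 ℕ.< j → j ℕ.< p → ∃ λ k → v ℕ.^ k ℕ.% p ≡ j
  powers j 0<j j<p = result (generates (+ j) λ j≡0 → ℕ.<⇒≱ j<p (ℕ.∣⇒≤ {{ℕ.>-nonZero 0<j}} (≡.subst (p ℕ.∣_) (≡.cong ℤ.∣_∣ (ℤ.+-identityʳ (+ j))) j≡0)))
    where
    result : (∃ λ k → + j ≡ u ℤ.^ k [mod p ]) → ∃ λ k → v ℕ.^ k ℕ.% p ≡ j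
    result (k , j≡u^k) = k , ≡.trans (≡.sym ([mod]⇒%≡ p j (v ℕ.^ k) (ℤ.∣⇒∣ᵤ (_≈ₘ_.divides (ℤₚ.trans {+ j} {u ℤ.^ k} (modulo (ℤ.∣ᵤ⇒∣ j≡u^k)) (u^≈v^ k))))))
      (ℕ.m<n⇒m%n≡m j<p)

-- The number of congruences in each parity.

half : ∀ k → suc (suc k) ℕ./ 2 ≡ suc (k ℕ./ 2)
half k = ℕ.m/n≡1+[m∸n]/n {suc (suc k)} (s≤s (s≤s z≤n))

odd-count : ∀ s → .{{ℕ.NonZero s}} → (s ℕ.+ 1) ℕ./ 2 ≡ suc ((s ∸ 1) ℕ./ 2)
odd-count (suc s) = ≡.trans (≡.cong (ℕ._/ 2) (ℕ.+-comm (suc s) 1)) (half s)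

even-count : ∀ s → (s ℕ.+ 2) ℕ./ 2 ≡ suc (s ℕ./ 2)
even-count s = ≡.trans (≡.cong (ℕ._/ 2) (ℕ.+-comm s 2)) (half s)

odd-count≤ : ∀ s → .{{ℕ.NonZero s}} → (s ℕ.+ 1) ℕ./ 2 ℕ.≤ s
odd-count≤ (suc s) = ≡.subst (ℕ._≤ suc s) (≡.sym (odd-count (suc s))) (s≤s (ℕ.m/n≤m s 2))

-- A positive even s is at least 2, which is just enough for s / 2 + 1 ≤ s; for s = 1 parity rules
-- the case out.
even-count≤ : ∀ s → .{{ℕ.NonZero s}} → s ℕ.% 2 ≡ 0 → (s ℕ.+ 2) ℕ./ 2 ℕ.≤ s
even-count≤ (suc (suc s)) _ = ≡.subst (ℕ._≤ suc (suc s)) (≡.sym (even-count (suc (suc s)))) (s≤s (≡.subst (ℕ._≤ suc s) (≡.sym (half s)) (s≤s (ℕ.m/n≤m s 2))))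

open import Data.Nat.Base using (NonZero; _+_; _^_)
open import Data.Nat.DivMod using (_/_; _%_)
open import Data.Nat.Divisibility using (_∣_)

theorem17 :
  ∀ {c ℓ k : Level} (p s : ℕ) .{{_ : NonZero s}} → Prime p → s ∣ p ∸ 1 →
  (L : CommutativeRing c ℓ) →
  let open CommutativeRing L using (Carrier) in
  (ι : ℚ → Carrier) (ζ : Carrier) → IsCyclotomicField L ι p ζ →
  (K : Pred Carrier k) → IsSubfield L K → HasDegree L ι K s →
  (u : ℤ) → GeneratesUnits p u →
  (σ : Carrier → Carrier) → IsAutomorphism L σ → IsPower L (σ ζ) ζ u →
  (t : Carrier) → IsTrace L K ζ t →
  (β : ℤ) → HasOrderMod p β (p ∸ 1) →
  let α = β ℤ.^ ((p ∸ 1) / s)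
      O = 𝓞 L ι K
      M = 𝓜 L ι K σ t p s α
  in (s % 2 ≡ 1 → HasIndex L O M (p ^ ((s + 1) / 2)))
   × (s % 2 ≡ 0 → HasIndex L O M (p ^ ((s + 2) / 2)))
theorem17 zero          s () _
theorem17 (suc zero)    s () _
theorem17 (suc (suc n)) s p-prime s∣N L ι ζ cyclotomic K subfield degree u generatesUnits σ σ-auto σζ t isTrace β order =
    -- The indices 0, ..., (s - 1) / 2 are (s + 1) / 2 in number, so i ≤ (s - 1) / 2 becomes k < m;
    -- the clause for the other parity is vacuous.
    (λ odd → index ((s ℕ.+ 1) ℕ./ 2) (odd-count≤ s)
      (λ congruences k k<m → Congruences.odd congruences odd k (ℕ.≤-pred (≡.subst (k ℕ.<_) (odd-count s) k<m)))
      (λ congruent → record { odd  = λ _ k k≤ → congruent k (≡.subst (k ℕ.<_) (≡.sym (odd-count s)) (s≤s k≤))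
                    ; even = λ even → contradiction (≡.trans (≡.sym odd) even) λ () }))
  , (λ even → index ((s ℕ.+ 2) ℕ./ 2) (even-count≤ s even)
      (λ congruences k k<m → Congruences.even congruences even k (ℕ.≤-pred (≡.subst (k ℕ.<_) (even-count s) k<m)))
      (λ congruent → record { even = λ _ k k≤ → congruent k (≡.subst (k ℕ.<_) (≡.sym (even-count s)) (s≤s k≤))
                    ; odd  = λ odd → contradiction (≡.trans (≡.sym even) odd) λ () }))
  where
  p N e : ℕ
  p = suc (suc n)
  N = suc n
  e = N ℕ./ s
  open IntegersMod p
  open Generator p u generatesUnits
  e*s≡N : e ℕ.* s ≡ N
  e*s≡N = ℕ.m/n*n≡m s∣N
  0<e : 0 ℕ.< e
  0<e = ℕ.m≥n⇒m/n>0 {N} {s} (ℕ.∣⇒≤ s∣N)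
  α : ℤ
  α = β ℤ.^ e
  α^s≈1 : α ℤ.^ s ≈ₘ + 1
  α^s≈1 = ≡.subst (_≈ₘ + 1) (≡.sym (≡.trans (ℤ.^-*-assoc β e s) (≡.cong (β ℤ.^_) e*s≡N))) (modulo (ℤ.∣ᵤ⇒∣ (HasOrderMod.power-one order)))
  α^k≉1 : ∀ k → 0 ℕ.< k → k ℕ.< s → ¬ α ℤ.^ k ≈ₘ + 1
  α^k≉1 k 0<k k<s eq = HasOrderMod.minimal order (e ℕ.* k) (ℕ.*-mono-< 0<e 0<k)
    (≡.subst (e ℕ.* k ℕ.<_) e*s≡N (ℕ.*-monoʳ-< e {{ℕ.>-nonZero 0<e}} k<s))
    (ℤ.∣⇒∣ᵤ (_≈ₘ_.divides (≡.subst (_≈ₘ + 1) (ℤ.^-*-assoc β e k) eq)))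
  index : ∀ m → m ℕ.≤ s → (∀ {a} → Congruences p s α a → ∀ k → k ℕ.< m → a · μ α k ≡ + 0 [mod p ]) →
          (∀ {a} → (∀ k → k ℕ.< m → a · μ α k ≡ + 0 [mod p ]) → Congruences p s α a) →
          HasIndex L (𝓞 L ι K) (𝓜 L ι K σ t p s α) (p ℕ.^ m)
  index = CyclotomicField.Index.hasIndex L ι n p-prime ζ cyclotomic v p∤v powers σ σ-auto
    (CyclotomicField.IsPower⇒ L ι n p-prime ζ cyclotomic u v u≡v+qp σζ) K subfield s degree t isTrace
    e (≡.cong suc e*s≡N) α α^s≈1 α^k≉1
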